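{- On standard Young tableaux, the equivalence relation $\equiv^0$ is a refinement of $\equiv^1$, which in turn is a refinement of $\equiv^2$; that is, $T\equiv^0T'$ implies $T\equiv^1T'$, and $T\equiv^1T'$ implies $T\equiv^2T'$.
   Context: Tableaux. Partition diagrams are in French notation: left-justified, rows numbered from bottom to top, row $r$ having $\lambda_r$ cells. $\mathrm{SYT}(\lambda)$ is the set of fillings of $\lambda\vdash n$ by $1,\dots,n$ (each used once), increasing left to right along rows and bottom to top up columns; $\mathrm{SYT}(n)=\bigcup_{\lambda\vdash n}\mathrm{SYT}(\lambda)$. The superstandard tableau $U_\lambda$ is the one whose bottom row is $1,\dots,\lambda_1$, whose second row is $\lambda_1+1,\dots,\lambda_1+\lambda_2$, and so on. The row reading word $\mathrm{rw}(T)$ reads each row left to right, starting with the top row and going down; cells are ordered by this reading order. For a permutation $\pi\in S_n$ in one-line notation, $\mathrm{ID}(\pi)$ is the set of $i\in[n-1]$ such that $i$ occurs to the right of $i+1$; $\mathrm{ID}(T)=\mathrm{ID}(\mathrm{rw}(T))$. Runs. Write $\mathrm{ID}(T)\cup\{n\}=\{b_1<\dots<b_m\}$, $b_0=0$. The $r$-th run of $T$ is the set of cells with entries in $(b_{r-1},b_r]$; $\beta_r(T)=b_r-b_{r-1}$. Within a run, entries increase in reading order, so $T$ is determined by the sequence of cell sets of its runs. The first $r$ runs of $T$ form the standard Young tableau consisting of entries $\le b_r$. The maps $\mathrm{slink},\mathrm{slink}_*$ on $\mathrm{SYT}(\lambda)$. Let $j$ be minimal such that the first $j$ runs of $T$ do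 not form a superstandard tableau. If no such $j$ exists ($T=U_\lambda$), both maps fix $T$. Otherwise ($j\ge2$): (1) $\mathrm{slink}(T)$ has the same runs as $T$ except runs $j-1$ and $j$: among the cells of runs $j-1$ and $j$ of $T$ lying strictly below row $j$, the first $\beta_j(T)-1$ in reading order form the new $(j-1)$-th run, and the remaining ones together with the cells of run $j$ in row $j$ form the new $j$-th run. (2) Let $\mu$ be the shape of the first $j$ runs of $T$ and let $i\ge1$ be minimal with $\mu_{i+1}\le\beta_j(T)+i-j$ (so $i\le j-1$). $\mathrm{slink}_*(T)$ has the same runs as $T$ except runs $i$ and $j$: among the cells of runs $i$ and $j$ of $T$ lying strictly below row $i+1$, the first $\beta_j(T)+i-j$ in reading order form the new $i$-th run, and the remaining ones together with the cells of run $j$ in rows $\ge i+1$ form the new $j$-th run. Elementary dual equivalence. $d_i$ acts on a permutation by: $\ldots i\ldots i-1\ldots i+1\ldots\leftrightarrow\ldots i+1\ldots i-1\ldots i\ldots$ and $\ldots i\ldots i+1\ldots i-1\ldots\leftrightarrow\ldots i-1\ldots i+1\ldots i\ldots$ (all else fixed), and as the identity if $i$ is between $i-1$ and $i+1$. It acts on $\mathrm{SYT}(\lambda)$ through $\mathrm{rw}$. For $i\in[2,n-2]$, $d_i^R(T)=T$ if $i+1\in\mathrm{ID}(T)\cap\mathrm{ID}(d_i(T))$, and $d_i^R(T)=d_i(T)$ otherwise. Relations. $\equiv^0$, $\equiv^1$, $\equiv^2$ are the equivalence relations on standard Young tableaux generated by $T\sim\mathrm{slink}_*(T)$, by $T\sim\mathrm{slink}(T)$,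 and by $T\sim d_i^R(T)$ for all $i\in[2,n-2]$ ($n$ the size of $T$), respectively. -}

module Defs where

open import Data.Bool.Base using (if_then_else_)
open import Data.List.Base
  using (List; []; _∷_; _++_; applyUpTo; concat; drop; filter; find; length; map; reverse; take; zip)
open import Data.Nat.Properties using (_≟_; _≤?_; _<?_)
open import Data.List.Membership.DecPropositional _≟_ using (_∈?_)
import Data.List.Properties as List
open import Data.List.Relation.Binary.Permutation.Propositional using (_↭_)
open import Data.List.Relation.Binary.Prefix.Heterogeneous using (Prefix)
open import Data.List.Relation.Unary.All using (All)
open import Data.List.Relation.Unary.Linked using (Linked)
open import Data.Maybe.Base using (Maybe; maybe′)
open import Data.Nat.Base using (ℕ; zero; suc; _+_; _∸_; _≤_; _<_; _≥_; _>_)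
open import Data.Product.Base using (_×_; _,_; proj₁; proj₂; ∃-syntax)
import Data.Product.Properties as Product
open import Data.Sum.Base using (_⊎_)
open import Relation.Binary.Construct.Closure.Equivalence using (EqClosure)
open import Relation.Binary.Core using (Rel)
open import Relation.Binary.Definitions using (DecidableEquality)
open import Relation.Binary.PropositionalEquality using (_≡_; cong; sym; trans)
open import Relation.Nullary.Decidable using (Dec; does; ¬?; _×-dec_; _⊎-dec_)
open import Level using (0ℓ)

[1⋯_] : ℕ → List ℕ
[1⋯ n ] = applyUpTo suc n

-- The entry of index k, counted from 0, or the default value beyond the end.
nth : ℕ → List ℕ → ℕ → ℕ
nth default []       k       = default
nth default (x ∷ xs) zero    = x
nth default (x ∷ xs) (suc k) = nth default xs k

-- The 0-based index of the first occurrence (the length if there is none).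
position : ∀ {A : Set} → DecidableEquality A → A → List A → ℕ
position _≈?_ x []       = 0
position _≈?_ x (y ∷ ys) = if does (x ≈? y) then 0 else suc (position _≈?_ x ys)

------------------------------------------------------------------------
-- Tableaux (French notation)

-- The list of rows, bottom row first, each row read from left to right.
Tableau : Set
Tableau = List (List ℕ)

shape : Tableau → List ℕ
shape = map length

size : Tableau → ℕ
size T = length (concat T)

record IsPartition (μ : List ℕ) : Set where
  field
    positive   : All (_> 0) μ
    decreasing : Linked _≥_ μ

-- `Prefix _>_ upper lower`: the row `upper` is no longer than `lower`, and
-- each entry of it exceeds the entry of `lower` in the same column.
record IsSYT (T : Tableau) : Set where
  field
    partition : IsPartition (shape T)
    entries   : concat T ↭ [1⋯ size T ]
    rows      : All (Linked _<_) T
    columns   : Linked (λ lower upper → Prefix _>_ upper lower) T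

superstandard : List ℕ → Tableau
superstandard = from 0
  where
  from : ℕ → List ℕ → Tableau
  from k []      = []
  from k (m ∷ μ) = map (k +_) [1⋯ m ] ∷ from (k + m) μ

-- Row by row from the top row down, each row from left to right.
reading : ∀ {A : Set} → List (List A) → List A
reading rows = concat (reverse rows)

rw : Tableau → List ℕ
rw = reading

-- A cell is a pair (row , column), both numbered from 1.
Cell : Set
Cell = ℕ × ℕ

row : Cell → ℕ
row = proj₁

_≟ᶜ_ : DecidableEquality Cell
_≟ᶜ_ = Product.≡-dec _≟_ _≟_

cellRows : List ℕ → List (List Cell)
cellRows = from 1
  where
  from : ℕ → List ℕ → List (List Cell)
  from r []      = []
  from r (m ∷ μ) = map (r ,_) [1⋯ m ] ∷ from (suc r) μ

-- The cells of T with their entries, in reading order.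
labelledCells : Tableau → List (Cell × ℕ)
labelledCells T = zip (reading (cellRows (shape T))) (rw T)

-- The subtableau of the entries ≤ k, without the rows that become empty.
restrict : ℕ → Tableau → Tableau
restrict k T = filter (λ r → 0 <? length r) (map (filter (_≤? k)) T)

------------------------------------------------------------------------
-- Inverse descents and runs

pos : ℕ → List ℕ → ℕ
pos = position _≟_

-- ID(w) for a permutation w of [n], in increasing order.
IDʷ : List ℕ → List ℕ
IDʷ w = filter (λ i → pos (suc i) w <? pos i w) [1⋯ length w ∸ 1 ]

ID : Tableau → List ℕ
ID T = IDʷ (rw T)

-- b₁ < ⋯ < bₘ
breaks : Tableau → List ℕ
breaks T = ID T ++ size T ∷ []

-- bᵣ for 0 ≤ r ≤ m; the default value is used only for r > m.
b : Tableau → ℕ → ℕ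
b T r = nth (size T) (0 ∷ breaks T) r

β : Tableau → ℕ → ℕ
β T r = b T r ∸ b T (r ∸ 1)

runIndices : Tableau → List ℕ
runIndices T = [1⋯ length (breaks T) ]

InRun : Tableau → ℕ → ℕ → Set
InRun T r x = b T (r ∸ 1) < x × x ≤ b T r

inRun? : ∀ T r x → Dec (InRun T r x)
inRun? T r x = (b T (r ∸ 1) <? x) ×-dec (x ≤? b T r)

-- The cells of the r-th run, in reading order.
run : Tableau → ℕ → List Cell
run T r = map proj₁ (filter (λ c → inRun? T r (proj₂ c)) (labelledCells T))

-- The filling of the shape μ whose successive runs are the given sets of cells,
-- each listed in reading order: the k-th cell of the concatenation contains k.
fromRuns : List ℕ → List (List Cell) → Tableau
fromRuns μ runs = map (map (λ c → suc (position _≟ᶜ_ c (concat runs)))) (cellRows μ)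

------------------------------------------------------------------------
-- slink and slink⁎

Superstandard : Tableau → Set
Superstandard T = T ≡ superstandard (shape T)

superstandard? : ∀ T → Dec (Superstandard T)
superstandard? T = List.≡-dec (List.≡-dec _≟_) T (superstandard (shape T))

firstRuns : Tableau → ℕ → Tableau
firstRuns T r = restrict (b T r) T

-- The minimal j such that the first j runs do not form a superstandard tableau.
firstBadRun : Tableau → Maybe ℕ
firstBadRun T = find (λ r → ¬? (superstandard? (firstRuns T r))) (runIndices T)

-- The cells of runs i and j strictly below row h, in reading order.
cellsBelow : Tableau → (i j h : ℕ) → List Cell
cellsBelow T i j h =
  filter (λ c → row c <? h)
    (map proj₁
      (filter (λ c → inRun? T i (proj₂ c) ⊎-dec inRun? T j (proj₂ c)) (labelledCells T)))

replaceRuns : Tableau → (i j : ℕ) (runᵢ runⱼ : List Cell) → Tableau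
replaceRuns T i j runᵢ runⱼ = fromRuns (shape T) (map new (runIndices T))
  where
  new : ℕ → List Cell
  new r = if does (r ≟ i) then runᵢ else if does (r ≟ j) then runⱼ else run T r

-- The new j-th run is listed in reading order: its cells kept from run j lie in
-- higher rows than the cells of `below`.
slinkAt : Tableau → ℕ → Tableau
slinkAt T j = replaceRuns T (j ∸ 1) j (take k below) (kept ++ drop k below)
  where
  k     = β T j ∸ 1
  below = cellsBelow T (j ∸ 1) j j
  kept  = filter (λ c → row c ≟ j) (run T j)

slink : Tableau → Tableau
slink T = maybe′ (slinkAt T) T (firstBadRun T)

-- μᵢ₊₁, which is 0 beyond the last row.
part-suc : List ℕ → ℕ → ℕ
part-suc μ i = nth 0 μ i

-- The minimal i ≥ 1 with μᵢ₊₁ ≤ βⱼ + i - j; an integer inequality, hence without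
-- truncated subtraction.  For a standard T and j = firstBadRun T, i = j - 1
-- satisfies it, so the search up to j - 1 succeeds.
slink⁎Index : Tableau → ℕ → Maybe ℕ
slink⁎Index T j = find (λ i → part-suc μ i + j ≤? β T j + i) [1⋯ j ∸ 1 ]
  where
  μ = shape (firstRuns T j)

slink⁎At : Tableau → (j i : ℕ) → Tableau
slink⁎At T j i = replaceRuns T i j (take k below) (kept ++ drop k below)
  where
  k     = (β T j + i) ∸ j
  below = cellsBelow T i j (suc i)
  kept  = filter (λ c → suc i ≤? row c) (run T j)

slink⁎ : Tableau → Tableau
slink⁎ T = maybe′ (λ j → maybe′ (slink⁎At T j) T (slink⁎Index T j)) T (firstBadRun T)

------------------------------------------------------------------------
-- Elementary dual equivalence

Between : List ℕ → (x y z : ℕ) → Set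
Between w x y z = (pos x w < pos y w × pos y w < pos z w) ⊎ (pos z w < pos y w × pos y w < pos x w)

between? : ∀ w x y z → Dec (Between w x y z)
between? w x y z =
  ((pos x w <? pos y w) ×-dec (pos y w <? pos z w)) ⊎-dec
  ((pos z w <? pos y w) ×-dec (pos y w <? pos x w))

transpose : (x y : ℕ) → ℕ → ℕ
transpose x y z = if does (z ≟ x) then y else if does (z ≟ y) then x else z

-- The permutation of values by which dᵢ acts on the word w.
dValues : ℕ → List ℕ → ℕ → ℕ
dValues i w =
  if does (between? w i (i ∸ 1) (suc i)) then transpose i (suc i)
  else if does (between? w (i ∸ 1) (suc i) i) then transpose (i ∸ 1) i
  else (λ x → x)

dʷ : ℕ → List ℕ → List ℕ
dʷ i w = map (dValues i w) w

d : ℕ → Tableau → Tableau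
d i T = map (map (dValues i (rw T))) T

rw-d : ∀ i T → rw (d i T) ≡ dʷ i (rw T)
rw-d i T = trans
  (cong concat (sym (List.reverse-map (map (dValues i (rw T))) T)))
  (List.concat-map (reverse T))

dᴿ : ℕ → Tableau → Tableau
dᴿ i T = if does ((suc i ∈? ID T) ×-dec (suc i ∈? ID (d i T))) then T else d i T

------------------------------------------------------------------------
-- The equivalence relations

-- The maps are total on fillings, but only standard tableaux generate.  All of
-- the maps send standard tableaux of shape μ to standard tableaux of shape μ, so
-- a nonstandard filling is related only to itself.
Generator⁰ Generator¹ Generator² : Rel Tableau 0ℓ
Generator⁰ T T′ = IsSYT T × T′ ≡ slink⁎ T
Generator¹ T T′ = IsSYT T × T′ ≡ slink T
Generator² T T′ = IsSYT T × ∃[ i ] 2 ≤ i × i ≤ size T ∸ 2 × T′ ≡ dᴿ i T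

infix 4 _≡⁰_ _≡¹_ _≡²_

_≡⁰_ _≡¹_ _≡²_ : Rel Tableau 0ℓ
_≡⁰_ = EqClosure Generator⁰
_≡¹_ = EqClosure Generator¹
_≡²_ = EqClosure Generator²

{-# OPTIONS --safe #-}

-- A standard tableau amounts to the semistandard filling by the indices of its runs, and slink
-- and slink⁎ exchange cells between two runs.  Let j be the first bad run of T and let i be the
-- index used by slink⁎.  If i = j - 1, then slink⁎ T = slink T.  Otherwise slink T has first bad
-- run j - 1 and the same index i, and slink⁎ (slink T) = slink (slink⁎ T); so T ≡¹ slink⁎ T
-- follows by induction on j.
--
-- For the second refinement, list the cells by increasing entry.  Runs j - 1 and j of T occupy a
-- segment z…z o…o z…z of this list, where the o are the cells in row j and the z, listed in reading
-- order, those below it; slink only moves the block of o's within the segment.  Exchanging two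
-- neighbours z and o is an elementary dual equivalence if a z precedes them or an o follows them,
-- and dᴿ does not block it as long as the last z of the segment stays in place.  Such exchanges
-- move the block of o's step by step, through standard tableaux because the words stay ballot.

module Submission where

open import Defs
open import Data.Bool.Base using (Bool; true; false; if_then_else_)
open import Data.Empty using (⊥; ⊥-elim)
open import Data.List.Base
  using (List; []; _∷_; [_]; _++_; applyUpTo; concat; drop; filter; length; map; replicate; reverse; take; zip)
open import Data.List.Membership.Propositional using (_∈_; _∉_; find)
open import Data.List.Membership.Propositional.Properties
  using (∈-++⁺ˡ; ∈-++⁺ʳ; ∈-++⁻; ∈-map⁺; ∈-map⁻; ∈-filter⁺; ∈-filter⁻; ∈-concat⁺′; ∈-concat⁻′; ∈-applyUpTo⁺; ∈-applyUpTo⁻; ∈-∃++)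
open import Data.List.Membership.Propositional.Properties.WithK using (unique∧set⇒bag)
import Data.List.Base as List using (find)
import Data.List.Properties as List
open import Data.List.Relation.Binary.BagAndSetEquality using (∼bag⇒↭)
open import Data.List.Relation.Binary.Permutation.Propositional as ↭ using (_↭_; ↭-sym; ↭-trans; ↭-reflexive; ↭⇒↭ₛ)
import Data.List.Relation.Binary.Permutation.Propositional.Properties as Perm
import Data.List.Relation.Binary.Permutation.Setoid.Properties as SetoidPerm
open import Data.List.Relation.Binary.Prefix.Heterogeneous as Prefix using (Prefix; []; _∷_)
open import Data.List.Relation.Binary.Subset.Propositional using (_⊆_)
open import Data.List.Relation.Unary.All as All using (All; []; _∷_)
import Data.List.Relation.Unary.All.Properties as All
open import Data.List.Relation.Unary.AllPairs as AllPairs using (AllPairs; []; _∷_)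
import Data.List.Relation.Unary.AllPairs.Properties as AllPairs
open import Data.List.Relation.Unary.Any using (here; there)
open import Data.List.Relation.Unary.Linked as Linked using (Linked; []; [-]; _∷_)
import Data.List.Relation.Unary.Linked.Properties as Linked
open import Data.List.Relation.Unary.Unique.Propositional using (Unique)
open import Data.Maybe.Base using (just; nothing; maybe′)
open import Data.Nat.Base using (ℕ; zero; suc; pred; _+_; _∸_; _⊓_; _≤_; _<_; _≥_; _>_; z≤n; s≤s; s≤s⁻¹; z<s; s<s; s<s⁻¹)
open import Data.Nat.Properties
open import Data.List.Membership.DecPropositional _≟_ using (_∈?_)
open import Data.Product using (∃₂; ∃-syntax; _×_; _,_; proj₁; proj₂)
import Data.Product.Properties as Product
open import Data.Sum.Base using (_⊎_; inj₁; inj₂)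
open import Data.Unit.Base using (⊤)
open import Function.Base using (_∘_; id; _on_; case_of_)
open import Function.Bundles using (_⇔_; mk⇔; Equivalence)
open import Level using (0ℓ)
open import Relation.Binary.Construct.Closure.Equivalence as EqC using (EqClosure)
open import Relation.Binary.Construct.Closure.ReflexiveTransitive using (ε; _◅_; _◅◅_)
open import Relation.Binary.Construct.Closure.Symmetric using (fwd; bwd)
open import Relation.Binary.Core using (Rel)
open import Relation.Binary.Definitions using (Asymmetric; DecidableEquality; Transitive; tri<; tri≈; tri>)
open import Relation.Binary.PropositionalEquality
  using (_≡_; _≢_; refl; sym; trans; cong; cong₂; subst; subst₂; setoid; module ≡-Reasoning)
open import Relation.Nullary.Decidable using (Dec; yes; no; does; dec-true; dec-false; decidable-stable; ¬?; _⊎-dec_)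
open import Relation.Nullary.Negation using (¬_; contradiction)
open import Relation.Unary using (Pred; Decidable)

private
  variable
    A B : Set

-- Lists

∈-tail : ∀ {x y : A} {xs} → x ∈ y ∷ xs → x ≢ y → x ∈ xs
∈-tail (here x≡y) x≢y = contradiction x≡y x≢y
∈-tail (there x∈) x≢y = x∈

∈-remove : ∀ {x y : A} as {bs} → x ∈ as ++ y ∷ bs → x ≢ y → x ∈ as ++ bs
∈-remove []       x∈         x≢y = ∈-tail x∈ x≢y
∈-remove (a ∷ as) (here p)   x≢y = here p
∈-remove (a ∷ as) (there x∈) x≢y = there (∈-remove as x∈ x≢y)

unique-⊆⇒length≤ : ∀ {xs ys : List A} → Unique xs → xs ⊆ ys → length xs ≤ length ys
unique-⊆⇒length≤ {xs = []}     _        _ = z≤n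
unique-⊆⇒length≤ {xs = x ∷ xs} (x∉ ∷ u) f with ∈-∃++ (f (here refl))
... | as , bs , refl = subst (suc (length xs) ≤_) (sym (List.length-++-sucʳ as x bs))
  (s≤s (unique-⊆⇒length≤ u λ z∈ → ∈-remove as (f (there z∈)) λ z≡x → All.lookup x∉ z∈ (sym z≡x)))

unique-⊆-⊇⇒↭ : ∀ {xs ys : List A} → Unique xs → Unique ys → xs ⊆ ys → ys ⊆ xs → xs ↭ ys
unique-⊆-⊇⇒↭ u v f g = ∼bag⇒↭ (unique∧set⇒bag u v (mk⇔ f g))

unique-++⁻ : ∀ (xs : List A) {ys x} → Unique (xs ++ ys) → x ∈ xs → x ∉ ys
unique-++⁻ (y ∷ xs) (y∉ ∷ u) (here refl) x∈ys = All.lookup y∉ (∈-++⁺ʳ xs x∈ys) refl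
unique-++⁻ (y ∷ xs) (y∉ ∷ u) (there x∈)  x∈ys = unique-++⁻ xs u x∈ x∈ys

module _ {_≺_ : Rel A 0ℓ} (asym : Asymmetric _≺_) where

  asym⇒≢ : ∀ {x y} → x ≺ y → x ≢ y
  asym⇒≢ x≺x refl = asym x≺x x≺x

  sorted⇒unique : ∀ {xs} → AllPairs _≺_ xs → Unique xs
  sorted⇒unique = AllPairs.map asym⇒≢

  sorted-≡ : ∀ {xs ys} → AllPairs _≺_ xs → AllPairs _≺_ ys → xs ⊆ ys → ys ⊆ xs → xs ≡ ys
  sorted-≡ {[]}     {[]}     _ _ _ _ = refl
  sorted-≡ {[]}     {y ∷ ys} _ _ _ g = case g (here refl) of λ ()
  sorted-≡ {x ∷ xs} {[]}     _ _ f _ = case f (here refl) of λ ()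
  sorted-≡ {x ∷ xs} {y ∷ ys} (x≺ ∷ sx) (y≺ ∷ sy) f g with heads (f (here refl)) (g (here refl))
    where
    heads : x ∈ y ∷ ys → y ∈ x ∷ xs → x ≡ y
    heads (here p)  _         = p
    heads (there _) (here p)  = sym p
    heads (there p) (there q) = contradiction (All.lookup y≺ p) (asym (All.lookup x≺ q))
  ... | refl = cong (x ∷_) (sorted-≡ sx sy
    (λ z∈ → ∈-tail (f (there z∈)) λ { refl → asym⇒≢ (All.lookup x≺ z∈) refl })
    (λ z∈ → ∈-tail (g (there z∈)) λ { refl → asym⇒≢ (All.lookup y≺ z∈) refl }))

data Before {A : Set} (x y : A) : List A → Set where
  here  : ∀ {zs} → y ∈ zs → Before x y (x ∷ zs)
  there : ∀ {z zs} → Before x y zs → Before x y (z ∷ zs)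

module _ {x y : A} where

  before-∈ˡ : ∀ {zs} → Before x y zs → x ∈ zs
  before-∈ˡ (here _)  = here refl
  before-∈ˡ (there p) = there (before-∈ˡ p)

  before-∈ʳ : ∀ {zs} → Before x y zs → y ∈ zs
  before-∈ʳ (here y∈) = there y∈
  before-∈ʳ (there p) = there (before-∈ʳ p)

  before-++⁺ˡ : ∀ {as bs} → Before x y as → Before x y (as ++ bs)
  before-++⁺ˡ (here y∈) = here (∈-++⁺ˡ y∈)
  before-++⁺ˡ (there p) = there (before-++⁺ˡ p)

  before-++⁺ʳ : ∀ as {bs} → Before x y bs → Before x y (as ++ bs)
  before-++⁺ʳ []       p = p
  before-++⁺ʳ (a ∷ as) p = there (before-++⁺ʳ as p)

  before-++⁺ : ∀ {as bs} → x ∈ as → y ∈ bs → Before x y (as ++ bs)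
  before-++⁺ {_ ∷ as} (here refl) y∈ = here (∈-++⁺ʳ as y∈)
  before-++⁺          (there x∈)  y∈ = there (before-++⁺ x∈ y∈)

  before-++⁻ : ∀ as {bs} → Before x y (as ++ bs) →
    Before x y as ⊎ (x ∈ as × y ∈ bs) ⊎ Before x y bs
  before-++⁻ []       p         = inj₂ (inj₂ p)
  before-++⁻ (a ∷ as) (here y∈) with ∈-++⁻ as y∈
  ... | inj₁ y∈as = inj₁ (here y∈as)
  ... | inj₂ y∈bs = inj₂ (inj₁ (here refl , y∈bs))
  before-++⁻ (a ∷ as) (there p) with before-++⁻ as p
  ... | inj₁ q                = inj₁ (there q)
  ... | inj₂ (inj₁ (x∈ , y∈)) = inj₂ (inj₁ (there x∈ , y∈))
  ... | inj₂ (inj₂ q)         = inj₂ (inj₂ q)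

  before-total : ∀ {zs} → x ∈ zs → y ∈ zs → Before x y zs ⊎ x ≡ y ⊎ Before y x zs
  before-total (here refl) (here refl) = inj₂ (inj₁ refl)
  before-total (here refl) (there y∈)  = inj₁ (here y∈)
  before-total (there x∈)  (here refl) = inj₂ (inj₂ (here x∈))
  before-total (there x∈)  (there y∈) with before-total x∈ y∈
  ... | inj₁ p        = inj₁ (there p)
  ... | inj₂ (inj₁ p) = inj₂ (inj₁ p)
  ... | inj₂ (inj₂ p) = inj₂ (inj₂ (there p))

module _ {R : Rel A 0ℓ} where

  sorted-before⁻ : ∀ {x y zs} → AllPairs R zs → Before x y zs → R x y
  sorted-before⁻ (r ∷ _) (here y∈) = All.lookup r y∈
  sorted-before⁻ (_ ∷ s) (there p) = sorted-before⁻ s p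

  sorted-before⁺ : Asymmetric R → ∀ {x y zs} → AllPairs R zs → x ∈ zs → y ∈ zs → R x y → Before x y zs
  sorted-before⁺ asym s x∈ y∈ r with before-total x∈ y∈
  ... | inj₁ p           = p
  ... | inj₂ (inj₁ refl) = contradiction r (asym r)
  ... | inj₂ (inj₂ p)    = contradiction (sorted-before⁻ s p) (asym r)

  tabulate-before : ∀ {zs} → (∀ {x y} → Before x y zs → R x y) → AllPairs R zs
  tabulate-before {[]}     f = []
  tabulate-before {z ∷ zs} f = All.tabulate (λ y∈ → f (here y∈)) ∷ tabulate-before (f ∘ there)

module _ (_≟A_ : DecidableEquality A) where

  private
    posA : A → List A → ℕ
    posA = position _≟A_

  position-here : ∀ x xs → posA x (x ∷ xs) ≡ 0
  position-here x xs rewrite dec-true (x ≟A x) refl = refl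

  position-there : ∀ {x y} xs → x ≢ y → posA x (y ∷ xs) ≡ suc (posA x xs)
  position-there {x} {y} xs x≢y rewrite dec-false (x ≟A y) x≢y = refl

  position-++ʳ : ∀ {x} as bs → x ∉ as → posA x (as ++ bs) ≡ length as + posA x bs
  position-++ʳ []       bs x∉ = refl
  position-++ʳ (a ∷ as) bs x∉ = trans (position-there (as ++ bs) (λ { refl → x∉ (here refl) }))
    (cong suc (position-++ʳ as bs (x∉ ∘ there)))

  before⇒position< : ∀ {x y zs} → Unique zs → Before x y zs → posA x zs < posA y zs
  before⇒position< {x} {y} {z ∷ zs} (z∉ ∷ u) (here y∈)
    rewrite position-here z zs | position-there {y} {z} zs (λ { refl → All.lookup z∉ y∈ refl }) = z<s
  before⇒position< {x} {y} {z ∷ zs} (z∉ ∷ u) (there p)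
    rewrite position-there {x} {z} zs (λ { refl → All.lookup z∉ (before-∈ˡ p) refl })
          | position-there {y} {z} zs (λ { refl → All.lookup z∉ (before-∈ʳ p) refl })
    = s<s (before⇒position< u p)

  position<⇒before : ∀ {x y zs} → Unique zs → x ∈ zs → y ∈ zs → posA x zs < posA y zs → Before x y zs
  position<⇒before u x∈ y∈ lt with before-total x∈ y∈
  ... | inj₁ p           = p
  ... | inj₂ (inj₁ refl) = contradiction lt (<-irrefl refl)
  ... | inj₂ (inj₂ p)    = contradiction lt (<-asym (before⇒position< u p))

  map-position : ∀ (f : ℕ → B) {xs} → Unique xs → map (λ x → f (posA x xs)) xs ≡ applyUpTo f (length xs)
  map-position f {[]}     []       = refl
  map-position f {x ∷ xs} (x∉ ∷ u) = cong₂ _∷_ (cong f (position-here x xs))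
    (trans (List.map-cong-local (All.tabulate λ {y} y∈ → cong f (position-there {y} {x} xs λ { refl → All.lookup x∉ y∈ refl })))
           (map-position (f ∘ suc) u))

  applyUpTo-position : ∀ {e : A → B} {f : ℕ → B} {n xs x} → map e xs ≡ applyUpTo f n → x ∈ xs → e x ≡ f (posA x xs)
  applyUpTo-position {n = suc n} {y ∷ xs} {x} eq x∈ with x ≟A y
  ... | yes refl = List.∷-injectiveˡ eq
  ... | no x≢y   = applyUpTo-position {n = n} (List.∷-injectiveʳ eq) (∈-tail x∈ x≢y)
  applyUpTo-position {n = zero} {[]} _ ()

position-map : ∀ (_≟A_ : DecidableEquality A) (_≟B_ : DecidableEquality B) (f : A → B) {x xs} → x ∈ xs →
  (∀ {y} → y ∈ xs → f x ≡ f y → x ≡ y) → position _≟B_ (f x) (map f xs) ≡ position _≟A_ x xs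
position-map _≟A_ _≟B_ f {x} {y ∷ xs} x∈ inj with x ≟A y
... | yes refl = position-here _≟B_ (f x) (map f xs)
... | no x≢y   = trans (position-there _≟B_ (map f xs) (x≢y ∘ inj (here refl)))
  (cong suc (position-map _≟A_ _≟B_ f (∈-tail x∈ x≢y) (inj ∘ there)))

∈-[1⋯]⁺ : ∀ {n v} → 1 ≤ v → v ≤ n → v ∈ [1⋯ n ]
∈-[1⋯]⁺ {v = suc v} _ v<n = ∈-applyUpTo⁺ suc v<n

∈-[1⋯]⁻ : ∀ {n v} → v ∈ [1⋯ n ] → 1 ≤ v × v ≤ n
∈-[1⋯]⁻ v∈ with ∈-applyUpTo⁻ suc v∈
... | _ , i<n , refl = z<s , i<n

[1⋯]-sorted : ∀ n → AllPairs _<_ [1⋯ n ]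
[1⋯]-sorted n = AllPairs.applyUpTo⁺₁ suc n λ i<j _ → s<s i<j

module _ {P : Pred ℕ 0ℓ} (P? : Decidable P) where

  find-just⁻ : ∀ {xs j} → AllPairs _<_ xs → List.find P? xs ≡ just j →
    j ∈ xs × P j × (∀ {s} → s ∈ xs → s < j → ¬ P s)
  find-just⁻ {x ∷ xs} (x< ∷ sx) eq with P? x
  find-just⁻ {x ∷ xs} (x< ∷ sx) refl | yes px =
    here refl , px , λ { (here refl) s<s′ _ → <-irrefl refl s<s′ ; (there s∈) s<x _ → <-asym s<x (All.lookup x< s∈) }
  ... | no ¬px with find-just⁻ sx eq
  ...   | j∈ , pj , min = there j∈ , pj , λ { (here refl) _ → ¬px ; (there s∈) → min s∈ }

  find-just⁺ : ∀ {xs j} → AllPairs _<_ xs → j ∈ xs → P j → (∀ {s} → s ∈ xs → s < j → ¬ P s) → List.find P? xs ≡ just j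
  find-just⁺ {x ∷ xs} (x< ∷ sx) (here refl) pj min rewrite dec-true (P? x) pj = refl
  find-just⁺ {x ∷ xs} (x< ∷ sx) (there j∈)  pj min rewrite dec-false (P? x) (min (here refl) (All.lookup x< j∈)) =
    find-just⁺ sx j∈ pj (min ∘ there)

-- Cells

col : Cell → ℕ
col = proj₂

infix 4 _<ᵣ_

-- c <ᵣ c′: the cell c precedes c′ in the reading order.
_<ᵣ_ : Rel Cell 0ℓ
c <ᵣ c′ = row c′ < row c ⊎ (row c ≡ row c′ × col c < col c′)

<ᵣ-asym : Asymmetric _<ᵣ_
<ᵣ-asym (inj₁ p)       (inj₁ q)       = <-asym p q
<ᵣ-asym (inj₁ p)       (inj₂ (e , _)) = <-irrefl e p
<ᵣ-asym (inj₂ (e , _)) (inj₁ q)       = <-irrefl e q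
<ᵣ-asym (inj₂ (_ , p)) (inj₂ (_ , q)) = <-asym p q

<ᵣ-irrefl : ∀ {c} → ¬ c <ᵣ c
<ᵣ-irrefl p = <ᵣ-asym p p

<ᵣ-trans : Transitive _<ᵣ_
<ᵣ-trans (inj₁ p)          (inj₁ q)          = inj₁ (<-trans q p)
<ᵣ-trans (inj₁ p)          (inj₂ (refl , _)) = inj₁ p
<ᵣ-trans (inj₂ (refl , _)) (inj₁ q)          = inj₁ q
<ᵣ-trans (inj₂ (refl , p)) (inj₂ (refl , q)) = inj₂ (refl , <-trans p q)

<ᵣ-total : ∀ c c′ → c <ᵣ c′ ⊎ c ≡ c′ ⊎ c′ <ᵣ c
<ᵣ-total (r , k) (r′ , k′) with <-cmp r r′
... | tri< r<r′ _ _ = inj₂ (inj₂ (inj₁ r<r′))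
... | tri> _ _ r>r′ = inj₁ (inj₁ r>r′)
... | tri≈ _ refl _ with <-cmp k k′
...   | tri< k<k′ _ _ = inj₁ (inj₂ (refl , k<k′))
...   | tri≈ _ refl _ = inj₂ (inj₁ refl)
...   | tri> _ _ k>k′ = inj₂ (inj₂ (inj₂ (refl , k>k′)))

<ᵣ-row : ∀ {c c′} → c <ᵣ c′ → row c′ ≤ row c
<ᵣ-row (inj₁ p)          = <⇒≤ p
<ᵣ-row (inj₂ (refl , _)) = ≤-refl

up : Cell → Cell
up (r , k) = suc r , k

up-<ᵣ : ∀ {c c′} → c <ᵣ c′ → up c <ᵣ up c′
up-<ᵣ (inj₁ p)          = inj₁ (s<s p)
up-<ᵣ (inj₂ (refl , p)) = inj₂ (refl , p)

filling : (Cell → A) → List ℕ → List (List A)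
filling e []      = []
filling e (m ∷ μ) = applyUpTo (λ k → e (1 , suc k)) m ∷ filling (e ∘ up) μ

-- The auxiliary functions of `cellRows` and `superstandard` are local to their
-- where blocks; they are recovered here by unification.
mutual
  rowsFrom : ℕ → List ℕ → List (List Cell)
  rowsFrom = _

  rowsFrom-1 : ∀ μ → cellRows μ ≡ rowsFrom 1 μ
  rowsFrom-1 μ with 1
  ... | r = refl {x = rowsFrom r μ}

mutual
  superstandardFrom : ℕ → List ℕ → Tableau
  superstandardFrom = _

  superstandardFrom-0 : ∀ μ → superstandard μ ≡ superstandardFrom 0 μ
  superstandardFrom-0 μ with 0
  ... | k = refl {x = superstandardFrom k μ}

map-rowsFrom : ∀ (e : Cell → A) s μ → map (map e) (rowsFrom (suc s) μ) ≡ filling (λ c → e (s + row c , col c)) μ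
map-rowsFrom e s []      = refl
map-rowsFrom e s (m ∷ μ) = cong₂ _∷_
  (begin
    map e (map (suc s ,_) [1⋯ m ]) ≡⟨ List.map-∘ [1⋯ m ] ⟨
    map (λ k → e (suc s , k)) [1⋯ m ] ≡⟨ List.map-applyUpTo suc (λ k → e (suc s , k)) m ⟩
    applyUpTo (λ k → e (suc s , suc k)) m ≡⟨ cong (λ r → applyUpTo (λ k → e (r , suc k)) m) (+-comm 1 s) ⟩
    applyUpTo (λ k → e (s + 1 , suc k)) m ∎)
  (trans (map-rowsFrom e (suc s) μ) (filling-cong′ μ λ c → cong (λ r → e (r , col c)) (sym (+-suc s (row c)))))
  where
  open ≡-Reasoning
  filling-cong′ : ∀ {f g : Cell → A} μ → (∀ c → f c ≡ g c) → filling f μ ≡ filling g μ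
  filling-cong′         []      eq = refl
  filling-cong′ {f = f} {g = g} (m ∷ μ) eq = cong₂ _∷_
    (trans (sym (List.map-applyUpTo suc (λ k → f (1 , k)) m))
      (trans (List.map-cong (λ k → eq (1 , k)) [1⋯ m ]) (List.map-applyUpTo suc (λ k → g (1 , k)) m)))
    (filling-cong′ μ (eq ∘ up))

map-cellRows : ∀ (e : Cell → A) μ → map (map e) (cellRows μ) ≡ filling e μ
map-cellRows e μ = map-rowsFrom e 0 μ

map-filling : ∀ (f : A → B) (e : Cell → A) μ → map (map f) (filling e μ) ≡ filling (f ∘ e) μ
map-filling f e []      = refl
map-filling f e (m ∷ μ) = cong₂ _∷_ (List.map-applyUpTo (λ k → e (1 , suc k)) f m) (map-filling f (e ∘ up) μ)

cellRows≡filling : ∀ μ → cellRows μ ≡ filling id μ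
cellRows≡filling μ = trans (sym (trans (List.map-cong List.map-id (cellRows μ)) (List.map-id (cellRows μ)))) (map-cellRows id μ)

reading-∷ : ∀ (xs : List A) xss → reading (xs ∷ xss) ≡ reading xss ++ xs
reading-∷ xs xss = begin
  concat (reverse (xs ∷ xss)) ≡⟨ cong concat (List.unfold-reverse xs xss) ⟩
  concat (reverse xss ++ [ xs ]) ≡⟨ List.concat-++ (reverse xss) [ xs ] ⟨
  concat (reverse xss) ++ (xs ++ []) ≡⟨ cong (concat (reverse xss) ++_) (List.++-identityʳ xs) ⟩
  concat (reverse xss) ++ xs ∎
  where open ≡-Reasoning

reading-map : ∀ (f : A → B) xss → reading (map (map f) xss) ≡ map f (reading xss)
reading-map f xss = trans (cong concat (sym (List.reverse-map (map f) xss))) (List.concat-map (reverse xss))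

reading↭concat : ∀ (xss : List (List A)) → reading xss ↭ concat xss
reading↭concat []         = ↭-reflexive refl
reading↭concat (xs ∷ xss) = ↭-trans (↭-reflexive (reading-∷ xs xss))
  (↭-trans (Perm.++-comm (reading xss) xs) (Perm.++⁺ˡ xs (reading↭concat xss)))

cells : List ℕ → List Cell
cells μ = reading (cellRows μ)

cells-∷ : ∀ m μ → cells (m ∷ μ) ≡ map up (cells μ) ++ applyUpTo (λ k → 1 , suc k) m
cells-∷ m μ = begin
  reading (cellRows (m ∷ μ)) ≡⟨ cong reading (cellRows≡filling (m ∷ μ)) ⟩
  reading (row₁ ∷ filling up μ) ≡⟨ reading-∷ row₁ (filling up μ) ⟩
  reading (filling up μ) ++ row₁ ≡⟨ cong (λ xss → reading xss ++ row₁) (map-cellRows up μ) ⟨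
  reading (map (map up) (cellRows μ)) ++ row₁ ≡⟨ cong (_++ row₁) (reading-map up (cellRows μ)) ⟩
  map up (cells μ) ++ row₁ ∎
  where
  open ≡-Reasoning
  row₁ = applyUpTo (λ k → 1 , suc k) m

∈-cells⁺ : ∀ {μ r k} → k < nth 0 μ r → (suc r , suc k) ∈ cells μ
∈-cells⁺ {m ∷ μ} {zero}  k<m = subst (_ ∈_) (sym (cells-∷ m μ))
  (∈-++⁺ʳ (map up (cells μ)) (∈-applyUpTo⁺ (λ k → 1 , suc k) k<m))
∈-cells⁺ {m ∷ μ} {suc r} k<  = subst (_ ∈_) (sym (cells-∷ m μ)) (∈-++⁺ˡ (∈-map⁺ up (∈-cells⁺ {μ} k<)))

∈-cells⁻ : ∀ μ {c} → c ∈ cells μ → ∃₂ λ r k → c ≡ (suc r , suc k) × k < nth 0 μ r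
∈-cells⁻ (m ∷ μ) c∈ with ∈-++⁻ (map up (cells μ)) (subst (_ ∈_) (cells-∷ m μ) c∈)
... | inj₂ c∈row with ∈-applyUpTo⁻ (λ k → 1 , suc k) c∈row
...   | k , k<m , refl = 0 , k , refl , k<m
∈-cells⁻ (m ∷ μ) c∈ | inj₁ c∈up with ∈-map⁻ up c∈up
...   | c′ , c′∈ , refl with ∈-cells⁻ μ c′∈
...     | r , k , refl , k< = suc r , k , refl , k<

cells-sorted : ∀ μ → AllPairs _<ᵣ_ (cells μ)
cells-sorted []      = []
cells-sorted (m ∷ μ) = subst (AllPairs _<ᵣ_) (sym (cells-∷ m μ)) (AllPairs.++⁺
  (AllPairs.map⁺ (AllPairs.map up-<ᵣ (cells-sorted μ)))
  (AllPairs.applyUpTo⁺₁ (λ k → 1 , suc k) m λ i<j _ → inj₂ (refl , s<s i<j))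
  (All.map⁺ (All.tabulate λ c∈ → All.applyUpTo⁺₁ (λ k → 1 , suc k) m λ _ → inj₁ (s<s (row-positive c∈)))))
  where
  row-positive : ∀ {c} → c ∈ cells μ → 0 < row c
  row-positive c∈ with ∈-cells⁻ μ c∈
  ... | _ , _ , refl , _ = z<s

cells-unique : ∀ μ → Unique (cells μ)
cells-unique μ = sorted⇒unique <ᵣ-asym (cells-sorted μ)

filling-cong : ∀ {f g : Cell → A} μ → (∀ {c} → c ∈ cells μ → f c ≡ g c) → filling f μ ≡ filling g μ
filling-cong         []      eq = refl
filling-cong {f = f} {g = g} (m ∷ μ) eq = cong₂ _∷_
  (trans (sym (List.map-applyUpTo (λ k → 1 , suc k) f m))
    (trans (List.map-cong-local (All.applyUpTo⁺₁ (λ k → 1 , suc k) m λ k<m → eq (∈-cells⁺ {m ∷ μ} k<m)))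
      (List.map-applyUpTo (λ k → 1 , suc k) g m)))
  (filling-cong μ λ c∈ → eq (subst (_ ∈_) (sym (cells-∷ m μ)) (∈-++⁺ˡ (∈-map⁺ up c∈))))

shape-filling : ∀ (e : Cell → ℕ) μ → shape (filling e μ) ≡ μ
shape-filling e []      = refl
shape-filling e (m ∷ μ) = cong₂ _∷_ (List.length-applyUpTo (λ k → e (1 , suc k)) m) (shape-filling (e ∘ up) μ)

rw-filling : ∀ (e : Cell → ℕ) μ → rw (filling e μ) ≡ map e (cells μ)
rw-filling e μ = trans (cong rw (sym (map-cellRows e μ))) (reading-map e (cellRows μ))

size-filling : ∀ (e : Cell → ℕ) μ → size (filling e μ) ≡ length (cells μ)
size-filling e μ = begin
  length (concat (filling e μ)) ≡⟨ Perm.↭-length (reading↭concat (filling e μ)) ⟨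
  length (rw (filling e μ)) ≡⟨ cong length (rw-filling e μ) ⟩
  length (map e (cells μ)) ≡⟨ List.length-map e (cells μ) ⟩
  length (cells μ) ∎
  where open ≡-Reasoning

zip-map : ∀ (f : A → B) xs → zip xs (map f xs) ≡ map (λ x → x , f x) xs
zip-map f []       = refl
zip-map f (x ∷ xs) = cong ((x , f x) ∷_) (zip-map f xs)

labelledCells-filling : ∀ (e : Cell → ℕ) μ → labelledCells (filling e μ) ≡ map (λ c → c , e c) (cells μ)
labelledCells-filling e μ = begin
  zip (reading (cellRows (shape (filling e μ)))) (rw (filling e μ))
    ≡⟨ cong₂ (λ ν → zip (reading (cellRows ν))) (shape-filling e μ) (rw-filling e μ) ⟩
  zip (cells μ) (map e (cells μ))
    ≡⟨ zip-map e (cells μ) ⟩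
  map (λ c → c , e c) (cells μ)
    ∎
  where open ≡-Reasoning

nthRow : Tableau → ℕ → List ℕ
nthRow []      r       = []
nthRow (R ∷ T) zero    = R
nthRow (R ∷ T) (suc r) = nthRow T r

entry : Tableau → Cell → ℕ
entry T (r , k) = nth 0 (nthRow T (r ∸ 1)) (k ∸ 1)

applyUpTo-nth : ∀ default xs → applyUpTo (nth default xs) (length xs) ≡ xs
applyUpTo-nth default []       = refl
applyUpTo-nth default (x ∷ xs) = cong (x ∷_) (applyUpTo-nth default xs)

tableau≡filling : ∀ T → T ≡ filling (entry T) (shape T)
tableau≡filling T = sym (go T (entry T) λ _ _ → refl)
  where
  go : ∀ T (e : Cell → ℕ) → (∀ r k → e (suc r , suc k) ≡ nth 0 (nthRow T r) k) → filling e (shape T) ≡ T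
  go []      e eq = refl
  go (R ∷ T) e eq = cong₂ _∷_
    (begin
      applyUpTo (λ k → e (1 , suc k)) (length R) ≡⟨ List.map-applyUpTo id (λ k → e (1 , suc k)) (length R) ⟨
      map (λ k → e (1 , suc k)) (applyUpTo id (length R)) ≡⟨ List.map-cong (eq 0) (applyUpTo id (length R)) ⟩
      map (nth 0 R) (applyUpTo id (length R)) ≡⟨ List.map-applyUpTo id (nth 0 R) (length R) ⟩
      applyUpTo (nth 0 R) (length R) ≡⟨ applyUpTo-nth 0 R ⟩
      R ∎)
    (go T (e ∘ up) (eq ∘ suc))
    where open ≡-Reasoning

record Standard (μ : List ℕ) (e : Cell → ℕ) : Set where
  field
    partition : IsPartition μ
    entries   : map e (cells μ) ↭ [1⋯ length (cells μ) ]
    rows      : ∀ {r k} → suc k < nth 0 μ r → e (suc r , suc k) < e (suc r , suc (suc k))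
    columns   : ∀ {r k} → k < nth 0 μ (suc r) → e (suc r , suc k) < e (suc (suc r) , suc k)

partition-≥ : ∀ {μ} → IsPartition μ → ∀ r → nth 0 μ (suc r) ≤ nth 0 μ r
partition-≥ π r = go (IsPartition.decreasing π) r
  where
  go : ∀ {μ} → Linked _≥_ μ → ∀ r → nth 0 μ (suc r) ≤ nth 0 μ r
  go []       r       = z≤n
  go [-]      r       = z≤n
  go (p ∷ ps) zero    = p
  go (p ∷ ps) (suc r) = go ps r

Linked-applyUpTo⁻ : ∀ {R : Rel A 0ℓ} (f : ℕ → A) {n k} → Linked R (applyUpTo f n) → suc k < n → R (f k) (f (suc k))
Linked-applyUpTo⁻ f {suc zero}            _        (s<s ())
Linked-applyUpTo⁻ f {suc (suc n)} {zero}  (r ∷ rs) _     = r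
Linked-applyUpTo⁻ f {suc (suc n)} {suc k} (r ∷ rs) (s<s k<) = Linked-applyUpTo⁻ (f ∘ suc) rs k<

Prefix-applyUpTo⁺ : ∀ {R : A → B → Set} (f : ℕ → A) (g : ℕ → B) {m n} → m ≤ n → (∀ {k} → k < m → R (f k) (g k)) →
  Prefix R (applyUpTo f m) (applyUpTo g n)
Prefix-applyUpTo⁺ f g {zero}          _         h = []
Prefix-applyUpTo⁺ f g {suc m} {suc n} (s≤s m≤n) h = h z<s ∷ Prefix-applyUpTo⁺ (f ∘ suc) (g ∘ suc) m≤n (h ∘ s<s)

Prefix-applyUpTo⁻ : ∀ {R : A → B → Set} (f : ℕ → A) (g : ℕ → B) {m n k} →
  Prefix R (applyUpTo f m) (applyUpTo g n) → k < m → R (f k) (g k)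
Prefix-applyUpTo⁻ f g {suc m} {suc n} {zero}  (r ∷ rs) _        = r
Prefix-applyUpTo⁻ f g {suc m} {suc n} {suc k} (r ∷ rs) (s<s k<) = Prefix-applyUpTo⁻ (f ∘ suc) (g ∘ suc) rs k<

private
  Above : Rel (List ℕ) 0ℓ
  Above lower upper = Prefix _>_ upper lower

Standard⇒IsSYT : ∀ {μ e} → Standard μ e → IsSYT (filling e μ)
Standard⇒IsSYT {μ} {e} std = record
  { partition = subst IsPartition (sym (shape-filling e μ)) partition
  ; entries   = ↭-trans (↭-sym (reading↭concat (filling e μ)))
      (↭-trans (↭-reflexive (rw-filling e μ))
        (↭-trans entries (↭-reflexive (cong [1⋯_] (sym (size-filling e μ))))))
  ; rows      = rows⁺ μ e rows
  ; columns   = columns⁺ μ e (partition-≥ partition) columns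
  }
  where
  open Standard std
  rows⁺ : ∀ μ e → (∀ {r k} → suc k < nth 0 μ r → e (suc r , suc k) < e (suc r , suc (suc k))) →
    All (Linked _<_) (filling e μ)
  rows⁺ []      e h = []
  rows⁺ (m ∷ μ) e h = Linked.applyUpTo⁺₁ (λ k → e (1 , suc k)) m (h {0}) ∷ rows⁺ μ (e ∘ up) λ {r} → h {suc r}
  columns⁺ : ∀ μ e → (∀ r → nth 0 μ (suc r) ≤ nth 0 μ r) →
    (∀ {r k} → k < nth 0 μ (suc r) → e (suc r , suc k) < e (suc (suc r) , suc k)) → Linked Above (filling e μ)
  columns⁺ []           e d h = []
  columns⁺ (m ∷ [])     e d h = [-]
  columns⁺ (m ∷ m′ ∷ μ) e d h =
    Prefix-applyUpTo⁺ (λ k → e (2 , suc k)) (λ k → e (1 , suc k)) (d 0) (h {0}) ∷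
    columns⁺ (m′ ∷ μ) (e ∘ up) (d ∘ suc) λ {r} → h {suc r}

IsSYT⇒Standard : ∀ {T} → IsSYT T → Standard (shape T) (entry T)
IsSYT⇒Standard {T} syt = record
  { partition = partition
  ; entries   = ↭-trans (↭-reflexive (sym (trans (cong rw (tableau≡filling T)) (rw-filling (entry T) (shape T)))))
      (↭-trans (reading↭concat T)
        (↭-trans entries (↭-reflexive (cong [1⋯_] (trans (cong size (tableau≡filling T)) (size-filling (entry T) (shape T)))))))
  ; rows      = rows⁻ (shape T) (entry T) (subst (All (Linked _<_)) (tableau≡filling T) rows)
  ; columns   = columns⁻ (shape T) (entry T) (subst (Linked Above) (tableau≡filling T) columns)
  }
  where
  open IsSYT syt
  rows⁻ : ∀ μ e → All (Linked _<_) (filling e μ) →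
    ∀ {r k} → suc k < nth 0 μ r → e (suc r , suc k) < e (suc r , suc (suc k))
  rows⁻ (m ∷ μ) e (p ∷ ps) {zero}  k< = Linked-applyUpTo⁻ (λ k → e (1 , suc k)) p k<
  rows⁻ (m ∷ μ) e (p ∷ ps) {suc r} k< = rows⁻ μ (e ∘ up) ps {r} k<
  columns⁻ : ∀ μ e → Linked Above (filling e μ) →
    ∀ {r k} → k < nth 0 μ (suc r) → e (suc r , suc k) < e (suc (suc r) , suc k)
  columns⁻ (m ∷ m′ ∷ μ) e (p ∷ ps) {zero}  k< = Prefix-applyUpTo⁻ (λ k → e (2 , suc k)) (λ k → e (1 , suc k)) p k<
  columns⁻ (m ∷ m′ ∷ μ) e (p ∷ ps) {suc r} k< = columns⁻ (m′ ∷ μ) (e ∘ up) ps {r} k<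

-- Standard fillings and their runs

label : List Cell → Cell → ℕ
label L c = suc (position _≟ᶜ_ c L)

tab : List ℕ → List Cell → Tableau
tab μ L = filling (label L) μ

fromRuns≡tab : ∀ μ Rs → fromRuns μ Rs ≡ tab μ (concat Rs)
fromRuns≡tab μ Rs = map-cellRows (label (concat Rs)) μ

∈-cells⇒< : ∀ {μ r k} → (suc r , suc k) ∈ cells μ → k < nth 0 μ r
∈-cells⇒< {μ} c∈ with ∈-cells⁻ μ c∈
... | _ , _ , refl , k< = k<

linear⇒Standard : ∀ {μ L} → IsPartition μ → L ↭ cells μ →
  (∀ {r k} → (r , suc k) ∈ cells μ → (r , k) ∈ cells μ → Before (r , k) (r , suc k) L) →
  (∀ {r k} → (suc r , k) ∈ cells μ → (r , k) ∈ cells μ → Before (r , k) (suc r , k) L) →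
  Standard μ (label L)
linear⇒Standard {μ} {L} π L↭ rows columns = record
  { partition = π
  ; entries   = ↭-trans (Perm.map⁺ (label L) (↭-sym L↭))
      (↭-reflexive (trans (map-position _≟ᶜ_ suc uniqueL) (cong [1⋯_] (Perm.↭-length L↭))))
  ; rows      = λ {r} k< → s<s (before⇒position< _≟ᶜ_ uniqueL
      (rows (∈-cells⁺ {μ} k<) (∈-cells⁺ {μ} (<-trans (n<1+n _) k<))))
  ; columns   = λ {r} k< → s<s (before⇒position< _≟ᶜ_ uniqueL
      (columns (∈-cells⁺ {μ} k<) (∈-cells⁺ {μ} (<-≤-trans k< (partition-≥ π r)))))
  }
  where
  uniqueL : Unique L
  uniqueL = SetoidPerm.Unique-resp-↭ (setoid Cell) (↭⇒↭ₛ (↭-sym L↭)) (cells-unique μ)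

nRuns : Tableau → ℕ
nRuns T = length (breaks T)

-- `R r` lists the cells of the r-th run.  Equivalently, mapping each cell to the index of its
-- run is a semistandard filling, and each run ends after the next one starts in reading order.
record Family (μ : List ℕ) (m : ℕ) (R : ℕ → List Cell) : Set where
  field
    partition : IsPartition μ
    positive  : 1 ≤ m
    range     : ∀ {r c} → c ∈ R r → 1 ≤ r × r ≤ m
    ⊆-cells   : ∀ {r c} → c ∈ R r → c ∈ cells μ
    cover     : ∀ {c} → c ∈ cells μ → ∃[ r ] c ∈ R r
    disjoint  : ∀ {r s c} → c ∈ R r → c ∈ R s → r ≡ s
    sorted    : ∀ r → AllPairs _<ᵣ_ (R r)
    rows      : ∀ {r s x k} → (x , k) ∈ R r → (x , suc k) ∈ R s → r ≤ s
    columns   : ∀ {r s x k} → (x , k) ∈ R r → (suc x , k) ∈ R s → r < s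
    descents  : ∀ {r} → 1 ≤ r → r < m → ∃₂ λ c c′ → c ∈ R r × c′ ∈ R (suc r) × c′ <ᵣ c

module StandardFilling {μ e} (std : Standard μ e) where
  open Standard std public

  n : ℕ
  n = length (cells μ)

  T : Tableau
  T = filling e μ

  entry-range : ∀ {c} → c ∈ cells μ → 1 ≤ e c × e c ≤ n
  entry-range c∈ = ∈-[1⋯]⁻ (Perm.∈-resp-↭ entries (∈-map⁺ e c∈))

  entry-surjective : ∀ {v} → 1 ≤ v → v ≤ n → ∃[ c ] c ∈ cells μ × e c ≡ v
  entry-surjective 1≤v v≤n with ∈-map⁻ e (Perm.∈-resp-↭ (↭-sym entries) (∈-[1⋯]⁺ 1≤v v≤n))
  ... | c , c∈ , refl = c , c∈ , refl

  entries-distinct : AllPairs (λ c c′ → e c ≢ e c′) (cells μ)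
  entries-distinct = AllPairs.map⁻ (SetoidPerm.Unique-resp-↭ (setoid ℕ) (↭⇒↭ₛ (↭-sym entries))
    (sorted⇒unique <-asym ([1⋯]-sorted n)))

  entry-injective : ∀ {c c′} → c ∈ cells μ → c′ ∈ cells μ → e c ≡ e c′ → c ≡ c′
  entry-injective c∈ c′∈ eq with before-total c∈ c′∈
  ... | inj₁ p        = contradiction eq (sorted-before⁻ entries-distinct p)
  ... | inj₂ (inj₁ p) = p
  ... | inj₂ (inj₂ p) = contradiction (sym eq) (sorted-before⁻ entries-distinct p)

  pos-entry : ∀ {c} → c ∈ cells μ → pos (e c) (map e (cells μ)) ≡ position _≟ᶜ_ c (cells μ)
  pos-entry c∈ = position-map _≟ᶜ_ _≟_ e c∈ (entry-injective c∈)

  pos-<⁺ : ∀ {c c′} → c ∈ cells μ → c′ ∈ cells μ → c <ᵣ c′ →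
    pos (e c) (map e (cells μ)) < pos (e c′) (map e (cells μ))
  pos-<⁺ c∈ c′∈ lt = subst₂ _<_ (sym (pos-entry c∈)) (sym (pos-entry c′∈))
    (before⇒position< _≟ᶜ_ (cells-unique μ) (sorted-before⁺ <ᵣ-asym (cells-sorted μ) c∈ c′∈ lt))

  pos-<⁻ : ∀ {c c′} → c ∈ cells μ → c′ ∈ cells μ →
    pos (e c) (map e (cells μ)) < pos (e c′) (map e (cells μ)) → c <ᵣ c′
  pos-<⁻ c∈ c′∈ lt = sorted-before⁻ (cells-sorted μ)
    (position<⇒before _≟ᶜ_ (cells-unique μ) c∈ c′∈ (subst₂ _<_ (pos-entry c∈) (pos-entry c′∈) lt))

  ID-T : ID T ≡ IDʷ (map e (cells μ))
  ID-T = cong IDʷ (rw-filling e μ)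

  private
    length-w : length (map e (cells μ)) ≡ n
    length-w = List.length-map e (cells μ)

    descent? : Decidable (λ i → pos (suc i) (map e (cells μ)) < pos i (map e (cells μ)))
    descent? i = pos (suc i) (map e (cells μ)) <? pos i (map e (cells μ))

  ∈-ID⁺ : ∀ {c c′} → c ∈ cells μ → c′ ∈ cells μ → e c′ ≡ suc (e c) → c′ <ᵣ c → e c ∈ ID T
  ∈-ID⁺ {c} {c′} c∈ c′∈ eq lt = subst (e c ∈_) (sym ID-T) (∈-filter⁺ descent?
    (∈-[1⋯]⁺ (proj₁ (entry-range c∈)) (subst (λ k → e c ≤ k ∸ 1) (sym length-w)
      (∸-monoˡ-≤ 1 (subst (_≤ n) eq (proj₂ (entry-range c′∈))))))
    (subst (λ v → pos v (map e (cells μ)) < pos (e c) (map e (cells μ))) eq (pos-<⁺ c′∈ c∈ lt)))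

  ID-bounds : ∀ {v} → v ∈ ID T → 1 ≤ v × suc v ≤ n
  ID-bounds {v} v∈ with ∈-[1⋯]⁻ (proj₁ (∈-filter⁻ descent? (subst (v ∈_) ID-T v∈)))
  ... | 1≤v , v≤ = 1≤v , go n (≤-trans 1≤v v≤′) v≤′
    where
    v≤′ : v ≤ n ∸ 1
    v≤′ = subst (λ k → v ≤ k ∸ 1) length-w v≤
    go : ∀ n → 1 ≤ n ∸ 1 → v ≤ n ∸ 1 → suc v ≤ n
    go (suc n) _ p = s≤s p

  ∈-ID⁻ : ∀ {c c′} → c ∈ cells μ → c′ ∈ cells μ → e c′ ≡ suc (e c) → e c ∈ ID T → c′ <ᵣ c
  ∈-ID⁻ {c} {c′} c∈ c′∈ eq v∈ = pos-<⁻ c′∈ c∈ (subst (λ v → pos v (map e (cells μ)) < pos (e c) (map e (cells μ))) (sym eq)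
    (proj₂ (∈-filter⁻ descent? {xs = [1⋯ length (map e (cells μ)) ∸ 1 ]} (subst (e c ∈_) ID-T v∈))))

  ID-sorted : AllPairs _<_ (ID T)
  ID-sorted = subst (AllPairs _<_) (sym ID-T) (AllPairs.filter⁺ descent? ([1⋯]-sorted (length (map e (cells μ)) ∸ 1)))

nth-∷ʳ : ∀ default xs r → nth default (xs ++ [ default ]) r ≡ nth default xs r
nth-∷ʳ default []       zero    = refl
nth-∷ʳ default []       (suc r) = refl
nth-∷ʳ default (x ∷ xs) zero    = refl
nth-∷ʳ default (x ∷ xs) (suc r) = nth-∷ʳ default xs r

nth-≤ : ∀ {n xs} r → All (_≤ n) xs → nth n xs r ≤ n
nth-≤ r       []       = ≤-refl
nth-≤ zero    (p ∷ ps) = p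
nth-≤ (suc r) (p ∷ ps) = nth-≤ r ps

nth-mono : ∀ {n xs} r → AllPairs _<_ xs → All (_≤ n) xs → nth n xs r ≤ nth n xs (suc r)
nth-mono r                   []             []       = ≤-refl
nth-mono {xs = x ∷ []}     zero    _              (p ∷ ps) = p
nth-mono {xs = x ∷ y ∷ xs} zero    ((q ∷ _) ∷ _)  _        = <⇒≤ q
nth-mono (suc r)             (_ ∷ s)        (_ ∷ ps) = nth-mono r s ps

nth-< : ∀ {n xs r} → AllPairs _<_ xs → suc r < length xs → nth n xs r < nth n xs (suc r)
nth-< {xs = x ∷ []}     {zero}  _             (s<s ())
nth-< {xs = x ∷ y ∷ xs} {zero}  ((p ∷ _) ∷ _) _        = p
nth-< {xs = x ∷ xs}     {suc r} (_ ∷ s)       (s<s r<) = nth-< s r<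

nth-∈ : ∀ {n} xs {r} → r < length xs → nth n xs r ∈ xs
nth-∈ (x ∷ xs) {zero}  _        = here refl
nth-∈ (x ∷ xs) {suc r} (s<s r<) = there (nth-∈ xs r<)

nth-≥ : ∀ {n} xs {r} → length xs ≤ r → nth n xs r ≡ n
nth-≥ []               _        = refl
nth-≥ (x ∷ xs) {suc r} (s≤s p)  = nth-≥ xs p

∈-nth : ∀ {n v xs} → v ∈ xs → ∃[ r ] r < length xs × nth n xs r ≡ v
∈-nth (here refl) = 0 , z<s , refl
∈-nth (there v∈) with ∈-nth v∈
... | r , r< , eq = suc r , s<s r< , eq

nth-locate : ∀ {n} lo xs {v} → lo < v → v ≤ n →
  ∃[ r ] r ≤ length xs × nth n (lo ∷ xs) r < v × v ≤ nth n xs r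
nth-locate lo []       lo<v v≤n = 0 , z≤n , lo<v , v≤n
nth-locate lo (x ∷ xs) {v} lo<v v≤n with v ≤? x
... | yes v≤x = 0 , z≤n , lo<v , v≤x
... | no v≰x with nth-locate x xs (≰⇒> v≰x) v≤n
...   | r , r≤ , p , q = suc r , s≤s r≤ , p , q

mono-suc⇒mono : ∀ {f : ℕ → ℕ} → (∀ r → f r ≤ f (suc r)) → ∀ {r s} → r ≤ s → f r ≤ f s
mono-suc⇒mono {f} step {r} {s} r≤s = go r s (m≤n⇒m<n∨m≡n r≤s)
  where
  go : ∀ r s → r < s ⊎ r ≡ s → f r ≤ f s
  go r s       (inj₂ refl)      = ≤-refl
  go r (suc s) (inj₁ (s≤s r≤s)) = ≤-trans (go r s (m≤n⇒m<n∨m≡n r≤s)) (step s)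

filter-labelled : ∀ {P : Pred (Cell × ℕ) 0ℓ} (P? : Decidable P) (e : Cell → ℕ) cs →
  map proj₁ (filter P? (map (λ c → c , e c) cs)) ≡ filter (λ c → P? (c , e c)) cs
filter-labelled P? e []       = refl
filter-labelled P? e (c ∷ cs) with does (P? (c , e c))
... | true  = cong (c ∷_) (filter-labelled P? e cs)
... | false = filter-labelled P? e cs

assemble : List ℕ → ℕ → (ℕ → List Cell) → Tableau
assemble μ m R = fromRuns μ (map R [1⋯ m ])

∈-assembled⁻ : ∀ m (R : ℕ → List Cell) {c} → c ∈ concat (map R [1⋯ m ]) → ∃[ r ] c ∈ R r
∈-assembled⁻ m R c∈ with ∈-concat⁻′ (map R [1⋯ m ]) c∈
... | _ , c∈Rr , Rr∈ with ∈-map⁻ R Rr∈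
...   | r , _ , refl = r , c∈Rr

∈-assembled⁺ : ∀ m (R : ℕ → List Cell) {r c} → 1 ≤ r → r ≤ m → c ∈ R r → c ∈ concat (map R [1⋯ m ])
∈-assembled⁺ m R 1≤r r≤m c∈ = ∈-concat⁺′ c∈ (∈-map⁺ R (∈-[1⋯]⁺ 1≤r r≤m))

assembled-sorted : ∀ {_≺_ : Rel Cell 0ℓ} m (R : ℕ → List Cell) → (∀ r → AllPairs _≺_ (R r)) →
  (∀ {r s c c′} → r < s → c ∈ R r → c′ ∈ R s → c ≺ c′) → AllPairs _≺_ (concat (map R [1⋯ m ]))
assembled-sorted m R within across = AllPairs.concat⁺
  (All.map⁺ (All.tabulate λ {r} _ → within r))
  (AllPairs.map⁺ (AllPairs.map (λ r<s → All.tabulate λ c∈ → All.tabulate λ c′∈ → across r<s c∈ c′∈) ([1⋯]-sorted m)))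

sorted-refine : ∀ {R S : Rel A 0ℓ} {xs} → (∀ {x y} → x ∈ xs → y ∈ xs → R x y → S x y) → AllPairs R xs → AllPairs S xs
sorted-refine f s = tabulate-before λ p → f (before-∈ˡ p) (before-∈ʳ p) (sorted-before⁻ s p)

Compatible : (Cell → ℕ) → (ℕ → List Cell) → Set
Compatible e R = ∀ {r s c c′} → c ∈ R r → c′ ∈ R s → r < s ⊎ (r ≡ s × c <ᵣ c′) → e c < e c′

module BreakFamily {μ e} (std : Standard μ e)
  {m : ℕ} {R : ℕ → List Cell} {B : ℕ → ℕ}
  (m≥1      : 1 ≤ m)
  (B-mono   : ∀ {r s} → r ≤ s → B r ≤ B s)
  (B-strict : ∀ {r} → 1 ≤ r → r < m → B (r ∸ 1) < B r)
  (B-last   : ∀ {r} → m ≤ r → B r ≡ length (cells μ))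
  (B-∈ID    : ∀ {r} → 1 ≤ r → r < m → B r ∈ ID (filling e μ))
  (ID-∈B    : ∀ {v} → v ∈ ID (filling e μ) → ∃[ r ] B (suc r) ≡ v)
  (R-cover  : ∀ {c} → c ∈ cells μ → ∃[ r ] c ∈ R r)
  (R-sorted : ∀ r → AllPairs _<ᵣ_ (R r))
  (∈-R⁺     : ∀ {r c} → c ∈ cells μ → B (r ∸ 1) < e c → e c ≤ B r → c ∈ R r)
  (∈-cells  : ∀ {r c} → c ∈ R r → c ∈ cells μ)
  (lower    : ∀ {r c} → c ∈ R r → B (r ∸ 1) < e c)
  (upper    : ∀ {r c} → c ∈ R r → e c ≤ B r)
  where

  open StandardFilling std

  R-mono : ∀ {r s c c′} → c ∈ R r → c′ ∈ R s → e c < e c′ → r ≤ s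
  R-mono c∈ c′∈ lt = ≮⇒≥ λ { (s≤s s≤) →
    <-irrefl refl (<-≤-trans (lower c∈) (≤-trans (<⇒≤ lt) (≤-trans (upper c′∈) (B-mono s≤)))) }

  R-disjoint : ∀ {r s c} → c ∈ R r → c ∈ R s → r ≡ s
  R-disjoint c∈r c∈s = ≤-antisym (≮⇒≥ (go c∈r c∈s)) (≮⇒≥ (go c∈s c∈r))
    where
    go : ∀ {r s c} → c ∈ R r → c ∈ R s → ¬ s < r
    go c∈r c∈s (s≤s s≤) = <-irrefl refl (<-≤-trans (lower c∈r) (≤-trans (upper c∈s) (B-mono s≤)))

  R-range : ∀ {r c} → c ∈ R r → 1 ≤ r × r ≤ m
  R-range {zero}  c∈ = contradiction (<-≤-trans (lower c∈) (upper c∈)) (<-irrefl refl)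
  R-range {suc r} c∈ = z<s , ≮⇒≥ λ { (s≤s m≤r) →
    <-irrefl refl (<-≤-trans (subst (_< _) (B-last m≤r) (lower c∈)) (proj₂ (entry-range (∈-cells c∈)))) }

  inside⇒¬descent : ∀ {r v} → B (r ∸ 1) < v → v < B r → v ∉ ID T
  inside⇒¬descent {r} p q v∈ with ID-∈B v∈
  ... | s , refl = go r p q
    where
    go : ∀ r → B (r ∸ 1) < B (suc s) → B (suc s) < B r → ⊥
    go zero    p q = <-asym p q
    go (suc r) p q = <⇒≱ q (B-mono (≰⇒> λ s<r → <⇒≱ p (B-mono s<r)))

  R-reading : ∀ {r c c′} → c ∈ R r → c′ ∈ R r → e c < e c′ → c <ᵣ c′
  R-reading {r} {c} {c′} c∈ c′∈ lt = go (e c′ ∸ suc (e c)) c∈ (sym (m∸n+n≡m lt))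
    where
    go : ∀ k {c} → c ∈ R r → e c′ ≡ k + suc (e c) → c <ᵣ c′
    go k {c} c∈ eq with entry-surjective {suc (e c)} z<s
      (≤-trans (m≤n+m (suc (e c)) k) (subst (_≤ n) eq (proj₂ (entry-range (∈-cells c′∈)))))
    ... | d , d∈ , ed = next k eq
      where
      c<B : e c < B r
      c<B = ≤-trans (m≤n+m (suc (e c)) k) (subst (_≤ B r) eq (upper c′∈))
      c<d : c <ᵣ d
      c<d with <ᵣ-total c d
      ... | inj₁ p           = p
      ... | inj₂ (inj₁ refl) = contradiction ed (<⇒≢ (n<1+n _))
      ... | inj₂ (inj₂ p)    = contradiction (∈-ID⁺ (∈-cells c∈) d∈ ed p) (inside⇒¬descent (lower c∈) c<B)
      next : ∀ k → e c′ ≡ k + suc (e c) → c <ᵣ c′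
      next zero    eq = subst (c <ᵣ_) (entry-injective d∈ (∈-cells c′∈) (trans ed (sym eq))) c<d
      next (suc k) eq = <ᵣ-trans c<d (go k
        (∈-R⁺ d∈ (subst (B (r ∸ 1) <_) (sym ed) (m<n⇒m<1+n (lower c∈))) (subst (_≤ B r) (sym ed) c<B))
        (trans eq (trans (sym (+-suc k (suc (e c)))) (cong (λ x → k + suc x) (sym ed)))))

  R-compatible : Compatible e R
  R-compatible {r} {s} {c} {c′} c∈ c′∈ h with <-cmp (e c) (e c′)
  ... | tri< lt _ _ = lt
  R-compatible c∈ c′∈ (inj₁ r<s)         | tri> _ _ gt = contradiction (R-mono c′∈ c∈ gt) (<⇒≱ r<s)
  R-compatible c∈ c′∈ (inj₂ (refl , lt)) | tri> _ _ gt = contradiction (R-reading c′∈ c∈ gt) (<ᵣ-asym lt)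
  R-compatible c∈ c′∈ h                  | tri≈ _ eq _ with entry-injective (∈-cells c∈) (∈-cells c′∈) eq
  R-compatible c∈ c′∈ (inj₁ r<s)         | tri≈ _ eq _ | refl = contradiction (R-disjoint c∈ c′∈) (<⇒≢ r<s)
  R-compatible c∈ c′∈ (inj₂ (_ , lt))    | tri≈ _ eq _ | refl = contradiction lt <ᵣ-irrefl

  R-descents : ∀ {r} → 1 ≤ r → r < m → ∃₂ λ c c′ → c ∈ R r × c′ ∈ R (suc r) × c′ <ᵣ c
  R-descents {r} 1≤r r<m with B-∈ID 1≤r r<m
  ... | v∈ with entry-surjective (proj₁ (ID-bounds v∈)) (<⇒≤ (proj₂ (ID-bounds v∈)))
              | entry-surjective z<s (proj₂ (ID-bounds v∈))
  ...   | c , c∈ , ec | c′ , c′∈ , ec′ = c , c′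
      , ∈-R⁺ c∈ (subst (B (r ∸ 1) <_) (sym ec) (B-strict 1≤r r<m)) (≤-reflexive ec)
      , ∈-R⁺ c′∈ (subst (B r <_) (sym ec′) (n<1+n _)) (subst (_≤ B (suc r)) (sym ec′) next)
      , ∈-ID⁻ c∈ c′∈ (trans ec′ (cong suc (sym ec))) (subst (_∈ ID T) (sym ec) v∈)
      where
      next : B r < B (suc r)
      next with m≤n⇒m<n∨m≡n r<m
      ... | inj₁ lt = B-strict {suc r} z<s lt
      ... | inj₂ eq = subst (B r <_) (sym (B-last (≤-reflexive (sym eq)))) (proj₂ (ID-bounds v∈))

  family : Family μ m R
  family = record
    { partition = partition
    ; positive  = m≥1
    ; range     = R-range
    ; ⊆-cells   = ∈-cells
    ; cover     = R-cover
    ; disjoint  = R-disjoint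
    ; sorted    = R-sorted
    ; rows      = λ c∈ c′∈ → R-mono c∈ c′∈ (row-< (∈-cells c∈) (∈-cells c′∈))
    ; columns   = λ c∈ c′∈ → column-< c∈ c′∈ (col-< (∈-cells c∈) (∈-cells c′∈))
    ; descents  = R-descents
    }
    where
    row-< : ∀ {r k} → (r , k) ∈ cells μ → (r , suc k) ∈ cells μ → e (r , k) < e (r , suc k)
    row-< c∈ c′∈ with ∈-cells⁻ μ c∈
    ... | r , k , refl , _ = rows {r} {k} (∈-cells⇒< {μ} c′∈)
    col-< : ∀ {r k} → (r , k) ∈ cells μ → (suc r , k) ∈ cells μ → e (r , k) < e (suc r , k)
    col-< c∈ c′∈ with ∈-cells⁻ μ c∈
    ... | r , k , refl , _ = columns {r} {k} (∈-cells⇒< {μ} c′∈)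
    column-< : ∀ {r s x k} → (x , k) ∈ R r → (suc x , k) ∈ R s → e (x , k) < e (suc x , k) → r < s
    column-< c∈ c′∈ lt with m≤n⇒m<n∨m≡n (R-mono c∈ c′∈ lt)
    ... | inj₁ r<s  = r<s
    ... | inj₂ refl = case R-reading c∈ c′∈ lt of λ where
      (inj₁ p)       → contradiction p (<-asym (n<1+n _))
      (inj₂ (p , _)) → contradiction p (<⇒≢ (n<1+n _))

  entries-assembled : map e (concat (map R [1⋯ m ])) ≡ [1⋯ n ]
  entries-assembled = sorted-≡ {_≺_ = _<_} <-asym
    (AllPairs.map⁺ (assembled-sorted m R
      (λ r → sorted-refine {S = λ c c′ → e c < e c′} (λ c∈ c′∈ lt → R-compatible c∈ c′∈ (inj₂ (refl , lt))) (R-sorted r))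
      (λ r<s c∈ c′∈ → R-compatible c∈ c′∈ (inj₁ r<s))))
    ([1⋯]-sorted n)
    (λ v∈ → case ∈-map⁻ e v∈ of λ { (c , c∈ , refl) →
      let c∈′ = ∈-cells (proj₂ (∈-assembled⁻ m R c∈)) in ∈-[1⋯]⁺ (proj₁ (entry-range c∈′)) (proj₂ (entry-range c∈′)) })
    (λ v∈ → case entry-surjective (proj₁ (∈-[1⋯]⁻ v∈)) (proj₂ (∈-[1⋯]⁻ v∈)) of λ { (c , c∈ , refl) →
      let r , c∈R = R-cover c∈ in ∈-map⁺ e (∈-assembled⁺ m R (proj₁ (R-range c∈R)) (proj₂ (R-range c∈R)) c∈R) })

  assembled : T ≡ assemble μ m R
  assembled = trans
    (filling-cong μ λ c∈ → let r , c∈R = R-cover c∈ in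
      applyUpTo-position _≟ᶜ_ entries-assembled (∈-assembled⁺ m R (proj₁ (R-range c∈R)) (proj₂ (R-range c∈R)) c∈R))
    (sym (fromRuns≡tab μ (map R [1⋯ m ])))

  entries-R : ∀ r → map e (R r) ≡ applyUpTo (λ i → suc (B (r ∸ 1) + i)) (B r ∸ B (r ∸ 1))
  entries-R r = sorted-≡ {_≺_ = _<_} <-asym
    (AllPairs.map⁺ (sorted-refine {S = λ c c′ → e c < e c′} (λ c∈ c′∈ lt → R-compatible c∈ c′∈ (inj₂ (refl , lt))) (R-sorted r)))
    (AllPairs.applyUpTo⁺₁ (λ i → suc (B (r ∸ 1) + i)) (B r ∸ B (r ∸ 1)) λ i<j _ → s<s (+-monoʳ-< (B (r ∸ 1)) i<j))
    (λ v∈ → case ∈-map⁻ e v∈ of λ { (c , c∈ , refl) → subst (_∈ applyUpTo (λ i → suc (B (r ∸ 1) + i)) (B r ∸ B (r ∸ 1)))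
      (m+[n∸m]≡n (lower c∈))
      (∈-applyUpTo⁺ (λ i → suc (B (r ∸ 1) + i)) (m+n≤o⇒m≤o∸n _ (subst (_≤ B r) (sym (trans (sym (+-suc (e c ∸ suc (B (r ∸ 1))) (B (r ∸ 1)))) (m∸n+n≡m (lower c∈)))) (upper c∈)))) })
    (λ v∈ → case ∈-applyUpTo⁻ (λ i → suc (B (r ∸ 1) + i)) v∈ of λ { (i , i< , refl) →
      let le = subst (suc (B (r ∸ 1) + i) ≤_) (m+[n∸m]≡n (B-mono (m∸n≤m r 1)))
                 (subst (_≤ B (r ∸ 1) + (B r ∸ B (r ∸ 1))) (+-suc (B (r ∸ 1)) i) (+-monoʳ-≤ (B (r ∸ 1)) i<))
          c , c∈ , ec = entry-surjective z<s (≤-trans le (subst (B r ≤_) (B-last (m≤m+n m r)) (B-mono (m≤n+m r m))))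
      in subst (_∈ map e (R r)) ec (∈-map⁺ e (∈-R⁺ c∈ (subst (B (r ∸ 1) <_) (sym ec) (s≤s (m≤m+n _ i))) (subst (_≤ B r) (sym ec) le))) })

  length-R : ∀ r → length (R r) ≡ B r ∸ B (r ∸ 1)
  length-R r = trans (sym (List.length-map e (R r)))
    (trans (cong length (entries-R r)) (List.length-applyUpTo _ (B r ∸ B (r ∸ 1))))

module StandardRuns {μ e} (std : Standard μ e) where
  open StandardFilling std

  b-nth : ∀ r → b T r ≡ nth (size T) (0 ∷ ID T) r
  b-nth zero    = refl
  b-nth (suc r) = nth-∷ʳ (size T) (ID T) r

  private
    size≡n : size T ≡ n
    size≡n = size-filling e μ

    ID≤ : All (_≤ size T) (ID T)
    ID≤ = All.tabulate λ v∈ → subst (_ ≤_) (sym size≡n) (<⇒≤ (proj₂ (ID-bounds v∈)))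

  b-mono : ∀ {r s} → r ≤ s → b T r ≤ b T s
  b-mono = mono-suc⇒mono λ r → subst₂ _≤_ (sym (b-nth r)) (sym (b-nth (suc r)))
    (nth-mono r (All.tabulate (λ v∈ → proj₁ (ID-bounds v∈)) ∷ ID-sorted) (z≤n ∷ ID≤))

  b-≤ : ∀ r → b T r ≤ n
  b-≤ r = subst₂ _≤_ (sym (b-nth r)) size≡n (nth-≤ r (z≤n ∷ ID≤))

  nRuns≡ : nRuns T ≡ suc (length (ID T))
  nRuns≡ = trans (List.length-++ (ID T)) (+-comm (length (ID T)) 1)

  b-last : ∀ {r} → nRuns T ≤ r → b T r ≡ n
  b-last {r} m≤r = trans (b-nth r) (trans (nth-≥ (0 ∷ ID T) (subst (_≤ r) nRuns≡ m≤r)) size≡n)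

  b-strict : ∀ {r} → 1 ≤ r → r < nRuns T → b T (r ∸ 1) < b T r
  b-strict {suc r} _ r<m = subst₂ _<_ (sym (b-nth r)) (sym (b-nth (suc r)))
    (nth-< (All.tabulate (λ v∈ → proj₁ (ID-bounds v∈)) ∷ ID-sorted) (subst (suc r <_) nRuns≡ r<m))

  b-∈ID : ∀ {r} → 1 ≤ r → r < nRuns T → b T r ∈ ID T
  b-∈ID {suc r} _ r<m = subst (_∈ ID T) (sym (b-nth (suc r))) (nth-∈ (ID T) (s<s⁻¹ (subst (suc r <_) nRuns≡ r<m)))

  ID-∈b : ∀ {v} → v ∈ ID T → ∃[ r ] b T (suc r) ≡ v
  ID-∈b v∈ with ∈-nth v∈
  ... | r , _ , eq = r , trans (b-nth (suc r)) eq

  run≡ : ∀ r → run T r ≡ filter (λ c → inRun? T r (e c)) (cells μ)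
  run≡ r = trans (cong (λ cs → map proj₁ (filter (λ c → inRun? T r (proj₂ c)) cs)) (labelledCells-filling e μ))
    (filter-labelled (λ c → inRun? T r (proj₂ c)) e (cells μ))

  ∈-run⁺ : ∀ {r c} → c ∈ cells μ → InRun T r (e c) → c ∈ run T r
  ∈-run⁺ {r} c∈ p = subst (_ ∈_) (sym (run≡ r)) (∈-filter⁺ (λ c → inRun? T r (e c)) c∈ p)

  ∈-run⁻ : ∀ {r c} → c ∈ run T r → c ∈ cells μ × InRun T r (e c)
  ∈-run⁻ {r} c∈ = ∈-filter⁻ (λ c → inRun? T r (e c)) {xs = cells μ} (subst (_ ∈_) (run≡ r) c∈)

  run-cover : ∀ {c} → c ∈ cells μ → ∃[ r ] c ∈ run T r
  run-cover {c} c∈ with nth-locate {size T} 0 (ID T) (proj₁ (entry-range c∈)) (subst (e c ≤_) (sym size≡n) (proj₂ (entry-range c∈)))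
  ... | r , _ , p , q = suc r
    , ∈-run⁺ {suc r} c∈ (subst (_< e c) (sym (b-nth r)) p , subst (e c ≤_) (sym (b-nth (suc r))) q)

  run-sorted : ∀ r → AllPairs _<ᵣ_ (run T r)
  run-sorted r = subst (AllPairs _<ᵣ_) (sym (run≡ r)) (AllPairs.filter⁺ (λ c → inRun? T r (e c)) (cells-sorted μ))

  open BreakFamily std {nRuns T} {run T} {b T} (subst (1 ≤_) (sym nRuns≡) z<s) b-mono
    (λ {r} → b-strict {r}) b-last b-∈ID ID-∈b run-cover run-sorted (λ {r} c∈ p q → ∈-run⁺ {r} c∈ (p , q))
    (λ {r} c∈ → proj₁ (∈-run⁻ {r} c∈)) (λ {r} c∈ → proj₁ (proj₂ (∈-run⁻ {r} c∈)))
    (λ {r} c∈ → proj₂ (proj₂ (∈-run⁻ {r} c∈))) public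
    using () renaming (family to run-family; R-compatible to run-compatible; assembled to assemble-runs; length-R to length-run)

module FamilyStep {μ e} (std : Standard μ e) {m R} (F : Family μ m R) (compatible : Compatible e R) where
  open StandardFilling std using (entry-range)
  open Family F

  first-run : ∀ {r c} → e c ≡ 1 → c ∈ R r → r ≡ 1
  first-run {r} {c} ec c∈ with m≤n⇒m<n∨m≡n (proj₁ (range c∈))
  ... | inj₂ 1≡r = sym 1≡r
  ... | inj₁ 1<r with descents ≤-refl (<-≤-trans 1<r (proj₂ (range c∈)))
  ...   | d , _ , d∈ , _ = contradiction (proj₁ (entry-range (⊆-cells d∈)))
            (<⇒≱ (subst (e d <_) ec (compatible d∈ c∈ (inj₁ 1<r))))

  next-run : ∀ {r s c c′} → c ∈ R r → c′ ∈ R s → e c′ ≡ suc (e c) → (c <ᵣ c′ × s ≡ r) ⊎ (c′ <ᵣ c × s ≡ suc r)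
  next-run {r} {s} {c} {c′} c∈ c′∈ eq with <-cmp r s
  ... | tri> _ _ s<r  = contradiction (compatible c′∈ c∈ (inj₁ s<r)) (<-asym (≤-reflexive (sym eq)))
  ... | tri≈ _ refl _ with <ᵣ-total c c′
  ...   | inj₁ lt          = inj₁ (lt , refl)
  ...   | inj₂ (inj₁ refl) = contradiction eq (<⇒≢ (n<1+n _))
  ...   | inj₂ (inj₂ gt)   = contradiction (compatible c′∈ c∈ (inj₂ (refl , gt))) (<-asym (≤-reflexive (sym eq)))
  next-run {r} {s} {c} {c′} c∈ c′∈ eq | tri< r<s _ _
    with descents (proj₁ (range c∈)) (<-≤-trans r<s (proj₂ (range c′∈)))
  ... | d , d′ , d∈ , d′∈ , d′<d = inj₂ (c′<c , ≤-antisym s≤ r<s)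
    where
    ¬between : ∀ {x} → e c < x → ¬ x < e c′
    ¬between p q = <⇒≱ q (subst (_≤ _) (sym eq) p)
    s≤ : s ≤ suc r
    s≤ = ≮⇒≥ λ lt → ¬between (compatible c∈ d′∈ (inj₁ (n<1+n r))) (compatible d′∈ c′∈ (inj₁ lt))
    c′<c : c′ <ᵣ c
    c′<c with <ᵣ-total c d | <ᵣ-total d′ c′
    ... | inj₁ c<d          | _                = contradiction (compatible d∈ c′∈ (inj₁ r<s)) (¬between (compatible c∈ d∈ (inj₂ (refl , c<d))))
    ... | inj₂ _            | inj₁ d′<c′       = contradiction (compatible d′∈ c′∈ (inj₂ (≤-antisym r<s s≤ , d′<c′))) (¬between (compatible c∈ d′∈ (inj₁ (n<1+n r))))
    ... | inj₂ (inj₁ refl)  | inj₂ (inj₁ refl) = d′<d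
    ... | inj₂ (inj₁ refl)  | inj₂ (inj₂ c′<d′) = <ᵣ-trans c′<d′ d′<d
    ... | inj₂ (inj₂ d<c)   | inj₂ (inj₁ refl) = <ᵣ-trans d′<d d<c
    ... | inj₂ (inj₂ d<c)   | inj₂ (inj₂ c′<d′) = <ᵣ-trans c′<d′ (<ᵣ-trans d′<d d<c)

module FamilyUnique {μ e} (std : Standard μ e) where
  open StandardFilling std using (entry-range; entry-surjective)

  module _ {m m′ R R′} (F : Family μ m R) (F′ : Family μ m′ R′) (comp : Compatible e R) (comp′ : Compatible e R′) where

    module F = Family F
    module F′ = Family F′
    module S = FamilyStep std F comp
    module S′ = FamilyStep std F′ comp′

    -- By induction on the entry of the cell, `next-run` determines its run.
    runs-⊆ : ∀ {r} → R r ⊆ R′ r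
    runs-⊆ c∈ = go _ (sym (m∸n+n≡m (proj₁ (entry-range (F.⊆-cells c∈))))) c∈
      where
      go : ∀ v {r c} → e c ≡ v + 1 → c ∈ R r → c ∈ R′ r
      go v ec c∈ with F′.cover (F.⊆-cells c∈)
      go zero {c = c} ec c∈ | r′ , c∈′ = subst (λ r → c ∈ R′ r) (trans (S′.first-run ec c∈′) (sym (S.first-run ec c∈))) c∈′
      go (suc v) {c = c} ec c∈ | r′ , c∈′
        with entry-surjective {v + 1} (m≤n+m 1 v) (≤-trans (n≤1+n _) (subst (_≤ _) ec (proj₂ (entry-range (F.⊆-cells c∈)))))
      ... | d , d∈cells , ed with F.cover d∈cells
      ...   | s , d∈ with S.next-run d∈ c∈ (trans ec (cong suc (sym ed))) | S′.next-run (go v ed d∈) c∈′ (trans ec (cong suc (sym ed)))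
      ...     | inj₁ (_ , refl) | inj₁ (_ , refl) = c∈′
      ...     | inj₂ (_ , refl) | inj₂ (_ , refl) = c∈′
      ...     | inj₁ (p , _)    | inj₂ (q , _)    = contradiction p (<ᵣ-asym q)
      ...     | inj₂ (p , _)    | inj₁ (q , _)    = contradiction p (<ᵣ-asym q)

    runs-number-≤ : m ≤ m′
    runs-number-≤ = ≮⇒≥ λ m′<m → case F.descents F′.positive m′<m of λ where
      (_ , _ , _ , c∈ , _) → <⇒≱ (n<1+n m′) (proj₂ (F′.range (runs-⊆ c∈)))

  runs-unique : ∀ {m m′ R R′} → Family μ m R → Family μ m′ R′ → Compatible e R → Compatible e R′ → m ≡ m′ × (∀ r → R r ≡ R′ r)
  runs-unique F F′ comp comp′ =
    ≤-antisym (runs-number-≤ F F′ comp comp′) (runs-number-≤ F′ F comp′ comp) ,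
    λ r → sorted-≡ <ᵣ-asym (Family.sorted F r) (Family.sorted F′ r) (runs-⊆ F F′ comp comp′) (runs-⊆ F′ F comp′ comp)

module AssembledFamily {μ m R} (F : Family μ m R) where
  open Family F

  L : List Cell
  L = concat (map R [1⋯ m ])

  _≺_ : Rel Cell 0ℓ
  c ≺ c′ = ∃₂ λ r s → c ∈ R r × c′ ∈ R s × (r < s ⊎ (r ≡ s × c <ᵣ c′))

  ≺-asym : Asymmetric _≺_
  ≺-asym (r , s , c∈r , c′∈s , h) (s′ , r′ , c′∈s′ , c∈r′ , h′) with disjoint c∈r c∈r′ | disjoint c′∈s c′∈s′
  ≺-asym (r , s , c∈r , c′∈s , inj₁ p)          (s′ , r′ , c′∈s′ , c∈r′ , inj₁ q)          | refl | refl = <-asym p q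
  ≺-asym (r , s , c∈r , c′∈s , inj₁ p)          (s′ , r′ , c′∈s′ , c∈r′ , inj₂ (refl , _)) | refl | refl = <-irrefl refl p
  ≺-asym (r , s , c∈r , c′∈s , inj₂ (refl , _)) (s′ , r′ , c′∈s′ , c∈r′ , inj₁ q)          | refl | refl = <-irrefl refl q
  ≺-asym (r , s , c∈r , c′∈s , inj₂ (_ , p))    (s′ , r′ , c′∈s′ , c∈r′ , inj₂ (_ , q))    | refl | refl = <ᵣ-asym p q

  L-sorted : AllPairs _≺_ L
  L-sorted = assembled-sorted m R
    (λ r → sorted-refine (λ c∈ c′∈ lt → r , r , c∈ , c′∈ , inj₂ (refl , lt)) (sorted r))
    (λ r<s c∈ c′∈ → _ , _ , c∈ , c′∈ , inj₁ r<s)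

  L-unique : Unique L
  L-unique = sorted⇒unique ≺-asym L-sorted

  run-⊆-L : ∀ {r} → R r ⊆ L
  run-⊆-L c∈ = ∈-assembled⁺ m R (proj₁ (range c∈)) (proj₂ (range c∈)) c∈

  L↭cells : L ↭ cells μ
  L↭cells = unique-⊆-⊇⇒↭ L-unique (cells-unique μ) (λ c∈ → ⊆-cells (proj₂ (∈-assembled⁻ m R c∈))) (λ c∈ → run-⊆-L (proj₂ (cover c∈)))

  L-before : ∀ {r s c c′} → c ∈ R r → c′ ∈ R s → r < s ⊎ (r ≡ s × c <ᵣ c′) → Before c c′ L
  L-before c∈ c′∈ h = sorted-before⁺ ≺-asym L-sorted (run-⊆-L c∈) (run-⊆-L c′∈) (_ , _ , c∈ , c′∈ , h)

  rows-before : ∀ {r k} → (r , suc k) ∈ cells μ → (r , k) ∈ cells μ → Before (r , k) (r , suc k) L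
  rows-before c′∈ c∈ with cover c∈ | cover c′∈
  ... | r , c∈r | s , c′∈s with m≤n⇒m<n∨m≡n (rows c∈r c′∈s)
  ...   | inj₁ r<s = L-before c∈r c′∈s (inj₁ r<s)
  ...   | inj₂ r≡s = L-before c∈r c′∈s (inj₂ (r≡s , inj₂ (refl , n<1+n _)))

  columns-before : ∀ {r k} → (suc r , k) ∈ cells μ → (r , k) ∈ cells μ → Before (r , k) (suc r , k) L
  columns-before c′∈ c∈ with cover c∈ | cover c′∈
  ... | r , c∈r | s , c′∈s = L-before c∈r c′∈s (inj₁ (columns c∈r c′∈s))

  standard : Standard μ (label L)
  standard = linear⇒Standard partition L↭cells rows-before columns-before

  compatible : Compatible (label L) R
  compatible c∈ c′∈ h = s<s (before⇒position< _≟ᶜ_ L-unique (L-before c∈ c′∈ h))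

  assemble≡tab : assemble μ m R ≡ tab μ L
  assemble≡tab = fromRuns≡tab μ (map R [1⋯ m ])

  assemble-IsSYT : IsSYT (assemble μ m R)
  assemble-IsSYT = subst IsSYT (sym assemble≡tab) (Standard⇒IsSYT standard)

  shape-assemble : shape (assemble μ m R) ≡ μ
  shape-assemble = trans (cong shape assemble≡tab) (shape-filling (label L) μ)

  unique-runs : nRuns (tab μ L) ≡ m × (∀ r → run (tab μ L) r ≡ R r)
  unique-runs = FamilyUnique.runs-unique standard (StandardRuns.run-family standard) F
    (λ {r} {s} → StandardRuns.run-compatible standard {r} {s}) compatible

  nRuns-assemble : nRuns (assemble μ m R) ≡ m
  nRuns-assemble = trans (cong nRuns assemble≡tab) (proj₁ unique-runs)

  run-assemble : ∀ r → run (assemble μ m R) r ≡ R r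
  run-assemble r = trans (cong (λ T → run T r) assemble≡tab) (proj₂ unique-runs r)

-- Superstandard tableaux

before-map : ∀ (f : A → B) {x y xs} → Before x y xs → Before (f x) (f y) (map f xs)
before-map f (here y∈) = here (∈-map⁺ f y∈)
before-map f (there p) = there (before-map f p)

before-filter : ∀ {P : Pred A 0ℓ} (P? : Decidable P) {x y xs} → P x → P y → Before x y xs → Before x y (filter P? xs)
before-filter P? {x} px py (here {zs} y∈) rewrite List.filter-accept P? {x} {zs} px = here (∈-filter⁺ P? y∈ py)
before-filter P? px py (there {z} p) with does (P? z)
... | true  = there (before-filter P? px py p)
... | false = before-filter P? px py p

[1⋯+] : ∀ m n → [1⋯ m + n ] ≡ [1⋯ m ] ++ map (m +_) [1⋯ n ]
[1⋯+] m n = trans (go suc m) (cong ([1⋯ m ] ++_) (sym (trans (List.map-applyUpTo suc (m +_) n) (shift n id))))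
  where
  go : ∀ (f : ℕ → ℕ) m → applyUpTo f (m + n) ≡ applyUpTo f m ++ applyUpTo (λ i → f (m + i)) n
  go f zero    = refl
  go f (suc m) = cong (f 0 ∷_) (go (f ∘ suc) m)
  shift : ∀ n (f : ℕ → ℕ) → applyUpTo (λ i → m + suc (f i)) n ≡ applyUpTo (λ i → suc (m + f i)) n
  shift zero    f = refl
  shift (suc n) f = cong₂ _∷_ (+-suc m (f 0)) (shift n (f ∘ suc))

++-length-injective : ∀ {as cs : List A} {bs ds} → length as ≡ length cs → as ++ bs ≡ cs ++ ds → as ≡ cs × bs ≡ ds
++-length-injective {as = []}     {[]}     _  eq = refl , eq
++-length-injective {as = a ∷ as} {c ∷ cs} le eq with ++-length-injective {as = as} (suc-injective le) (List.∷-injectiveʳ eq)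
... | p , q = cong₂ _∷_ (List.∷-injectiveˡ eq) p , q

consecutive⇒superstandard : ∀ {T} → concat T ≡ [1⋯ size T ] → Superstandard T
consecutive⇒superstandard {T} eq = sym (go 0 T (trans eq (sym (List.map-id _))))
  where
  open ≡-Reasoning
  go : ∀ k T → concat T ≡ map (k +_) [1⋯ size T ] → superstandardFrom k (shape T) ≡ T
  go k []      eq = refl
  go k (R ∷ T) eq = let p , q = ++-length-injective {as = R} (sym (trans (List.length-map (k +_) [1⋯ length R ]) (List.length-applyUpTo suc (length R)))) eq′
                    in cong₂ _∷_ (sym p) (go (k + length R) T q)
    where
    eq′ : R ++ concat T ≡ map (k +_) [1⋯ length R ] ++ map ((k + length R) +_) [1⋯ size T ]
    eq′ = begin
      R ++ concat T
        ≡⟨ eq ⟩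
      map (k +_) [1⋯ length (R ++ concat T) ]
        ≡⟨ cong (λ l → map (k +_) [1⋯ l ]) (List.length-++ R) ⟩
      map (k +_) [1⋯ length R + size T ]
        ≡⟨ cong (map (k +_)) ([1⋯+] (length R) (size T)) ⟩
      map (k +_) ([1⋯ length R ] ++ map (length R +_) [1⋯ size T ])
        ≡⟨ List.map-++ (k +_) [1⋯ length R ] _ ⟩
      map (k +_) [1⋯ length R ] ++ map (k +_) (map (length R +_) [1⋯ size T ])
        ≡⟨ cong (map (k +_) [1⋯ length R ] ++_) (List.map-∘ [1⋯ size T ]) ⟨
      map (k +_) [1⋯ length R ] ++ map (λ i → k + (length R + i)) [1⋯ size T ]
        ≡⟨ cong (map (k +_) [1⋯ length R ] ++_) (List.map-cong (λ i → sym (+-assoc k (length R) i)) [1⋯ size T ]) ⟩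
      map (k +_) [1⋯ length R ] ++ map ((k + length R) +_) [1⋯ size T ]
        ∎

superstandard-sorted : ∀ {T} → Superstandard T → AllPairs _<_ (concat T)
superstandard-sorted {T} eq = subst (AllPairs _<_ ∘ concat) (sym eq) (proj₁ (go 0 (shape T)))
  where
  go : ∀ k μ → AllPairs _<_ (concat (superstandardFrom k μ)) × All (k <_) (concat (superstandardFrom k μ))
  go k []      = [] , []
  go k (m ∷ μ) with go (k + m) μ
  ... | s , a = AllPairs.++⁺ (AllPairs.map⁺ (AllPairs.map (+-monoʳ-< k) ([1⋯]-sorted m))) s
                  (All.map⁺ (All.tabulate λ i∈ → All.map (λ lt → ≤-<-trans (+-monoʳ-≤ k (proj₂ (∈-[1⋯]⁻ i∈))) lt) a))
              , All.++⁺ (All.map⁺ (All.tabulate λ i∈ → ≤-trans (≤-reflexive (+-comm 1 k)) (+-monoʳ-≤ k (proj₁ (∈-[1⋯]⁻ i∈)))))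
                  (All.map (λ lt → ≤-<-trans (m≤m+n k m) lt) a)

concat-restrict : ∀ k T → concat (restrict k T) ≡ filter (_≤? k) (concat T)
concat-restrict k []      = refl
concat-restrict k (R ∷ T) = trans (step (filter (_≤? k) R)) (trans
  (cong (filter (_≤? k) R ++_) (concat-restrict k T)) (sym (List.filter-++ (_≤? k) R (concat T))))
  where
  step : ∀ R → concat (filter (λ r → 0 <? length r) (R ∷ map (filter (_≤? k)) T)) ≡ R ++ concat (restrict k T)
  step []      = refl
  step (x ∷ R) = refl

infix 4 _<ˡ_

_<ˡ_ : Rel Cell 0ℓ
c <ˡ c′ = row c < row c′ ⊎ (row c ≡ row c′ × col c < col c′)

<ˡ-asym : Asymmetric _<ˡ_
<ˡ-asym (inj₁ p)       (inj₁ q)       = <-asym p q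
<ˡ-asym (inj₁ p)       (inj₂ (e , _)) = <-irrefl (sym e) p
<ˡ-asym (inj₂ (e , _)) (inj₁ q)       = <-irrefl (sym e) q
<ˡ-asym (inj₂ (_ , p)) (inj₂ (_ , q)) = <-asym p q

rowwise : List ℕ → List Cell
rowwise μ = concat (filling id μ)

rowwise↭cells : ∀ μ → rowwise μ ↭ cells μ
rowwise↭cells μ = ↭-trans (↭-sym (reading↭concat (filling id μ))) (↭-reflexive (cong reading (sym (cellRows≡filling μ))))

rowwise-sorted : ∀ μ → AllPairs _<ˡ_ (rowwise μ)
rowwise-sorted []      = []
rowwise-sorted (m ∷ μ) = AllPairs.++⁺
  (AllPairs.applyUpTo⁺₁ (λ k → 1 , suc k) m λ i<j _ → inj₂ (refl , s<s i<j))
  (subst (AllPairs _<ˡ_) up-rowwise (AllPairs.map⁺ (AllPairs.map up-<ˡ (rowwise-sorted μ))))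
  (All.applyUpTo⁺₁ (λ k → 1 , suc k) m λ _ → subst (All _) up-rowwise (All.map⁺ (All.tabulate λ c∈ → inj₁ (s<s (row-positive c∈)))))
  where
  up-rowwise : map up (rowwise μ) ≡ concat (filling up μ)
  up-rowwise = trans (sym (List.concat-map (filling id μ))) (cong concat (map-filling up id μ))
  up-<ˡ : ∀ {c c′} → c <ˡ c′ → up c <ˡ up c′
  up-<ˡ (inj₁ p)          = inj₁ (s<s p)
  up-<ˡ (inj₂ (refl , p)) = inj₂ (refl , p)
  row-positive : ∀ {c} → c ∈ rowwise μ → 0 < row c
  row-positive c∈ with ∈-cells⁻ μ (Perm.∈-resp-↭ (rowwise↭cells μ) c∈)
  ... | _ , _ , refl , _ = z<s

concat-filling : ∀ (e : Cell → A) μ → concat (filling e μ) ≡ map e (rowwise μ)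
concat-filling e μ = trans (cong concat (sym (map-filling e id μ))) (List.concat-map (filling id μ))

module StandardSuperstandard {μ e} (std : Standard μ e) where
  open StandardFilling std

  row-increasing : ∀ {c c′} → c ∈ cells μ → c′ ∈ cells μ → row c ≡ row c′ → col c < col c′ → e c < e c′
  row-increasing c∈ c′∈ eq lt with ∈-cells⁻ μ c∈ | ∈-cells⁻ μ c′∈
  row-increasing c∈ c′∈ refl (s<s lt) | r , k , refl , k< | _ , k′ , refl , k′< = go k′ lt k′<
    where
    go : ∀ k′ → k < k′ → k′ < nth 0 μ r → e (suc r , suc k) < e (suc r , suc k′)
    go (suc k′) (s≤s k≤k′) k′< with m≤n⇒m<n∨m≡n k≤k′
    ... | inj₁ k<k′ = <-trans (go k′ k<k′ (<-trans (n<1+n k′) k′<)) (rows {r} k′<)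
    ... | inj₂ refl = rows {r} k′<

  restrict-superstandard⁺ : ∀ {k} → k ≤ n →
    (∀ {c c′} → c ∈ cells μ → c′ ∈ cells μ → e c ≤ k → e c′ ≤ k → row c < row c′ → e c < e c′) →
    Superstandard (restrict k T)
  restrict-superstandard⁺ {k} k≤n h = consecutive⇒superstandard
    (trans consecutive (cong [1⋯_] (sym (trans (cong length consecutive) (List.length-applyUpTo suc k)))))
    where
    ∈-rowwise : ∀ {c} → c ∈ rowwise μ → c ∈ cells μ
    ∈-rowwise = Perm.∈-resp-↭ (rowwise↭cells μ)
    increasing : ∀ {c c′} → c ∈ rowwise μ → c′ ∈ rowwise μ → c <ˡ c′ → e c ≤ k → e c′ ≤ k → e c < e c′
    increasing c∈ c′∈ (inj₁ lt)        = λ p q → h (∈-rowwise c∈) (∈-rowwise c′∈) p q lt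
    increasing c∈ c′∈ (inj₂ (eq , lt)) = λ _ _ → row-increasing (∈-rowwise c∈) (∈-rowwise c′∈) eq lt
    sorted : AllPairs _<_ (filter (_≤? k) (map e (rowwise μ)))
    sorted = sorted-refine {R = λ x y → x ≤ k → y ≤ k → x < y}
      (λ x∈ y∈ f → f (proj₂ (∈-filter⁻ (_≤? k) {xs = map e (rowwise μ)} x∈)) (proj₂ (∈-filter⁻ (_≤? k) {xs = map e (rowwise μ)} y∈)))
      (AllPairs.filter⁺ (_≤? k) (AllPairs.map⁺ (sorted-refine increasing (rowwise-sorted μ))))
    consecutive : concat (restrict k T) ≡ [1⋯ k ]
    consecutive = trans (concat-restrict k T) (trans (cong (filter (_≤? k)) (concat-filling e μ))
      (sorted-≡ {_≺_ = _<_} <-asym sorted ([1⋯]-sorted k)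
        (λ v∈ → let v∈map , v≤k = ∈-filter⁻ (_≤? k) {xs = map e (rowwise μ)} v∈ in case ∈-map⁻ e v∈map of λ where
          (c , c∈ , refl) → ∈-[1⋯]⁺ (proj₁ (entry-range (∈-rowwise c∈))) v≤k)
        (λ v∈ → let 1≤v , v≤k = ∈-[1⋯]⁻ v∈ in case entry-surjective 1≤v (≤-trans v≤k k≤n) of λ where
          (c , c∈ , refl) → ∈-filter⁺ (_≤? k) (∈-map⁺ e (Perm.∈-resp-↭ (↭-sym (rowwise↭cells μ)) c∈)) v≤k)))

  restrict-superstandard⁻ : ∀ {k} → Superstandard (restrict k T) →
    ∀ {c c′} → c ∈ cells μ → c′ ∈ cells μ → e c ≤ k → e c′ ≤ k → row c < row c′ → e c < e c′
  restrict-superstandard⁻ {k} ss c∈ c′∈ p q lt = sorted-before⁻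
    (subst (AllPairs _<_) (trans (concat-restrict k T) (cong (filter (_≤? k)) (concat-filling e μ))) (superstandard-sorted ss))
    (before-filter (_≤? k) p q (before-map e (sorted-before⁺ <ˡ-asym (rowwise-sorted μ) (∈-rowwise c∈) (∈-rowwise c′∈) (inj₁ lt))))
    where
    ∈-rowwise : ∀ {c} → c ∈ cells μ → c ∈ rowwise μ
    ∈-rowwise = Perm.∈-resp-↭ (↭-sym (rowwise↭cells μ))

filter-increasing : ∀ k (f : ℕ → ℕ) m → (∀ {i} → suc i < m → f i < f (suc i)) →
  ∃[ l ] filter (_≤? k) (applyUpTo f m) ≡ applyUpTo f l × (∀ {i} → (i < m × f i ≤ k) ⇔ (i < l))
filter-increasing k f zero    inc = 0 , refl , mk⇔ (λ ()) (λ ())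
filter-increasing k f (suc m) inc with f 0 ≤? k | filter-increasing k (f ∘ suc) m (inc ∘ s<s)
... | yes p | l , eq , h = suc l , trans (List.filter-accept (_≤? k) p) (cong (f 0 ∷_) eq) , λ {i} → mk⇔ to (from i)
  where
  to : ∀ {i} → i < suc m × f i ≤ k → i < suc l
  to {zero}  _            = z<s
  to {suc i} (s<s i< , q) = s<s (Equivalence.to h (i< , q))
  from : ∀ i → i < suc l → i < suc m × f i ≤ k
  from zero    _        = z<s , p
  from (suc i) (s<s i<) = let i<m , q = Equivalence.from h i< in s<s i<m , q
... | no ¬p | l , eq , h = 0 , trans (List.filter-reject (_≤? k) ¬p) (trans eq (cong (applyUpTo (f ∘ suc)) (n≤0⇒n≡0 (≮⇒≥ λ 0<l → let 0<m , q = Equivalence.from h 0<l in large 1 (s<s 0<m) q))))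
    , λ {i} → mk⇔ (λ { (i< , q) → contradiction q (large i i<) }) (λ ())
  where
  large : ∀ i → i < suc m → ¬ f i ≤ k
  large zero    _        q = ¬p q
  large (suc i) i< q = large i (<-trans (n<1+n i) i<) (≤-trans (<⇒≤ (inc i<)) q)

restrict-∷ : ∀ k R T → restrict k (R ∷ T) ≡ filter (λ r → 0 <? length r) [ filter (_≤? k) R ] ++ restrict k T
restrict-∷ k R T = List.filter-++ (λ r → 0 <? length r) [ filter (_≤? k) R ] (map (filter (_≤? k)) T)

restricted-rows : ∀ k μ e → (∀ r → nth 0 μ (suc r) ≤ nth 0 μ r) →
  (∀ {r c} → suc c < nth 0 μ r → e (suc r , suc c) < e (suc r , suc (suc c))) →
  (∀ {r c} → c < nth 0 μ (suc r) → e (suc r , suc c) < e (suc (suc r) , suc c)) →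
  ∀ r c → (c < nth 0 μ r × e (suc r , suc c) ≤ k) ⇔ (c < nth 0 (shape (restrict k (filling e μ))) r)
restricted-rows k []      e d rows columns r c = mk⇔ (λ ()) (λ ())
restricted-rows k (m ∷ μ) e d rows columns r c
  with filter-increasing k (λ c → e (1 , suc c)) m (rows {0})
     | restricted-rows k μ (e ∘ up) (d ∘ suc) (λ {r} → rows {suc r}) (λ {r} → columns {suc r})
... | zero , eq , h | ih = mk⇔ (λ { (c< , q) → contradiction (large r c c<) (≤⇒≯ q) }) λ c< → contradiction (subst (λ T → c < nth 0 (shape T) r) restricted c<) (empty r)
  where
  restricted : restrict k (filling e (m ∷ μ)) ≡ restrict k (filling (e ∘ up) μ)
  restricted = trans (restrict-∷ k (applyUpTo (λ c → e (1 , suc c)) m) (filling (e ∘ up) μ))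
    (cong (λ R → filter (λ r → 0 <? length r) [ R ] ++ restrict k (filling (e ∘ up) μ)) eq)
  large : ∀ r c → c < nth 0 (m ∷ μ) r → k < e (suc r , suc c)
  large zero    c c< = ≰⇒> λ q → case Equivalence.to h (c< , q) of λ ()
  large (suc r) c c< = <-trans (large r c (<-≤-trans c< (d r))) (columns {r} c<)
  empty : ∀ r → ¬ c < nth 0 (shape (restrict k (filling (e ∘ up) μ))) r
  empty r c< = let c<′ , q = Equivalence.from (ih r c) c< in <⇒≱ (large (suc r) c c<′) q
... | suc l , eq , h | ih = subst (λ T → (c < nth 0 (m ∷ μ) r × e (suc r , suc c) ≤ k) ⇔ (c < nth 0 (shape T) r)) (sym restricted) (go r)
  where
  R = applyUpTo (λ c → e (1 , suc c)) (suc l)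
  restricted : restrict k (filling e (m ∷ μ)) ≡ R ∷ restrict k (filling (e ∘ up) μ)
  restricted = trans (restrict-∷ k (applyUpTo (λ c → e (1 , suc c)) m) (filling (e ∘ up) μ))
    (cong (λ R → filter (λ r → 0 <? length r) [ R ] ++ restrict k (filling (e ∘ up) μ)) eq)
  go : ∀ r → (c < nth 0 (m ∷ μ) r × e (suc r , suc c) ≤ k) ⇔ (c < nth 0 (shape (R ∷ restrict k (filling (e ∘ up) μ))) r)
  go zero    = subst (λ x → (c < m × e (1 , suc c) ≤ k) ⇔ (c < x)) (sym (List.length-applyUpTo (λ c → e (1 , suc c)) (suc l))) h
  go (suc r) = ih r c

row-≤-run : ∀ {μ m R} → Family μ m R → ∀ {r c} → c ∈ R r → row c ≤ r
row-≤-run {μ} F c∈ with ∈-cells⁻ μ (Family.⊆-cells F c∈)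
row-≤-run {μ} F c∈ | x , k , refl , k< = go x k< c∈
  where
  open Family F
  go : ∀ x {k r} → k < nth 0 μ x → (suc x , suc k) ∈ _ → suc x ≤ r
  go zero    k< c∈ = proj₁ (range c∈)
  go (suc x) k< c∈ = let k<′ = <-≤-trans k< (partition-≥ partition x) ; s , d∈ = cover (∈-cells⁺ {μ} k<′) in
    ≤-trans (s≤s (go x k<′ d∈)) (columns d∈ c∈)

record FirstBad (m : ℕ) (R : ℕ → List Cell) (j : ℕ) : Set where
  field
    j≥1   : 1 ≤ j
    j≤m   : j ≤ m
    rowed : ∀ {s c} → s < j → c ∈ R s → row c ≡ s
    bad   : ∃[ c ] c ∈ R j × row c ≢ j

record RunStructure (T : Tableau) (μ : List ℕ) (e : Cell → ℕ) : Set where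
  field
    family           : Family μ (nRuns T) (run T)
    assembled        : T ≡ assemble μ (nRuns T) (run T)
    length-run       : ∀ r → length (run T r) ≡ β T r
    ∈-cellsBelow     : ∀ {i j h c} → c ∈ cellsBelow T i j h ⇔ ((c ∈ run T i ⊎ c ∈ run T j) × row c < h)
    cellsBelow-sorted : ∀ i j h → AllPairs _<ᵣ_ (cellsBelow T i j h)
    firstRuns-rows   : ∀ {j x k} → k < nth 0 (shape (firstRuns T j)) x ⇔ (∃[ r ] r ≤ j × (suc x , suc k) ∈ run T r)
    firstBad⁻        : ∀ {j} → firstBadRun T ≡ just j → FirstBad (nRuns T) (run T) j
    firstBad⁺        : ∀ {j} → FirstBad (nRuns T) (run T) j → firstBadRun T ≡ just j

module SuperstandardRuns {μ e} (std : Standard μ e)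
  {m : ℕ} {R : ℕ → List Cell} {Bk : ℕ → ℕ}
  (F : Family μ m R) (comp : Compatible e R)
  (lower  : ∀ {r c} → c ∈ R r → Bk (r ∸ 1) < e c)
  (upper  : ∀ {r c} → c ∈ R r → e c ≤ Bk r)
  (B-mono : ∀ {r s} → r ≤ s → Bk r ≤ Bk s)
  (B-≤    : ∀ r → Bk r ≤ length (cells μ))
  where
  open Family F using (cover; range; descents; partition) renaming (⊆-cells to ∈-cells)
  open StandardFilling std using (T)
  open StandardSuperstandard std

  restrictTo : ℕ → Tableau
  restrictTo r = restrict (Bk r) T

  run-index-≤ : ∀ {j r c} → c ∈ R r → e c ≤ Bk j → r ≤ j
  run-index-≤ c∈ p = ≮⇒≥ λ { (s≤s j≤) → <⇒≱ (lower c∈) (≤-trans p (B-mono j≤)) }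

  firstRuns-superstandard⁺ : ∀ {j} → (∀ {s c} → s ≤ j → c ∈ R s → row c ≡ s) → Superstandard (restrictTo j)
  firstRuns-superstandard⁺ {j} rowed = restrict-superstandard⁺ (B-≤ j) λ c∈ c′∈ p q lt →
    let r , c∈r = cover c∈ ; s , c′∈s = cover c′∈ in
    comp {r} {s} c∈r c′∈s (inj₁ (subst₂ _<_ (rowed (run-index-≤ {j} c∈r p) c∈r) (rowed (run-index-≤ {j} c′∈s q) c′∈s) lt))

  firstRuns-superstandard⁻ : ∀ j → j ≤ m → (∀ {s c} → s < j → c ∈ R s → row c ≡ s) →
    Superstandard (restrictTo j) → ∀ {c} → c ∈ R j → row c ≡ j
  firstRuns-superstandard⁻ zero          j≤m rowed ss {c} c∈ = contradiction (proj₁ (range {0} c∈)) λ ()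
  firstRuns-superstandard⁻ (suc zero)    j≤m rowed ss {c} c∈ with ∈-cells⁻ μ (∈-cells c∈)
  ... | _ , _ , refl , _ = ≤-antisym (row-≤-run F c∈) z<s
  firstRuns-superstandard⁻ j@(suc (suc i)) j≤m rowed ss {c} c∈ with descents {suc i} z<s j≤m
  ... | d , d′ , d∈ , d′∈ , d′<d = ≤-antisym (row-≤-run F c∈) (≮⇒≥ λ lt →
    <-asym (restrict-superstandard⁻ {Bk j} ss (∈-cells c∈) (∈-cells d′∈) (upper c∈) (upper d′∈) (<-≤-trans lt (row-d′ d′<d)))
      (comp {j} {j} d′∈ c∈ (inj₂ (refl , inj₁ (<-≤-trans lt (row-d′ d′<d))))))
    where
    row-d′ : d′ <ᵣ d → j ≤ row d′
    row-d′ (inj₁ lt)        = subst (_< row d′) (rowed (n<1+n (suc i)) d∈) lt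
    row-d′ (inj₂ (eq , lt)) = contradiction (row-increasing (∈-cells d′∈) (∈-cells d∈) eq lt)
      (<-asym (comp {suc i} {j} d∈ d′∈ (inj₁ (n<1+n (suc i)))))

  bad? : Decidable (λ r → ¬ Superstandard (restrictTo r))
  bad? r = ¬? (superstandard? (restrictTo r))

  find-firstBad⁻ : ∀ {j} → List.find bad? [1⋯ m ] ≡ just j → FirstBad (m) (R) j
  find-firstBad⁻ {j} eq with find-just⁻ bad? ([1⋯]-sorted (m)) eq
  ... | j∈ , ¬ss , min = record
    { j≥1 = proj₁ (∈-[1⋯]⁻ j∈) ; j≤m = proj₂ (∈-[1⋯]⁻ j∈) ; rowed = rowed j ≤-refl ; bad = bad }
    where
    rowed : ∀ t → t ≤ j → ∀ {s c} → s < t → c ∈ R s → row c ≡ s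
    rowed (suc t) t<j {s} s<t c∈ with m≤n⇒m<n∨m≡n (s≤s⁻¹ s<t)
    ... | inj₁ lt   = rowed t (<⇒≤ t<j) lt c∈
    ... | inj₂ refl = firstRuns-superstandard⁻ s (proj₂ (range {s} c∈)) (rowed s (<⇒≤ t<j))
      (decidable-stable (superstandard? (restrictTo s)) (min (∈-[1⋯]⁺ (proj₁ (range {s} c∈)) (proj₂ (range {s} c∈))) t<j)) c∈
    bad : ∃[ c ] c ∈ R j × row c ≢ j
    bad with All.all? (λ c → row c ≟ j) (R j)
    ... | no ¬all = find (All.¬All⇒Any¬ (λ c → row c ≟ j) (R j) ¬all)
    ... | yes all = contradiction (firstRuns-superstandard⁺ {j} rowed′) ¬ss
      where
      rowed′ : ∀ {s c} → s ≤ j → c ∈ R s → row c ≡ s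
      rowed′ {s} s≤j c∈ with m≤n⇒m<n∨m≡n s≤j
      ... | inj₁ s<j  = rowed j ≤-refl s<j c∈
      ... | inj₂ refl = All.lookup all c∈

  find-firstBad⁺ : ∀ {j} → FirstBad (m) (R) j → List.find bad? [1⋯ m ] ≡ just j
  find-firstBad⁺ {j} B = find-just⁺ bad? ([1⋯]-sorted (m)) (∈-[1⋯]⁺ j≥1 j≤m)
    (λ ss → proj₂ (proj₂ bad) (firstRuns-superstandard⁻ j j≤m rowed ss (proj₁ (proj₂ bad))))
    (λ {s} _ s<j ¬ss → ¬ss (firstRuns-superstandard⁺ {s} λ t≤s → rowed (≤-<-trans t≤s s<j)))
    where open FirstBad B

  rows-of-restriction : ∀ {j x k} → k < nth 0 (shape (restrictTo j)) x ⇔ (∃[ r ] r ≤ j × (suc x , suc k) ∈ R r)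
  rows-of-restriction {j} {x} {k} = mk⇔
    (λ k< → let k<′ , p = Equivalence.from spec k< ; r , c∈ = cover (∈-cells⁺ {μ} k<′) in r , run-index-≤ c∈ p , c∈)
    (λ { (r , r≤j , c∈) → Equivalence.to spec (∈-cells⇒< {μ} (∈-cells c∈) , ≤-trans (upper c∈) (B-mono r≤j)) })
    where
    spec = restricted-rows (Bk j) μ e (partition-≥ partition) (λ {r} → Standard.rows std {r}) (λ {r} → Standard.columns std {r}) x k

module StandardRunStructure {μ e} (std : Standard μ e) where
  open StandardFilling std using (T)
  open StandardRuns std
  open SuperstandardRuns std {nRuns T} {run T} {b T} run-family (λ {r} {s} → run-compatible {r} {s})
    (λ {r} c∈ → proj₁ (proj₂ (∈-run⁻ {r} c∈))) (λ {r} c∈ → proj₂ (proj₂ (∈-run⁻ {r} c∈))) b-mono b-≤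

  cellsBelow≡ : ∀ i j h → cellsBelow T i j h ≡
    filter (λ c → row c <? h) (filter (λ c → inRun? T i (e c) ⊎-dec inRun? T j (e c)) (cells μ))
  cellsBelow≡ i j h = cong (filter (λ c → row c <? h)) (trans
    (cong (λ cs → map proj₁ (filter (λ c → inRun? T i (proj₂ c) ⊎-dec inRun? T j (proj₂ c)) cs)) (labelledCells-filling e μ))
    (filter-labelled (λ c → inRun? T i (proj₂ c) ⊎-dec inRun? T j (proj₂ c)) e (cells μ)))

  ∈-cellsBelow⇔ : ∀ i j h {c} → c ∈ cellsBelow T i j h ⇔ ((c ∈ run T i ⊎ c ∈ run T j) × row c < h)
  ∈-cellsBelow⇔ i j h {c} = mk⇔ to from
    where
    either? : Decidable (λ c → InRun T i (e c) ⊎ InRun T j (e c))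
    either? c = inRun? T i (e c) ⊎-dec inRun? T j (e c)
    to : c ∈ cellsBelow T i j h → (c ∈ run T i ⊎ c ∈ run T j) × row c < h
    to c∈ with ∈-filter⁻ (λ c → row c <? h) {xs = filter either? (cells μ)} (subst (c ∈_) (cellsBelow≡ i j h) c∈)
    ... | c∈′ , lt with ∈-filter⁻ either? {xs = cells μ} c∈′
    ...   | c∈μ , inj₁ p = inj₁ (∈-run⁺ {i} c∈μ p) , lt
    ...   | c∈μ , inj₂ p = inj₂ (∈-run⁺ {j} c∈μ p) , lt
    from : (c ∈ run T i ⊎ c ∈ run T j) × row c < h → c ∈ cellsBelow T i j h
    from (inj₁ c∈ , lt) = subst (c ∈_) (sym (cellsBelow≡ i j h)) (∈-filter⁺ (λ c → row c <? h)
      (∈-filter⁺ either? (proj₁ (∈-run⁻ {i} c∈)) (inj₁ (proj₂ (∈-run⁻ {i} c∈)))) lt)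
    from (inj₂ c∈ , lt) = subst (c ∈_) (sym (cellsBelow≡ i j h)) (∈-filter⁺ (λ c → row c <? h)
      (∈-filter⁺ either? (proj₁ (∈-run⁻ {j} c∈)) (inj₂ (proj₂ (∈-run⁻ {j} c∈)))) lt)

  runStructure : RunStructure T μ e
  runStructure = record
    { family            = run-family
    ; assembled         = assemble-runs
    ; length-run        = length-run
    ; ∈-cellsBelow      = λ {i} {j} {h} → ∈-cellsBelow⇔ i j h
    ; cellsBelow-sorted = λ i j h → subst (AllPairs _<ᵣ_) (sym (cellsBelow≡ i j h))
        (AllPairs.filter⁺ (λ c → row c <? h) (AllPairs.filter⁺ _ (cells-sorted μ)))
    ; firstRuns-rows    = rows-of-restriction
    ; firstBad⁻         = find-firstBad⁻
    ; firstBad⁺         = find-firstBad⁺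
    }

syt-structure : ∀ {T} → IsSYT T → RunStructure T (shape T) (entry T)
syt-structure {T} syt = subst (λ X → RunStructure X (shape T) (entry T)) (sym (tableau≡filling T))
  (StandardRunStructure.runStructure (IsSYT⇒Standard syt))

-- Moving cells between two runs

cells-down : ∀ {μ} → IsPartition μ → ∀ {x y t u} → (y , u) ∈ cells μ → 1 ≤ x → x ≤ y → 1 ≤ t → t ≤ u → (x , t) ∈ cells μ
cells-down {μ} π {suc x} {suc y} {suc t} c∈ _ (s≤s x≤y) _ (s≤s t≤u) with ∈-cells⁻ μ c∈
... | _ , _ , refl , u< = ∈-cells⁺ {μ} (≤-<-trans t≤u (<-≤-trans u< (go x≤y)))
  where
  go : ∀ {y} → x ≤ y → nth 0 μ y ≤ nth 0 μ x
  go {y} x≤y with m≤n⇒m<n∨m≡n x≤y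
  go {suc y} x≤y | inj₁ (s≤s lt) = ≤-trans (partition-≥ π y) (go lt)
  go {y}     x≤y | inj₂ refl     = ≤-refl

cell-positive : ∀ {μ c} → c ∈ cells μ → 1 ≤ row c × 1 ≤ col c
cell-positive {μ} c∈ with ∈-cells⁻ μ c∈
... | _ , _ , refl , _ = z<s , z<s

rowCells : ℕ → ℕ → List Cell
rowCells x l = map (λ t → x , t) [1⋯ l ]

length-rowCells : ∀ x l → length (rowCells x l) ≡ l
length-rowCells x l = trans (List.length-map (λ t → x , t) [1⋯ l ]) (List.length-applyUpTo suc l)

∈-rowCells⁺ : ∀ {x t l} → 1 ≤ t → t ≤ l → (x , t) ∈ rowCells x l
∈-rowCells⁺ {x} 1≤t t≤l = ∈-map⁺ (λ t → x , t) (∈-[1⋯]⁺ 1≤t t≤l)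

∈-rowCells⁻ : ∀ {x l c} → c ∈ rowCells x l → row c ≡ x × 1 ≤ col c × col c ≤ l
∈-rowCells⁻ {x} c∈ with ∈-map⁻ (λ t → x , t) c∈
... | t , t∈ , refl = refl , ∈-[1⋯]⁻ t∈

rowCells-unique : ∀ x l → Unique (rowCells x l)
rowCells-unique x l = AllPairs.map⁺ (AllPairs.map (λ { lt refl → <-irrefl refl lt }) ([1⋯]-sorted l))

take-⊆ : ∀ k {xs : List A} → take k xs ⊆ xs
take-⊆ k {xs} x∈ = subst (_ ∈_) (List.take++drop≡id k xs) (∈-++⁺ˡ x∈)

drop-⊆ : ∀ k {xs : List A} → drop k xs ⊆ xs
drop-⊆ k {xs} x∈ = subst (_ ∈_) (List.take++drop≡id k xs) (∈-++⁺ʳ (take k xs) x∈)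

∈-take⊎drop : ∀ k {xs : List A} {x} → x ∈ xs → x ∈ take k xs ⊎ x ∈ drop k xs
∈-take⊎drop k {xs} x∈ = ∈-++⁻ (take k xs) (subst (_ ∈_) (sym (List.take++drop≡id k xs)) x∈)

sorted-++⁻ : ∀ {R : Rel A 0ℓ} {xs ys} → AllPairs R (xs ++ ys) → ∀ {x y} → x ∈ xs → y ∈ ys → R x y
sorted-++⁻ s x∈ y∈ = sorted-before⁻ s (before-++⁺ x∈ y∈)

take-drop-sorted : ∀ {R : Rel A 0ℓ} k {xs} → AllPairs R xs → ∀ {x y} → x ∈ take k xs → y ∈ drop k xs → R x y
take-drop-sorted {R = R} k {xs} s = sorted-++⁻ (subst (AllPairs R) (sym (List.take++drop≡id k xs)) s)

nonempty : ∀ {xs : List A} → 0 < length xs → ∃[ x ] x ∈ xs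
nonempty {xs = x ∷ xs} _ = x , here refl

module FamilyProperties {μ m R} (F : Family μ m R) where
  open Family F

  rows-mono : ∀ {r s c c′} → c ∈ R r → c′ ∈ R s → row c ≡ row c′ → col c < col c′ → r ≤ s
  rows-mono {r} {s} {x , t} {.x , u} c∈ c′∈ refl lt = go u lt c′∈
    where
    go : ∀ u {s} → t < u → (x , u) ∈ R s → r ≤ s
    go (suc u) (s≤s t≤u) c′∈ with m≤n⇒m<n∨m≡n t≤u
    ... | inj₂ refl = rows c∈ c′∈
    ... | inj₁ t<u with cover (cells-down partition {x} {x} {u} {suc u} (⊆-cells c′∈)
                         (proj₁ (cell-positive {μ} (⊆-cells c′∈))) ≤-refl (≤-trans z<s t<u) (n≤1+n u))
    ...   | s′ , d∈ = ≤-trans (go u t<u d∈) (rows d∈ c′∈)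

  columns-mono : ∀ {r s c c′} → c ∈ R r → c′ ∈ R s → col c ≡ col c′ → row c < row c′ → r < s
  columns-mono {r} {s} {x , t} {y , .t} c∈ c′∈ refl lt = go y lt c′∈
    where
    go : ∀ y {s} → x < y → (y , t) ∈ R s → r < s
    go (suc y) (s≤s x≤y) c′∈ with m≤n⇒m<n∨m≡n x≤y
    ... | inj₂ refl = columns c∈ c′∈
    ... | inj₁ x<y with cover (cells-down partition {y} {suc y} {t} {t} (⊆-cells c′∈)
                         (≤-trans z<s x<y) (n≤1+n y) (proj₂ (cell-positive {μ} (⊆-cells c′∈))) ≤-refl)
    ...   | s′ , d∈ = <-trans (go y x<y d∈) (columns d∈ c′∈)

  column-below : ∀ {r c x} → c ∈ R r → 1 ≤ x → x ≤ row c → ∃[ s ] s ≤ r × (x , col c) ∈ R s × (x < row c → s < r)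
  column-below {r} {c} {x} c∈ 1≤x x≤ with m≤n⇒m<n∨m≡n x≤
  ... | inj₂ refl = r , ≤-refl , c∈ , λ lt → contradiction lt (<-irrefl refl)
  ... | inj₁ x<   = let s , d∈ = cover (cells-down partition (⊆-cells c∈) 1≤x x≤ (proj₂ (cell-positive {μ} (⊆-cells c∈))) ≤-refl)
                        s<r = columns-mono d∈ c∈ refl x<
                    in s , <⇒≤ s<r , d∈ , λ _ → s<r

  -- A run is a horizontal strip, so pushing its cells down their columns to a common row is injective.
  strip-length : ∀ {r} {x : ℕ} {X Y} → AllPairs _<ᵣ_ X → X ⊆ R r → (∀ {c} → c ∈ X → (x , col c) ∈ Y) → length X ≤ length Y
  strip-length {r} {x} {X} {Y} sX X⊆ f = subst (_≤ length Y) (List.length-map (λ c → x , col c) X)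
    (unique-⊆⇒length≤ (AllPairs.map⁺ (sorted-refine distinct sX)) λ c∈ → case ∈-map⁻ (λ c → x , col c) c∈ of λ where
      (_ , d∈ , refl) → f d∈)
    where
    distinct : ∀ {c c′} → c ∈ X → c′ ∈ X → c <ᵣ c′ → (x , col c) ≢ (x , col c′)
    distinct c∈ c′∈ (inj₁ lt)       eq = <-irrefl refl (columns-mono (X⊆ c′∈) (X⊆ c∈) (sym (cong proj₂ eq)) lt)
    distinct c∈ c′∈ (inj₂ (_ , lt)) eq = <⇒≢ lt (cong proj₂ eq)

upperCells lowerCells belowCells : (ℕ → List Cell) → ℕ → ℕ → List Cell
upperCells R j i = filter (λ c → suc i ≤? row c) (R j)
lowerCells R j i = filter (λ c → row c <? suc i) (R j)
belowCells R j i = R i ++ lowerCells R j i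

moveCells : (ℕ → List Cell) → (i j k : ℕ) → ℕ → List Cell
moveCells R i j k r =
  if does (r ≟ i) then take k (belowCells R j i)
  else if does (r ≟ j) then upperCells R j i ++ drop k (belowCells R j i)
  else R r

moveCells-first : ∀ R i j k → moveCells R i j k i ≡ take k (belowCells R j i)
moveCells-first R i j k rewrite dec-true (i ≟ i) refl = refl

moveCells-second : ∀ R {i j} k → i < j → moveCells R i j k j ≡ upperCells R j i ++ drop k (belowCells R j i)
moveCells-second R {i} {j} k i<j rewrite dec-false (j ≟ i) (λ { refl → <-irrefl refl i<j }) | dec-true (j ≟ j) refl = refl

moveCells-other : ∀ R {i j} k {r} → r ≢ i → r ≢ j → moveCells R i j k r ≡ R r
moveCells-other R {i} {j} k {r} r≢i r≢j rewrite dec-false (r ≟ i) r≢i | dec-false (r ≟ j) r≢j = refl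

module BadFamily {μ m R} (F : Family μ m R) {j} (B : FirstBad m R j) where
  open Family F
  open FamilyProperties F
  open FirstBad B public

  run-in-row : ∀ {r c} → r ≤ j → c ∈ R r → row c < j → r ≡ row c ⊎ r ≡ j
  run-in-row r≤j c∈ _ with m≤n⇒m<n∨m≡n r≤j
  ... | inj₁ r<j = inj₁ (sym (rowed r<j c∈))
  ... | inj₂ r≡j = inj₂ r≡j

  top : ∀ {r} → 1 ≤ r → r ≤ j → 2 ≤ j → ∃[ c ] c ∈ R r × row c ≡ r
  top {r} 1≤r r≤j 2≤j with m≤n⇒m<n∨m≡n r≤j
  ... | inj₁ r<j = let c , _ , c∈ , _ = descents 1≤r (<-≤-trans r<j j≤m) in c , c∈ , rowed r<j c∈
  top {suc (suc i)} 1≤r r≤j 2≤j | inj₂ refl with descents {suc i} z<s j≤m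
  ... | d , d′ , d∈ , d′∈ , d′<d = d′ , d′∈ , ≤-antisym (row-≤-run F d′∈) (row-d′ d′<d)
    where
    row-d′ : d′ <ᵣ d → suc (suc i) ≤ row d′
    row-d′ (inj₁ lt)        = subst (_< row d′) (rowed (n<1+n (suc i)) d∈) lt
    row-d′ (inj₂ (eq , lt)) = contradiction (rows-mono d′∈ d∈ eq lt) (<⇒≱ (n<1+n (suc i)))
  top {suc zero} 1≤r r≤j (s≤s ()) | inj₂ refl

  upper lower belows : ℕ → List Cell
  upper  = upperCells R j
  lower  = lowerCells R j
  belows = belowCells R j

  ∈-upper⁻ : ∀ i {c} → c ∈ upper i → c ∈ R j × suc i ≤ row c
  ∈-upper⁻ i = ∈-filter⁻ (λ c → suc i ≤? row c) {xs = R j}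

  ∈-lower⁻ : ∀ i {c} → c ∈ lower i → c ∈ R j × row c ≤ i
  ∈-lower⁻ i c∈ = let p , q = ∈-filter⁻ (λ c → row c <? suc i) {xs = R j} c∈ in p , s≤s⁻¹ q

  ∈-upper⁺ : ∀ i {c} → c ∈ R j → suc i ≤ row c → c ∈ upper i
  ∈-upper⁺ i = ∈-filter⁺ (λ c → suc i ≤? row c)

  ∈-lower⁺ : ∀ i {c} → c ∈ R j → row c ≤ i → c ∈ lower i
  ∈-lower⁺ i c∈ p = ∈-filter⁺ (λ c → row c <? suc i) c∈ (s≤s p)

  upper-sorted : ∀ i → AllPairs _<ᵣ_ (upper i)
  upper-sorted i = AllPairs.filter⁺ (λ c → suc i ≤? row c) (sorted j)

  lower-sorted : ∀ i → AllPairs _<ᵣ_ (lower i)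
  lower-sorted i = AllPairs.filter⁺ (λ c → row c <? suc i) (sorted j)

  run-j≡ : ∀ i → R j ≡ upper i ++ lower i
  run-j≡ i = sorted-≡ <ᵣ-asym (sorted j)
    (AllPairs.++⁺ (upper-sorted i) (lower-sorted i) (All.tabulate λ c∈ → All.tabulate λ c′∈ →
      inj₁ (≤-<-trans (proj₂ (∈-lower⁻ i c′∈)) (proj₂ (∈-upper⁻ i c∈)))))
    (λ {c} c∈ → case suc i ≤? row c of λ where
      (yes p) → ∈-++⁺ˡ (∈-upper⁺ i c∈ p)
      (no ¬p) → ∈-++⁺ʳ (upper i) (∈-lower⁺ i c∈ (s≤s⁻¹ (≰⇒> ¬p))))
    (λ c∈ → case ∈-++⁻ (upper i) c∈ of λ where
      (inj₁ p) → proj₁ (∈-upper⁻ i p)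
      (inj₂ p) → proj₁ (∈-lower⁻ i p))

  length-run-j : ∀ i → length (R j) ≡ length (upper i) + length (lower i)
  length-run-j i = trans (cong length (run-j≡ i)) (List.length-++ (upper i))

  upper-length : ∀ {i} → 1 ≤ i → i < j → length (upper i) ≤ length (R i)
  upper-length {i} 1≤i i<j = strip-length {r = j} {x = i} (upper-sorted i) (λ c∈ → proj₁ (∈-upper⁻ i c∈)) λ {c} c∈ →
    let c∈j , lt = ∈-upper⁻ i c∈ ; s , _ , d∈ , s<j = column-below c∈j 1≤i (<⇒≤ lt)
    in subst (λ r → (i , col c) ∈ R r) (sym (rowed (s<j lt) d∈)) d∈

  ∈-belows⁻ : ∀ {i} → i < j → ∀ {c} → c ∈ belows i → (c ∈ R i ⊎ c ∈ R j) × row c ≤ i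
  ∈-belows⁻ {i} i<j c∈ with ∈-++⁻ (R i) c∈
  ... | inj₁ p = inj₁ p , ≤-reflexive (rowed i<j p)
  ... | inj₂ p = inj₂ (proj₁ (∈-lower⁻ i p)) , proj₂ (∈-lower⁻ i p)

  ∈-belows⁺ : ∀ {i} → i < j → ∀ {c} → c ∈ R i ⊎ c ∈ R j → row c ≤ i → c ∈ belows i
  ∈-belows⁺ {i} i<j (inj₁ p) q = ∈-++⁺ˡ p
  ∈-belows⁺ {i} i<j (inj₂ p) q = ∈-++⁺ʳ (R i) (∈-lower⁺ i p q)

  belows-sorted : ∀ {i} → i < j → AllPairs _<ᵣ_ (belows i)
  belows-sorted {i} i<j = AllPairs.++⁺ (sorted i) (lower-sorted i)
    (All.tabulate λ c∈ → All.tabulate λ d∈ → lt c∈ (proj₁ (∈-lower⁻ i d∈)) (proj₂ (∈-lower⁻ i d∈)))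
    where
    lt : ∀ {c d} → c ∈ R i → d ∈ R j → row d ≤ i → c <ᵣ d
    lt {c} {d} c∈ d∈ row≤ with <ᵣ-total c d
    ... | inj₁ p                      = p
    ... | inj₂ (inj₁ refl)            = contradiction (disjoint c∈ d∈) (<⇒≢ i<j)
    ... | inj₂ (inj₂ (inj₁ p))        = contradiction (subst (_< row d) (rowed i<j c∈) p) (≤⇒≯ row≤)
    ... | inj₂ (inj₂ (inj₂ (eq , p))) = contradiction (rows-mono d∈ c∈ eq p) (<⇒≱ i<j)

  data Moved (i k : ℕ) (c : Cell) : ℕ → Set where
    first : c ∈ take k (belows i) → Moved i k c i
    kept  : c ∈ upper i → Moved i k c j
    second : c ∈ drop k (belows i) → Moved i k c j
    other : ∀ {r} → r ≢ i → r ≢ j → c ∈ R r → Moved i k c r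

  moved : ∀ {i} k {r c} → i < j → c ∈ moveCells R i j k r → Moved i k c r
  moved {i} k {r} i<j c∈ = by-cases (r ≟ i) (r ≟ j)
    where
    by-cases : Dec (r ≡ i) → Dec (r ≡ j) → Moved i k _ r
    by-cases (yes refl) _          = first (subst (_ ∈_) (moveCells-first R i j k) c∈)
    by-cases (no r≢i)   (no r≢j)   = other r≢i r≢j (subst (_ ∈_) (moveCells-other R k r≢i r≢j) c∈)
    by-cases (no r≢i)   (yes refl) with ∈-++⁻ (upper i) (subst (_ ∈_) (moveCells-second R k i<j) c∈)
    ... | inj₁ p = kept p
    ... | inj₂ p = second p

  module Move {i k} (1≤i : 1 ≤ i) (i<j : i < j) (k+j : k + j ≡ length (R j) + i)
    (fits : ∀ {r t} → r ≤ j → (suc i , t) ∈ R r → t ≤ k) {N : ℕ → List Cell} (N≡ : ∀ r → N r ≡ moveCells R i j k r) where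

    N-first : N i ≡ take k (belows i)
    N-first = trans (N≡ i) (moveCells-first R i j k)

    N-second : N j ≡ upper i ++ drop k (belows i)
    N-second = trans (N≡ j) (moveCells-second R k i<j)

    N-other : ∀ {r} → r ≢ i → r ≢ j → N r ≡ R r
    N-other r≢i r≢j = trans (N≡ _) (moveCells-other R k r≢i r≢j)

    N-moved : ∀ {r c} → c ∈ N r → Moved i k c r
    N-moved {r} c∈ = moved k i<j (subst (_ ∈_) (N≡ r) c∈)

    2≤j : 2 ≤ j
    2≤j = ≤-trans (s≤s 1≤i) i<j

    below-sorted : AllPairs _<ᵣ_ (belows i)
    below-sorted = belows-sorted i<j

    ∈-take⁻ : ∀ {c} → c ∈ take k (belows i) → (c ∈ R i ⊎ c ∈ R j) × row c ≤ i
    ∈-take⁻ c∈ = ∈-belows⁻ i<j (take-⊆ k c∈)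

    ∈-drop⁻ : ∀ {c} → c ∈ drop k (belows i) → (c ∈ R i ⊎ c ∈ R j) × row c ≤ i
    ∈-drop⁻ c∈ = ∈-belows⁻ i<j (drop-⊆ k c∈)

    ∈-N-i : ∀ {c} → c ∈ take k (belows i) → c ∈ N i
    ∈-N-i c∈ = subst (_ ∈_) (sym (N-first)) c∈

    ∈-N-j : ∀ {c} → c ∈ upper i ++ drop k (belows i) → c ∈ N j
    ∈-N-j c∈ = subst (_ ∈_) (sym (N-second)) c∈

    ∈-N-other : ∀ {r c} → r ≢ i → r ≢ j → c ∈ R r → c ∈ N r
    ∈-N-other r≢i r≢j c∈ = subst (_ ∈_) (sym (N-other r≢i r≢j)) c∈

    k≥1 : 1 ≤ k
    k≥1 with top {suc i} z<s i<j 2≤j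
    ... | (_ , t) , c∈ , refl = ≤-trans (proj₂ (cell-positive {μ} (⊆-cells c∈))) (fits i<j c∈)

    k<length-belows : k < length (belows i)
    k<length-belows = subst (k <_) (sym (List.length-++ (R i))) (+-cancelʳ-< j k _ (begin-strict
      k + j ≡⟨ k+j ⟩
      length (R j) + i ≡⟨ cong (_+ i) (length-run-j i) ⟩
      length (upper i) + length (lower i) + i <⟨ +-mono-≤-< (+-monoˡ-≤ (length (lower i)) (upper-length 1≤i i<j)) i<j ⟩
      length (R i) + length (lower i) + j ∎))
      where open ≤-Reasoning

    length-first : length (take k (belows i)) ≡ k
    length-first = trans (List.length-take k (belows i)) (m≤n⇒m⊓n≡m (<⇒≤ k<length-belows))

    second-nonempty : ∃[ c ] c ∈ drop k (belows i)
    second-nonempty = nonempty (subst (0 <_) (sym (List.length-drop k (belows i))) (m<n⇒0<n∸m k<length-belows))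

    -- The k cells that precede c = (i , t) in `belows i` are among (i , 1), …, (i , t - 1).
    dropped-column : ∀ {t} → (i , t) ∈ drop k (belows i) → k < t
    dropped-column {zero}  c∈ = contradiction (proj₂ (cell-positive {μ} (cell∈ (proj₁ (∈-drop⁻ c∈))))) λ ()
      where
      cell∈ : (i , 0) ∈ R i ⊎ (i , 0) ∈ R j → (i , 0) ∈ cells μ
      cell∈ (inj₁ p) = ⊆-cells p
      cell∈ (inj₂ p) = ⊆-cells p
    dropped-column {suc t} c∈ = s≤s (subst₂ _≤_ length-first (length-rowCells i t)
      (unique-⊆⇒length≤ (sorted⇒unique <ᵣ-asym (AllPairs.take⁺ k below-sorted)) λ d∈ →
        go d∈ (∈-take⁻ d∈) (take-drop-sorted k below-sorted d∈ c∈)))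
      where
      go : ∀ {d} → d ∈ take k (belows i) → (d ∈ R i ⊎ d ∈ R j) × row d ≤ i → d <ᵣ (i , suc t) → d ∈ rowCells i t
      go _ (_ , row≤)   (inj₁ lt)             = contradiction lt (≤⇒≯ row≤)
      go _ (inj₁ d∈ , _) (inj₂ (refl , s≤s lt)) = ∈-rowCells⁺ (proj₂ (cell-positive {μ} (⊆-cells d∈))) lt
      go _ (inj₂ d∈ , _) (inj₂ (refl , s≤s lt)) = ∈-rowCells⁺ (proj₂ (cell-positive {μ} (⊆-cells d∈))) lt

    ¬column-in-belows : ∀ {x t} → (x , t) ∈ belows i → (suc x , t) ∈ belows i → ⊥
    ¬column-in-belows c∈ c′∈ with ∈-belows⁻ i<j c∈ | ∈-belows⁻ i<j c′∈
    ... | inj₁ p , _ | inj₁ q , _ = <-irrefl refl (columns p q)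
    ... | inj₁ p , _ | inj₂ q , r = <⇒≱ (n<1+n i) (subst (λ x → suc x ≤ i) (rowed i<j p) r)
    ... | inj₂ p , _ | inj₁ q , _ = <-asym i<j (columns p q)
    ... | inj₂ p , _ | inj₂ q , _ = <-irrefl refl (columns p q)

    N-range : ∀ {r c} → c ∈ N r → 1 ≤ r × r ≤ m
    N-range c∈ with N-moved c∈
    ... | first _     = 1≤i , ≤-trans (<⇒≤ i<j) j≤m
    ... | kept _      = j≥1 , j≤m
    ... | second _    = j≥1 , j≤m
    ... | other _ _ p = range p

    old-cells : ∀ {c} → c ∈ R i ⊎ c ∈ R j → c ∈ cells μ
    old-cells (inj₁ p) = ⊆-cells p
    old-cells (inj₂ p) = ⊆-cells p

    N-cells : ∀ {r c} → c ∈ N r → c ∈ cells μ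
    N-cells c∈ with N-moved c∈
    ... | first p     = old-cells (proj₁ (∈-take⁻ p))
    ... | kept p      = ⊆-cells (proj₁ (∈-upper⁻ i p))
    ... | second p    = old-cells (proj₁ (∈-drop⁻ p))
    ... | other _ _ p = ⊆-cells p

    from-belows : ∀ {c} → c ∈ belows i → ∃[ r ] c ∈ N r
    from-belows c∈ with ∈-take⊎drop k c∈
    ... | inj₁ p = i , ∈-N-i p
    ... | inj₂ p = j , ∈-N-j (∈-++⁺ʳ (upper i) p)

    N-cover : ∀ {c} → c ∈ cells μ → ∃[ r ] c ∈ N r
    N-cover {c} c∈ with cover c∈
    ... | r , p = by-cases (r ≟ i) (r ≟ j) (suc i ≤? row c)
      where
      by-cases : Dec (r ≡ i) → Dec (r ≡ j) → Dec (suc i ≤ row c) → ∃[ s ] c ∈ N s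
      by-cases (yes refl) _          _       = from-belows (∈-++⁺ˡ p)
      by-cases (no r≢i)   (no r≢j)   _       = r , ∈-N-other r≢i r≢j p
      by-cases (no _)     (yes refl) (yes q) = j , ∈-N-j (∈-++⁺ˡ (∈-upper⁺ i p q))
      by-cases (no _)     (yes refl) (no ¬q) = from-belows (∈-++⁺ʳ (R i) (∈-lower⁺ i p (s≤s⁻¹ (≰⇒> ¬q))))

    N-sorted : ∀ r → AllPairs _<ᵣ_ (N r)
    N-sorted r = by-cases (r ≟ i) (r ≟ j)
      where
      by-cases : Dec (r ≡ i) → Dec (r ≡ j) → AllPairs _<ᵣ_ (N r)
      by-cases (yes refl) _          = subst (AllPairs _<ᵣ_) (sym (N-first)) (AllPairs.take⁺ k below-sorted)
      by-cases (no r≢i)   (no r≢j)   = subst (AllPairs _<ᵣ_) (sym (N-other r≢i r≢j)) (sorted r)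
      by-cases (no r≢i)   (yes refl) = subst (AllPairs _<ᵣ_) (sym (N-second))
        (AllPairs.++⁺ (upper-sorted i) (AllPairs.drop⁺ k below-sorted)
          (All.tabulate λ c∈ → All.tabulate λ d∈ → inj₁ (≤-<-trans (proj₂ (∈-drop⁻ d∈)) (proj₂ (∈-upper⁻ i c∈)))))

    old-run : ∀ {c r} → c ∈ R i ⊎ c ∈ R j → c ∈ R r → r ≢ i → r ≢ j → ⊥
    old-run (inj₁ p) q r≢i r≢j = r≢i (disjoint q p)
    old-run (inj₂ p) q r≢i r≢j = r≢j (disjoint q p)

    N-disjoint : ∀ {r s c} → c ∈ N r → c ∈ N s → r ≡ s
    N-disjoint c∈r c∈s with N-moved c∈r | N-moved c∈s
    ... | first _       | first _       = refl
    ... | first p       | kept q        = contradiction (proj₂ (∈-take⁻ p)) (<⇒≱ (proj₂ (∈-upper⁻ i q)))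
    ... | first p       | second q      = contradiction (take-drop-sorted k below-sorted p q) <ᵣ-irrefl
    ... | first p       | other x y q   = ⊥-elim (old-run (proj₁ (∈-take⁻ p)) q x y)
    ... | kept p        | first q       = contradiction (proj₂ (∈-take⁻ q)) (<⇒≱ (proj₂ (∈-upper⁻ i p)))
    ... | kept _        | kept _        = refl
    ... | kept _        | second _      = refl
    ... | kept p        | other x y q   = ⊥-elim (old-run (inj₂ (proj₁ (∈-upper⁻ i p))) q x y)
    ... | second p      | first q       = contradiction (take-drop-sorted k below-sorted q p) <ᵣ-irrefl
    ... | second _      | kept _        = refl
    ... | second _      | second _      = refl
    ... | second p      | other x y q   = ⊥-elim (old-run (proj₁ (∈-drop⁻ p)) q x y)
    ... | other x y p   | first q       = ⊥-elim (old-run (proj₁ (∈-take⁻ q)) p x y)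
    ... | other x y p   | kept q        = ⊥-elim (old-run (inj₂ (proj₁ (∈-upper⁻ i q))) p x y)
    ... | other x y p   | second q      = ⊥-elim (old-run (proj₁ (∈-drop⁻ q)) p x y)
    ... | other _ _ p   | other _ _ q   = disjoint p q

    below-row : ∀ {r c} → c ∈ R r → r ≤ j → r ≢ j → row c ≡ r
    below-row c∈ r≤j r≢j = rowed (≤∧≢⇒< r≤j r≢j) c∈

    rows-moved : ∀ {r s x t} → Moved i k (x , t) r → Moved i k (x , suc t) s → r ≤ s
    rows-moved (first _)  (first _)     = ≤-refl
    rows-moved (first _)  (kept _)      = <⇒≤ i<j
    rows-moved (first _)  (second _)    = <⇒≤ i<j
    rows-moved (first p)  (other _ _ q) with proj₁ (∈-take⁻ p)
    ... | inj₁ p′ = rows p′ q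
    ... | inj₂ p′ = ≤-trans (<⇒≤ i<j) (rows p′ q)
    rows-moved (kept p)   (first q)     = contradiction (proj₂ (∈-take⁻ q)) (<⇒≱ (proj₂ (∈-upper⁻ i p)))
    rows-moved (kept _)   (kept _)      = ≤-refl
    rows-moved (kept _)   (second _)    = ≤-refl
    rows-moved (kept p)   (other _ _ q) = rows (proj₁ (∈-upper⁻ i p)) q
    rows-moved (second p) (first q)     = contradiction (take-drop-sorted k below-sorted q p) (<ᵣ-asym (inj₂ (refl , n<1+n _)))
    rows-moved (second _) (kept _)      = ≤-refl
    rows-moved (second _) (second _)    = ≤-refl
    rows-moved (second p) (other s≢i _ q) with proj₁ (∈-drop⁻ p)
    ... | inj₁ p′ = ≮⇒≥ λ s<j → s≢i (trans (sym (rowed s<j q)) (rowed i<j p′))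
    ... | inj₂ p′ = rows p′ q
    rows-moved (other _ r≢j p) (first q) with ∈-take⁻ q
    ... | inj₁ q′ , _    = rows p q′
    ... | inj₂ q′ , row≤ = subst (_≤ i) (below-row p (rows p q′) r≢j) row≤
    rows-moved (other _ _ p) (kept q)   = rows p (proj₁ (∈-upper⁻ i q))
    rows-moved (other _ _ p) (second q) with proj₁ (∈-drop⁻ q)
    ... | inj₁ q′ = ≤-trans (rows p q′) (<⇒≤ i<j)
    ... | inj₂ q′ = rows p q′
    rows-moved (other _ _ p) (other _ _ q) = rows p q

    columns-moved : ∀ {r s x t} → Moved i k (x , t) r → Moved i k (suc x , t) s → r < s
    columns-moved (first p)  (first q)     = ⊥-elim (¬column-in-belows (take-⊆ k p) (take-⊆ k q))
    columns-moved (first _)  (kept _)      = i<j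
    columns-moved (first _)  (second _)    = i<j
    columns-moved (first p)  (other _ _ q) with proj₁ (∈-take⁻ p)
    ... | inj₁ p′ = columns p′ q
    ... | inj₂ p′ = <-trans i<j (columns p′ q)
    columns-moved (kept p)   (first q)     = contradiction (proj₂ (∈-take⁻ q)) (<⇒≱ (m<n⇒m<1+n (proj₂ (∈-upper⁻ i p))))
    columns-moved (kept p)   (kept q)      = contradiction (columns (proj₁ (∈-upper⁻ i p)) (proj₁ (∈-upper⁻ i q))) (<-irrefl refl)
    columns-moved (kept p)   (second q)    = contradiction (proj₂ (∈-drop⁻ q)) (<⇒≱ (m<n⇒m<1+n (proj₂ (∈-upper⁻ i p))))
    columns-moved (kept p)   (other _ _ q) = columns (proj₁ (∈-upper⁻ i p)) q
    columns-moved (second p) (first q)     = ⊥-elim (¬column-in-belows (drop-⊆ k p) (take-⊆ k q))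
    columns-moved (second p) (second q)    = ⊥-elim (¬column-in-belows (drop-⊆ k p) (drop-⊆ k q))
    columns-moved (second p) (kept q) with proj₁ (∈-drop⁻ p)
    ... | inj₂ p′ = contradiction (columns p′ (proj₁ (∈-upper⁻ i q))) (<-irrefl refl)
    ... | inj₁ p′ with rowed i<j p′
    ...   | refl = contradiction (fits ≤-refl (proj₁ (∈-upper⁻ i q))) (<⇒≱ (dropped-column p))
    columns-moved (second p) (other _ _ q) with proj₁ (∈-drop⁻ p)
    ... | inj₂ p′ = columns p′ q
    ... | inj₁ p′ with rowed i<j p′
    ...   | refl = ≰⇒> λ s≤j → <⇒≱ (dropped-column p) (fits s≤j q)
    columns-moved (other _ r≢j p) (first q) with ∈-take⁻ q
    ... | inj₁ q′ , _    = columns p q′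
    ... | inj₂ q′ , row≤ = subst (_< i) (below-row p (<⇒≤ (columns p q′)) r≢j) row≤
    columns-moved (other _ _ p) (kept q)   = columns p (proj₁ (∈-upper⁻ i q))
    columns-moved (other _ _ p) (second q) with proj₁ (∈-drop⁻ q)
    ... | inj₁ q′ = <-trans (columns p q′) i<j
    ... | inj₂ q′ = columns p q′
    columns-moved (other _ _ p) (other _ _ q) = columns p q

    N-top : ∀ {r} → 1 ≤ r → r ≤ j → ∃[ c ] c ∈ N r × row c ≡ r
    N-top {r} 1≤r r≤j = by-cases (r ≟ i) (r ≟ j)
      where
      by-cases : Dec (r ≡ i) → Dec (r ≡ j) → ∃[ c ] c ∈ N r × row c ≡ r
      by-cases (no r≢i) (no r≢j) = let c , c∈ , eq = top 1≤r r≤j 2≤j in c , ∈-N-other r≢i r≢j c∈ , eq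
      by-cases (no r≢i) (yes refl) = let c , c∈ , eq = top 1≤r r≤j 2≤j in
        c , ∈-N-j (∈-++⁺ˡ (∈-upper⁺ i c∈ (subst (i <_) (sym eq) i<j))) , eq
      by-cases (yes refl) _ = let c , c∈ , eq = head (R i) refl (proj₁ (proj₂ (top 1≤r r≤j 2≤j))) in c , ∈-N-i c∈ , eq
        where
        head : ∀ Ri → Ri ≡ R i → ∀ {d} → d ∈ Ri → ∃[ c ] c ∈ take k (Ri ++ lower i) × row c ≡ i
        head (c ∷ Ri) eq _ = c , go k≥1 , rowed i<j (subst (c ∈_) eq (here refl))
          where
          go : ∀ {k} → 1 ≤ k → c ∈ take k (c ∷ Ri ++ lower i)
          go {suc k} _ = here refl

    last-second : ∀ {c} → c ∈ R j → ∃[ d ] d ∈ N j × (c ≡ d ⊎ c <ᵣ d)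
    last-second {c} c∈ with suc i ≤? row c
    ... | yes p = c , ∈-N-j (∈-++⁺ˡ (∈-upper⁺ i c∈ p)) , inj₁ refl
    ... | no ¬p with ∈-take⊎drop k (∈-++⁺ʳ (R i) (∈-lower⁺ i c∈ (s≤s⁻¹ (≰⇒> ¬p))))
    ...   | inj₂ q = c , ∈-N-j (∈-++⁺ʳ (upper i) q) , inj₁ refl
    ...   | inj₁ q = let d , d∈ = second-nonempty in
      d , ∈-N-j (∈-++⁺ʳ (upper i) d∈) , inj₂ (take-drop-sorted k below-sorted q d∈)

    N-descents : ∀ {r} → 1 ≤ r → r < m → ∃₂ λ c c′ → c ∈ N r × c′ ∈ N (suc r) × c′ <ᵣ c
    N-descents {r} 1≤r r<m with <-cmp r j
    ... | tri< r<j _ _ = let c , c∈ , eq = N-top 1≤r (<⇒≤ r<j) ; c′ , c′∈ , eq′ = N-top z<s r<j in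
      c , c′ , c∈ , c′∈ , inj₁ (subst₂ _<_ (sym eq) (sym eq′) (n<1+n r))
    ... | tri≈ _ refl _ with descents 1≤r r<m
    ...   | c , c′ , c∈ , c′∈ , lt with last-second c∈
    ...     | d , d∈ , c≤d = d , c′ , d∈ , ∈-N-other (λ { refl → <-asym i<j (n<1+n j) }) (λ ()) c′∈ , lt′ c≤d
      where
      lt′ : c ≡ d ⊎ c <ᵣ d → c′ <ᵣ d
      lt′ (inj₁ refl) = lt
      lt′ (inj₂ c<d)  = <ᵣ-trans lt c<d
    N-descents {r} 1≤r r<m | tri> _ _ j<r = let c , c′ , c∈ , c′∈ , lt = descents 1≤r r<m in
      c , c′ , ∈-N-other (>⇒≢ (<-trans i<j j<r)) (>⇒≢ j<r) c∈
      , ∈-N-other (>⇒≢ (m<n⇒m<1+n (<-trans i<j j<r))) (>⇒≢ (m<n⇒m<1+n j<r)) c′∈ , lt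

    newFamily : Family μ m N
    newFamily = record
      { partition = partition
      ; positive  = positive
      ; range     = N-range
      ; ⊆-cells   = N-cells
      ; cover     = N-cover
      ; disjoint  = N-disjoint
      ; sorted    = N-sorted
      ; rows      = λ c∈ c′∈ → rows-moved (N-moved c∈) (N-moved c′∈)
      ; columns   = λ c∈ c′∈ → columns-moved (N-moved c∈) (N-moved c′∈)
      ; descents  = N-descents
      }

-- slink and slink⁎ on families of runs

take-length-++ : ∀ (as : List A) {bs} y → take (length as + y) (as ++ bs) ≡ as ++ take y bs
take-length-++ []       y = refl
take-length-++ (a ∷ as) y = cong (a ∷_) (take-length-++ as y)

drop-length-++ : ∀ (as : List A) {bs} y → drop (length as + y) (as ++ bs) ≡ drop y bs
drop-length-++ []       y = refl
drop-length-++ (a ∷ as) y = drop-length-++ as y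

∈-drop-++ : ∀ k (as : List A) {bs} → k < length as → ∃[ x ] x ∈ as × x ∈ drop k (as ++ bs)
∈-drop-++ zero    (a ∷ as) _        = a , here refl , here refl
∈-drop-++ (suc k) (a ∷ as) (s<s k<) = let x , p , q = ∈-drop-++ k as k< in x , there p , q

below-≤ : ∀ {a b} → (∀ {t} → t < a → t < b) → a ≤ b
below-≤ {zero}  f = z≤n
below-≤ {suc a} f = f ≤-refl

row-segment : ∀ {X y l} → AllPairs _<ᵣ_ X → (∀ {c} → c ∈ X → row c ≡ y × 1 ≤ col c × col c ≤ l) → length X ≤ l
row-segment {X} {y} {l} sX f = subst (length X ≤_) (length-rowCells y l)
  (unique-⊆⇒length≤ (sorted⇒unique <ᵣ-asym sX) λ c∈ → go (f c∈))
  where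
  go : ∀ {c} → row c ≡ y × 1 ≤ col c × col c ≤ l → c ∈ rowCells y l
  go (refl , p , q) = ∈-rowCells⁺ p q

-- M x is the number of cells of row x + 1 in the runs 1, …, j.
RowLengths : (ℕ → List Cell) → ℕ → (ℕ → ℕ) → Set
RowLengths R j M = ∀ {x t} → t < M x ⇔ (∃[ r ] r ≤ j × (suc x , suc t) ∈ R r)

record Index (M : ℕ → ℕ) (β j i : ℕ) : Set where
  field
    i≥1     : 1 ≤ i
    i<j     : i < j
    holds   : M i + j ≤ β + i
    minimal : ∀ {x} → 1 ≤ x → x < i → ¬ (M x + j ≤ β + x)

module BadLast {μ m R} (F : Family μ m R) {p} (B : FirstBad m R (suc p)) where
  open Family F
  open FamilyProperties F
  open BadFamily F B

  p≥1 : 1 ≤ p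
  p≥1 = let c , c∈ , row≢ = bad in s≤s⁻¹
    (≤-trans (s≤s (proj₁ (cell-positive {μ} (⊆-cells c∈)))) (≤∧≢⇒< (row-≤-run F c∈) row≢))

  lower-nonempty : 0 < length (lower p)
  lower-nonempty = let c , c∈ , row≢ = bad in
    go (∈-lower⁺ p c∈ (s≤s⁻¹ (≤∧≢⇒< (row-≤-run F c∈) row≢)))
    where
    go : ∀ {c : Cell} {xs} → c ∈ xs → 0 < length xs
    go (here _)  = z<s
    go (there _) = z<s

  length-run-j>upper : length (upper p) < length (R (suc p))
  length-run-j>upper = subst (length (upper p) <_) (sym (length-run-j p)) (m<m+n (length (upper p)) lower-nonempty)

  length-run-j≡suc : length (R (suc p)) ≡ suc (length (R (suc p)) ∸ 1)
  length-run-j≡suc = sym (m+[n∸m]≡n (≤-trans z<s length-run-j>upper))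

  slink-count : (length (R (suc p)) ∸ 1) + suc p ≡ length (R (suc p)) + p
  slink-count = trans (+-suc _ p) (cong (_+ p) (sym length-run-j≡suc))

  slink-fits : ∀ {r t} → r ≤ suc p → (suc p , t) ∈ R r → t ≤ length (R (suc p)) ∸ 1
  slink-fits {r} {t} r≤j c∈ = ≤-trans
    (subst (_≤ length (upper p)) (length-rowCells (suc p) t) (unique-⊆⇒length≤ (rowCells-unique (suc p) t) λ d∈ → in-upper (∈-rowCells⁻ d∈)))
    (s≤s⁻¹ (subst (length (upper p) <_) length-run-j≡suc length-run-j>upper))
    where
    in-upper : ∀ {d} → row d ≡ suc p × 1 ≤ col d × col d ≤ t → d ∈ upper p
    in-upper {d} (refl , 1≤u , u≤t) with cover (cells-down partition (⊆-cells c∈) z<s ≤-refl 1≤u u≤t)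
    ... | s , d∈ = ∈-upper⁺ p (subst (λ s → d ∈ R s) (≤-antisym (s≤ (m≤n⇒m<n∨m≡n u≤t)) (row-≤-run F d∈)) d∈) ≤-refl
      where
      s≤ : col d < t ⊎ col d ≡ t → s ≤ suc p
      s≤ (inj₁ u<t)  = ≤-trans (rows-mono d∈ c∈ refl u<t) r≤j
      s≤ (inj₂ refl) = subst (_≤ suc p) (disjoint c∈ d∈) r≤j

module IndexProperties {μ m R} (F : Family μ m R) {j} (B : FirstBad m R j) {M} (M-rows : RowLengths R j M)
  {i} (I : Index M (length (R j)) j i) where
  open Family F
  open FamilyProperties F
  open BadFamily F B
  open Index I

  M-antitone : ∀ {x y} → x ≤ y → M y ≤ M x
  M-antitone {x} {y} x≤y = below-≤ λ t< → let r , r≤j , c∈ = Equivalence.to M-rows t<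
                                              s , s≤r , d∈ , _ = column-below c∈ z<s (s≤s x≤y)
                                          in Equivalence.from M-rows (s , ≤-trans s≤r r≤j , d∈)

  holds-from : ∀ {x} → i ≤ x → M x + j ≤ length (R j) + x
  holds-from {x} i≤x = ≤-trans (+-monoˡ-≤ j (M-antitone i≤x)) (≤-trans holds (+-monoʳ-≤ (length (R j)) i≤x))

  k : ℕ
  k = (length (R j) + i) ∸ j

  k+j : k + j ≡ length (R j) + i
  k+j = m∸n+n≡m (≤-trans (m≤n+m j (M i)) holds)

  fits : ∀ {r t} → r ≤ j → (suc i , t) ∈ R r → t ≤ k
  fits {r} {zero}  _   _  = z≤n
  fits {r} {suc t} r≤j c∈ = ≤-trans (Equivalence.from M-rows (r , r≤j , c∈)) (m+n≤o⇒m≤o∸n (M i) holds)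

  module Moved⁎ {N : ℕ → List Cell} (N≡ : ∀ r → N r ≡ moveCells R i j k r) where
    open Move i≥1 i<j k+j fits N≡

    first-in-row : ∀ {c} → c ∈ take k (belows i) → row c ≡ i
    first-in-row {c} c∈ = ≤-antisym row≤i (≮⇒≥ (go i refl))
      where
      row≤i : row c ≤ i
      row≤i = proj₂ (∈-belows⁻ i<j (take-⊆ k c∈))
      c∈μ : c ∈ cells μ
      c∈μ with proj₁ (∈-belows⁻ i<j (take-⊆ k c∈))
      ... | inj₁ p = ⊆-cells p
      ... | inj₂ p = ⊆-cells p
      go : ∀ i′ → i′ ≡ i → ¬ row c < i
      go zero          refl lt = contradiction lt λ ()
      go (suc zero)    refl lt = <⇒≱ lt (proj₁ (cell-positive {μ} c∈μ))
      go (suc (suc x)) refl lt = minimal {suc x} z<s ≤-refl (+-cancelˡ-≤ 1 _ _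
        (≤-trans (+-monoˡ-≤ j suc-M≤k) (≤-reflexive (trans k+j (+-suc (length (R j)) (suc x))))))
        where
        in-take : ∀ {d} → d ∈ R i ⊎ d ∈ R j → row d ≡ i → d ∈ take k (belows i)
        in-take h refl with ∈-take⊎drop k (∈-belows⁺ i<j h ≤-refl)
        ... | inj₁ q = q
        ... | inj₂ q = contradiction (take-drop-sorted k (belows-sorted i<j) c∈ q) (<ᵣ-asym (inj₁ lt))
        segment⊆ : ∀ {d} → row d ≡ i × 1 ≤ col d × col d ≤ M (suc x) → d ∈ take k (belows i)
        segment⊆ {_ , suc t} (refl , _ , t≤M) with Equivalence.to M-rows t≤M
        ... | r , r≤j , d∈ with run-in-row r≤j d∈ i<j
        ...   | inj₁ refl = in-take (inj₁ d∈) refl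
        ...   | inj₂ refl = in-take (inj₂ d∈) refl
        suc-M≤k : suc (M (suc x)) ≤ k
        suc-M≤k = subst₂ _≤_ (cong suc (length-rowCells i (M (suc x)))) length-first
          (unique-⊆⇒length≤ {xs = c ∷ rowCells i (M (suc x))}
            (All.tabulate (λ d∈ → λ { refl → <-irrefl (proj₁ (∈-rowCells⁻ d∈)) lt }) ∷ rowCells-unique i (M (suc x)))
            λ { (here refl) → c∈ ; (there d∈) → segment⊆ (∈-rowCells⁻ d∈) })

    moved-firstBad : FirstBad m N j
    moved-firstBad = record
      { j≥1   = j≥1
      ; j≤m   = j≤m
      ; rowed = λ s<j c∈ → rowed′ s<j (N-moved c∈)
      ; bad   = let c , c∈ = second-nonempty in c
          , subst (c ∈_) (sym N-second) (∈-++⁺ʳ (upper i) c∈)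
          , λ eq → <⇒≱ i<j (subst (_≤ i) eq (proj₂ (∈-belows⁻ i<j (drop-⊆ k c∈))))
      }
      where
      rowed′ : ∀ {s c} → s < j → Moved i k c s → row c ≡ s
      rowed′ _   (first c∈)     = first-in-row c∈
      rowed′ s<j (kept _)       = contradiction s<j (<-irrefl refl)
      rowed′ s<j (second _)     = contradiction s<j (<-irrefl refl)
      rowed′ s<j (other _ _ c∈) = rowed s<j c∈

row-length⁺ : ∀ {R j M} → RowLengths R j M → ∀ {r x t} → r ≤ j → (suc x , t) ∈ R r → t ≤ M x
row-length⁺ M-rows {t = zero}  r≤j c∈ = z≤n
row-length⁺ M-rows {t = suc t} r≤j c∈ = Equivalence.from M-rows (_ , r≤j , c∈)

filter-++-none-all : ∀ {P : Pred A 0ℓ} (P? : Decidable P) {as bs} →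
  (∀ {a} → a ∈ as → ¬ P a) → (∀ {b} → b ∈ bs → P b) → filter P? (as ++ bs) ≡ bs
filter-++-none-all P? {as} {bs} f g = trans (List.filter-++ P? as bs)
  (cong₂ _++_ (List.filter-none P? (All.tabulate f)) (List.filter-all P? (All.tabulate g)))

filter-++-all-none : ∀ {P : Pred A 0ℓ} (P? : Decidable P) {as bs} →
  (∀ {a} → a ∈ as → P a) → (∀ {b} → b ∈ bs → ¬ P b) → filter P? (as ++ bs) ≡ as
filter-++-all-none P? {as} {bs} f g = trans (List.filter-++ P? as bs)
  (trans (cong₂ _++_ (List.filter-all P? (All.tabulate f)) (List.filter-none P? (All.tabulate g))) (List.++-identityʳ as))

module Commute {μ m R} (F : Family μ m R) {q} (bad : FirstBad m R (suc (suc q)))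
  {M : ℕ → ℕ} (M-rows : RowLengths R (suc (suc q)) M)
  {i} (I : Index M (length (R (suc (suc q)))) (suc (suc q)) i) (i<p : i < suc q)
  {N¹ : ℕ → List Cell} (N¹≡ : ∀ r → N¹ r ≡ moveCells R (suc q) (suc (suc q)) (length (R (suc (suc q))) ∸ 1) r)
  {M¹ : ℕ → ℕ} (M¹-rows : RowLengths N¹ (suc q) M¹) where

  p j : ℕ
  p = suc q
  j = suc p

  open Family F
  open BadFamily F bad hiding (bad)
  open BadLast F bad
  open IndexProperties F bad M-rows I using (M-antitone; holds-from; k; k+j)
  open Index I

  k₁ : ℕ
  k₁ = length (R j) ∸ 1

  module Slink = Move p≥1 (n<1+n p) slink-count slink-fits N¹≡

  F¹ : Family μ m N¹
  F¹ = Slink.newFamily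

  module F¹ = Family F¹
  open FamilyProperties F¹ using () renaming (column-below to column-below¹; strip-length to strip-length¹)

  p<j : p < j
  p<j = n<1+n p

  length-N¹ : length (N¹ p) ≡ k₁
  length-N¹ = trans (cong length Slink.N-first) Slink.length-first

  N¹-other : ∀ {r} → r ≢ p → r ≢ j → N¹ r ≡ R r
  N¹-other = Slink.N-other

  M¹-≤ : ∀ x → M¹ x ≤ M x
  M¹-≤ x = below-≤ λ t< → let r , r≤p , c∈ = Equivalence.to M¹-rows t< in Equivalence.from M-rows (go r≤p (Slink.N-moved c∈))
    where
    go : ∀ {r t} → r ≤ p → Moved p k₁ (suc x , suc t) r → ∃[ s ] s ≤ j × (suc x , suc t) ∈ R s
    go _   (first c∈) with proj₁ (∈-belows⁻ p<j (take-⊆ k₁ c∈))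
    ... | inj₁ c∈p = p , <⇒≤ p<j , c∈p
    ... | inj₂ c∈j = j , ≤-refl , c∈j
    go r≤p (kept _)       = contradiction r≤p (<⇒≱ p<j)
    go r≤p (second _)     = contradiction r≤p (<⇒≱ p<j)
    go r≤p (other _ _ c∈) = _ , ≤-trans r≤p (<⇒≤ p<j) , c∈

  ∈-N¹-p⁻ : ∀ {c} → c ∈ N¹ p → c ∈ take k₁ (belows p)
  ∈-N¹-p⁻ = subst (_ ∈_) Slink.N-first

  firstBad¹ : FirstBad m N¹ p
  firstBad¹ = record
    { j≥1   = p≥1
    ; j≤m   = ≤-trans (<⇒≤ p<j) j≤m
    ; rowed = λ s<p c∈ → rowed (<-trans s<p p<j) (subst (_ ∈_) (N¹-other (<⇒≢ s<p) (<⇒≢ (<-trans s<p p<j))) c∈)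
    ; bad   = bad¹
    }
    where
    bad¹ : ∃[ c ] c ∈ N¹ p × row c ≢ p
    bad¹ with All.all? (λ c → row c ≟ p) (N¹ p)
    ... | no ¬all = find (All.¬All⇒Any¬ (λ c → row c ≟ p) (N¹ p) ¬all)
    ... | yes all = contradiction (holds-from (s≤s⁻¹ i<p)) (<⇒≱ (begin-strict
      length (R j) + q ≡⟨ cong (_+ q) length-run-j≡suc ⟩
      suc k₁ + q ≤⟨ s≤s (+-monoˡ-≤ q k₁≤) ⟩
      suc (M q + q) <⟨ ≤-refl ⟩
      suc (suc (M q + q)) ≡⟨ trans (cong suc (sym (+-suc (M q) q))) (sym (+-suc (M q) p)) ⟩
      M q + j ∎))
      where
      open ≤-Reasoning
      in-row-p : ∀ {c} → c ∈ take k₁ (belows p) → row c ≡ p → col c ≤ M q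
      in-row-p c∈ refl with proj₁ (∈-belows⁻ p<j (take-⊆ k₁ c∈))
      ... | inj₁ c∈p = row-length⁺ M-rows (<⇒≤ p<j) c∈p
      ... | inj₂ c∈j = row-length⁺ M-rows ≤-refl c∈j
      k₁≤ : k₁ ≤ M q
      k₁≤ = subst (_≤ M q) length-N¹ (row-segment (F¹.sorted p) λ c∈ →
        All.lookup all c∈ , proj₂ (cell-positive {μ} (F¹.⊆-cells c∈)) , in-row-p (∈-N¹-p⁻ c∈) (All.lookup all c∈))

  -- The cells of the new run p all precede the dropped cell, hence lie in rows ≥ x + 1.
  dropped-row : ∀ {x t} → (suc x , t) ∈ drop k₁ (belows p) → k₁ ≤ M¹ x
  dropped-row {x} d∈ = subst₂ _≤_ length-N¹ (length-rowCells (suc x) (M¹ x))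
    (strip-length¹ {r = p} {x = suc x} (F¹.sorted p) id λ c∈ →
      let s , s≤p , c′∈ , _ = column-below¹ c∈ z<s (<ᵣ-row (take-drop-sorted k₁ (belows-sorted p<j) (∈-N¹-p⁻ c∈) d∈))
      in ∈-rowCells⁺ (proj₂ (cell-positive {μ} (F¹.⊆-cells c∈))) (row-length⁺ M¹-rows s≤p c′∈))

  index¹ : Index M¹ (length (N¹ p)) p i
  index¹ = record
    { i≥1     = i≥1
    ; i<j     = i<p
    ; holds   = s≤s⁻¹ (begin
        suc (M¹ i + p) ≡⟨ +-suc (M¹ i) p ⟨
        M¹ i + j ≤⟨ +-monoˡ-≤ j (M¹-≤ i) ⟩
        M i + j ≤⟨ holds ⟩
        length (R j) + i ≡⟨ cong (_+ i) (trans length-run-j≡suc (cong suc (sym length-N¹))) ⟩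
        suc (length (N¹ p)) + i ∎)
    ; minimal = minimal¹
    }
    where
    open ≤-Reasoning
    minimal¹ : ∀ {x} → 1 ≤ x → x < i → ¬ (M¹ x + p ≤ length (N¹ p) + x)
    minimal¹ {x} 1≤x x<i h = <⇒≱ (<-trans x<i i<p) (+-cancelˡ-≤ (M¹ x) p x (≤-trans h
      (+-monoˡ-≤ x (subst (_≤ M¹ x) (sym length-N¹) (dropped-row in-drop)))))
      where
      M¹<M : M¹ x < M x
      M¹<M = ≰⇒> λ M≤M¹ → minimal 1≤x x<i (begin
        M x + j ≤⟨ +-monoˡ-≤ j M≤M¹ ⟩
        M¹ x + j ≡⟨ +-suc (M¹ x) p ⟩
        suc (M¹ x + p) ≤⟨ s≤s h ⟩
        suc (length (N¹ p) + x) ≡⟨ cong (_+ x) (trans (cong suc length-N¹) (sym length-run-j≡suc)) ⟩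
        length (R j) + x ∎)
      in-drop : (suc x , suc (M¹ x)) ∈ drop k₁ (belows p)
      in-drop with Equivalence.to M-rows M¹<M
      ... | r , r≤j , c∈ = by-cases (r ≟ p) (r ≟ j)
        where
        ¬short : ∀ {s} → s ≤ p → (suc x , suc (M¹ x)) ∉ N¹ s
        ¬short s≤p c∈ = <-irrefl refl (Equivalence.from M¹-rows (_ , s≤p , c∈))
        not-taken : (suc x , suc (M¹ x)) ∈ belows p → (suc x , suc (M¹ x)) ∈ drop k₁ (belows p)
        not-taken c∈ with ∈-take⊎drop k₁ c∈
        ... | inj₁ q = contradiction (subst (_ ∈_) (sym Slink.N-first) q) (¬short ≤-refl)
        ... | inj₂ q = q
        by-cases : Dec (r ≡ p) → Dec (r ≡ j) → (suc x , suc (M¹ x)) ∈ drop k₁ (belows p)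
        by-cases (yes refl) _          = not-taken (∈-++⁺ˡ c∈)
        by-cases (no r≢p)   (no r≢j)   = contradiction (subst (_ ∈_) (sym (N¹-other r≢p r≢j)) c∈) (¬short (s≤s⁻¹ (≤∧≢⇒< r≤j r≢j)))
        by-cases (no _)     (yes refl) = not-taken (∈-++⁺ʳ (R p) (∈-lower⁺ p c∈ (≤-trans x<i (<⇒≤ i<p))))

  middle : List Cell
  middle = filter (λ c → suc i ≤? row c) (lower p)

  ∈-middle⁻ : ∀ {c} → c ∈ middle → c ∈ R j × suc i ≤ row c × row c ≤ p
  ∈-middle⁻ c∈ = let c∈p , lt = ∈-filter⁻ (λ c → suc i ≤? row c) {xs = lower p} c∈ ; c∈j , le = ∈-lower⁻ p c∈p in c∈j , lt , le

  ∈-middle⁺ : ∀ {c} → c ∈ R j → suc i ≤ row c → row c ≤ p → c ∈ middle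
  ∈-middle⁺ c∈ lt le = ∈-filter⁺ (λ c → suc i ≤? row c) (∈-lower⁺ p c∈ le) lt

  middle-sorted : AllPairs _<ᵣ_ middle
  middle-sorted = AllPairs.filter⁺ (λ c → suc i ≤? row c) (lower-sorted p)

  lower-p≡ : lower p ≡ middle ++ lower i
  lower-p≡ = sorted-≡ <ᵣ-asym (lower-sorted p)
    (AllPairs.++⁺ middle-sorted (lower-sorted i) (All.tabulate λ c∈ → All.tabulate λ d∈ →
      inj₁ (≤-<-trans (proj₂ (∈-lower⁻ i d∈)) (proj₁ (proj₂ (∈-middle⁻ c∈))))))
    (λ {c} c∈ → case suc i ≤? row c of λ where
      (yes lt) → ∈-++⁺ˡ (∈-middle⁺ (proj₁ (∈-lower⁻ p c∈)) lt (proj₂ (∈-lower⁻ p c∈)))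
      (no ¬lt) → ∈-++⁺ʳ middle (∈-lower⁺ i (proj₁ (∈-lower⁻ p c∈)) (s≤s⁻¹ (≰⇒> ¬lt))))
    (λ c∈ → case ∈-++⁻ middle c∈ of λ where
      (inj₁ q) → let c∈j , _ , le = ∈-middle⁻ q in ∈-lower⁺ p c∈j le
      (inj₂ q) → let c∈j , le = ∈-lower⁻ i q in ∈-lower⁺ p c∈j (≤-trans le (<⇒≤ i<p)))

  upper-i≡ : upper i ≡ upper p ++ middle
  upper-i≡ = sorted-≡ <ᵣ-asym (upper-sorted i)
    (AllPairs.++⁺ (upper-sorted p) middle-sorted (All.tabulate λ c∈ → All.tabulate λ d∈ →
      inj₁ (≤-<-trans (proj₂ (proj₂ (∈-middle⁻ d∈))) (proj₂ (∈-upper⁻ p c∈)))))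
    (λ {c} c∈ → case suc p ≤? row c of λ where
      (yes lt) → ∈-++⁺ˡ (∈-upper⁺ p (proj₁ (∈-upper⁻ i c∈)) lt)
      (no ¬lt) → ∈-++⁺ʳ (upper p) (∈-middle⁺ (proj₁ (∈-upper⁻ i c∈)) (proj₂ (∈-upper⁻ i c∈)) (s≤s⁻¹ (≰⇒> ¬lt))))
    (λ c∈ → case ∈-++⁻ (upper p) c∈ of λ where
      (inj₁ q) → let c∈j , lt = ∈-upper⁻ p q in ∈-upper⁺ i c∈j (<-trans i<p lt)
      (inj₂ q) → let c∈j , lt , _ = ∈-middle⁻ q in ∈-upper⁺ i c∈j lt)

  head-p : List Cell
  head-p = R p ++ middle

  belows-p≡ : belows p ≡ head-p ++ lower i
  belows-p≡ = trans (cong (R p ++_) lower-p≡) (sym (List.++-assoc (R p) middle (lower i)))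

  head-rows : ∀ {c} → c ∈ head-p → suc i ≤ row c × row c ≤ p
  head-rows c∈ with ∈-++⁻ (R p) c∈
  ... | inj₁ q = subst (suc i ≤_) (sym (rowed p<j q)) i<p , ≤-reflexive (rowed p<j q)
  ... | inj₂ q = proj₂ (∈-middle⁻ q)

  head-≤ : length head-p ≤ k₁
  head-≤ = ≮⇒≥ λ k₁< → let c , c∈ , d∈ = ∈-drop-++ k₁ head-p k₁< in
    go (head-rows c∈) (subst (λ xs → c ∈ drop k₁ xs) (sym belows-p≡) d∈)
    where
    go : ∀ {c} → suc i ≤ row c × row c ≤ p → c ∈ drop k₁ (belows p) → ⊥
    go {suc x , t} (s≤s i≤x , x<p) d∈ = <⇒≱ x<p (+-cancelˡ-≤ k₁ p x (s≤s⁻¹ (begin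
      suc (k₁ + p) ≡⟨ +-suc k₁ p ⟨
      k₁ + j ≤⟨ +-monoˡ-≤ j (≤-trans (dropped-row d∈) (M¹-≤ x)) ⟩
      M x + j ≤⟨ holds-from i≤x ⟩
      length (R j) + x ≡⟨ cong (_+ x) length-run-j≡suc ⟩
      suc (k₁ + x) ∎)))
      where open ≤-Reasoning

  x₁ : ℕ
  x₁ = k₁ ∸ length head-p

  k₁≡ : k₁ ≡ length head-p + x₁
  k₁≡ = sym (m+[n∸m]≡n head-≤)

  N¹-p≡ : N¹ p ≡ head-p ++ take x₁ (lower i)
  N¹-p≡ = trans Slink.N-first (trans (cong₂ take k₁≡ belows-p≡) (take-length-++ head-p x₁))

  upper¹≡ : upperCells N¹ p i ≡ head-p
  upper¹≡ = trans (cong (filter (λ c → suc i ≤? row c)) N¹-p≡) (filter-++-all-none (λ c → suc i ≤? row c)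
    (λ c∈ → proj₁ (head-rows c∈)) (λ d∈ → ≤⇒≯ (proj₂ (∈-lower⁻ i (take-⊆ x₁ d∈)))))

  lower¹≡ : lowerCells N¹ p i ≡ take x₁ (lower i)
  lower¹≡ = trans (cong (filter (λ c → row c <? suc i)) N¹-p≡) (filter-++-none-all (λ c → row c <? suc i)
    (λ c∈ → ≤⇒≯ (proj₁ (head-rows c∈))) (λ d∈ → s≤s (proj₂ (∈-lower⁻ i (take-⊆ x₁ d∈)))))

  i≢p : i ≢ p
  i≢p = <⇒≢ i<p

  i≢j : i ≢ j
  i≢j = <⇒≢ i<j

  head-≤-run-i : length head-p ≤ length (R i)
  head-≤-run-i = subst₂ (λ xs ys → length xs ≤ length ys) upper¹≡ (N¹-other i≢p i≢j)
    (BadFamily.upper-length F¹ firstBad¹ i≥1 i<p)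

  k+p : k + p ≡ k₁ + i
  k+p = suc-injective (trans (sym (+-suc k p)) (trans k+j (cong (_+ i) length-run-j≡suc)))

  k-≤ : k ≤ length (R i) + x₁
  k-≤ = +-cancelʳ-≤ p k _ (begin
    k + p ≡⟨ k+p ⟩
    k₁ + i ≡⟨ cong (_+ i) k₁≡ ⟩
    length head-p + x₁ + i ≤⟨ +-mono-≤ (+-monoˡ-≤ x₁ head-≤-run-i) (<⇒≤ i<p) ⟩
    length (R i) + x₁ + p ∎)
    where open ≤-Reasoning

  y₁ : ℕ
  y₁ = length (R i) + x₁ ∸ k

  k+y₁ : k + y₁ ≡ length (R i) + x₁
  k+y₁ = m+[n∸m]≡n k-≤

  belows¹≡ : belowCells N¹ p i ≡ take (k + y₁) (belows i)
  belows¹≡ = trans (cong₂ _++_ (N¹-other i≢p i≢j) lower¹≡)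
    (trans (sym (take-length-++ (R i) x₁)) (cong (λ l → take l (belows i)) (sym k+y₁)))

  k¹≡k : (length (N¹ p) + i) ∸ p ≡ k
  k¹≡k = trans (cong (λ l → (l + i) ∸ p) length-N¹) (cong (λ l → (l + i) ∸ j) (sym length-run-j≡suc))

  module _ {N′ : ℕ → List Cell} (N′≡ : ∀ r → N′ r ≡ moveCells R i j k r) where

    N′-second : N′ j ≡ upper i ++ drop k (belows i)
    N′-second = trans (N′≡ j) (moveCells-second R k i<j)

    N′-other : ∀ {r} → r ≢ i → r ≢ j → N′ r ≡ R r
    N′-other {r} r≢i r≢j = trans (N′≡ r) (moveCells-other R k r≢i r≢j)

    k-≤-belows : k ≤ length (belows i)
    k-≤-belows = <⇒≤ (Move.k<length-belows i≥1 i<j k+j (IndexProperties.fits F bad M-rows I) N′≡)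

    length-N′ : length (N′ j) ≡ suc (length head-p + y₁)
    length-N′ = +-cancelʳ-≡ k (length (N′ j)) (suc (length head-p + y₁)) (begin
      length (N′ j) + k ≡⟨ cong (λ (xs : List Cell) → length xs + k) N′-second ⟩
      length (upper i ++ drop k (belows i)) + k ≡⟨ cong (_+ k) (List.length-++ (upper i)) ⟩
      length (upper i) + length (drop k (belows i)) + k ≡⟨ +-assoc (length (upper i)) _ k ⟩
      length (upper i) + (length (drop k (belows i)) + k) ≡⟨ cong (λ l → length (upper i) + (l + k)) (List.length-drop k (belows i)) ⟩
      length (upper i) + (length (belows i) ∸ k + k) ≡⟨ cong (length (upper i) +_) (m∸n+n≡m k-≤-belows) ⟩
      length (upper i) + length (belows i) ≡⟨ cong (length (upper i) +_) (trans (List.length-++ (R i)) (+-comm (length (R i)) _)) ⟩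
      length (upper i) + (length (lower i) + length (R i)) ≡⟨ +-assoc (length (upper i)) _ _ ⟨
      length (upper i) + length (lower i) + length (R i) ≡⟨ cong (_+ length (R i)) (length-run-j i) ⟨
      length (R j) + length (R i) ≡⟨ cong (_+ length (R i)) (trans length-run-j≡suc (cong suc k₁≡)) ⟩
      suc (length head-p + x₁ + length (R i)) ≡⟨ cong suc (+-assoc (length head-p) x₁ _) ⟩
      suc (length head-p + (x₁ + length (R i))) ≡⟨ cong (λ l → suc (length head-p + l)) (trans (+-comm x₁ _) (trans (sym k+y₁) (+-comm k y₁))) ⟩
      suc (length head-p + (y₁ + k)) ≡⟨ cong suc (+-assoc (length head-p) y₁ k) ⟨
      suc (length head-p + y₁ + k) ∎)
      where open ≡-Reasoning

    k₂≡ : length (N′ j) ∸ 1 ≡ length head-p + y₁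
    k₂≡ = cong pred length-N′

    N′-j≡ : N′ j ≡ upper p ++ (middle ++ drop k (belows i))
    N′-j≡ = trans N′-second (trans (cong (_++ drop k (belows i)) upper-i≡) (List.++-assoc (upper p) middle _))

    row-≤-p : ∀ {c} → c ∈ middle ++ drop k (belows i) → row c ≤ p
    row-≤-p c∈ with ∈-++⁻ middle c∈
    ... | inj₁ q = proj₂ (proj₂ (∈-middle⁻ q))
    ... | inj₂ q = ≤-trans (proj₂ (∈-belows⁻ i<j (drop-⊆ k q))) (<⇒≤ i<p)

    upper′≡ : upperCells N′ j p ≡ upper p
    upper′≡ = trans (cong (filter (λ c → suc p ≤? row c)) N′-j≡) (filter-++-all-none (λ c → suc p ≤? row c)
      (λ c∈ → proj₂ (∈-upper⁻ p c∈)) (λ d∈ → ≤⇒≯ (row-≤-p d∈)))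

    lower′≡ : lowerCells N′ j p ≡ middle ++ drop k (belows i)
    lower′≡ = trans (cong (filter (λ c → row c <? suc p)) N′-j≡) (filter-++-none-all (λ c → row c <? suc p)
      (λ c∈ → ≤⇒≯ (proj₂ (∈-upper⁻ p c∈))) (λ d∈ → s≤s (row-≤-p d∈)))

    p≢i : p ≢ i
    p≢i = i≢p ∘ sym

    p≢j : p ≢ j
    p≢j = <⇒≢ p<j

    belows′≡ : belowCells N′ j p ≡ head-p ++ drop k (belows i)
    belows′≡ = trans (cong₂ _++_ (N′-other p≢i p≢j) lower′≡) (sym (List.++-assoc (R p) middle _))

    commute : ∀ r → moveCells N¹ i p ((length (N¹ p) + i) ∸ p) r ≡ moveCells N′ p j (length (N′ j) ∸ 1) r
    commute r = trans (cong (λ l → moveCells N¹ i p l r) k¹≡k)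
      (trans (by-cases (r ≟ i) (r ≟ p) (r ≟ j)) (cong (λ l → moveCells N′ p j l r) (sym k₂≡)))
      where
      open ≡-Reasoning
      k₂ = length head-p + y₁
      by-cases : Dec (r ≡ i) → Dec (r ≡ p) → Dec (r ≡ j) → moveCells N¹ i p k r ≡ moveCells N′ p j k₂ r
      by-cases (yes refl) _ _ = begin
        moveCells N¹ i p k i ≡⟨ moveCells-first N¹ i p k ⟩
        take k (belowCells N¹ p i) ≡⟨ cong (take k) belows¹≡ ⟩
        take k (take (k + y₁) (belows i)) ≡⟨ List.take-take k (k + y₁) (belows i) ⟩
        take (k ⊓ (k + y₁)) (belows i) ≡⟨ cong (λ l → take l (belows i)) (m≤n⇒m⊓n≡m (m≤m+n k y₁)) ⟩
        take k (belows i) ≡⟨ moveCells-first R i j k ⟨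
        moveCells R i j k i ≡⟨ N′≡ i ⟨
        N′ i ≡⟨ moveCells-other N′ k₂ i≢p i≢j ⟨
        moveCells N′ p j k₂ i ∎
      by-cases (no _) (yes refl) _ = begin
        moveCells N¹ i p k p ≡⟨ moveCells-second N¹ k i<p ⟩
        upperCells N¹ p i ++ drop k (belowCells N¹ p i) ≡⟨ cong₂ (λ xs ys → xs ++ drop k ys) upper¹≡ belows¹≡ ⟩
        head-p ++ drop k (take (k + y₁) (belows i)) ≡⟨ cong (head-p ++_) (List.take-drop y₁ k (belows i)) ⟨
        head-p ++ take y₁ (drop k (belows i)) ≡⟨ take-length-++ head-p y₁ ⟨
        take k₂ (head-p ++ drop k (belows i)) ≡⟨ cong (take k₂) belows′≡ ⟨
        take k₂ (belowCells N′ j p) ≡⟨ moveCells-first N′ p j k₂ ⟨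
        moveCells N′ p j k₂ p ∎
      by-cases (no r≢i) (no r≢p) (yes refl) = begin
        moveCells N¹ i p k j ≡⟨ moveCells-other N¹ k r≢i r≢p ⟩
        N¹ j ≡⟨ Slink.N-second ⟩
        upper p ++ drop k₁ (belows p) ≡⟨ cong (upper p ++_) (begin
          drop k₁ (belows p) ≡⟨ cong₂ drop k₁≡ belows-p≡ ⟩
          drop (length head-p + x₁) (head-p ++ lower i) ≡⟨ drop-length-++ head-p x₁ ⟩
          drop x₁ (lower i) ≡⟨ drop-length-++ (R i) x₁ ⟨
          drop (length (R i) + x₁) (belows i) ≡⟨ cong (λ l → drop l (belows i)) k+y₁ ⟨
          drop (k + y₁) (belows i) ≡⟨ List.drop-drop k y₁ (belows i) ⟨
          drop y₁ (drop k (belows i)) ≡⟨ drop-length-++ head-p y₁ ⟨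
          drop k₂ (head-p ++ drop k (belows i)) ≡⟨ cong (drop k₂) belows′≡ ⟨
          drop k₂ (belowCells N′ j p) ∎) ⟩
        upper p ++ drop k₂ (belowCells N′ j p) ≡⟨ cong (_++ drop k₂ (belowCells N′ j p)) upper′≡ ⟨
        upperCells N′ j p ++ drop k₂ (belowCells N′ j p) ≡⟨ moveCells-second N′ k₂ p<j ⟨
        moveCells N′ p j k₂ j ∎
      by-cases (no r≢i) (no r≢p) (no r≢j) = begin
        moveCells N¹ i p k r ≡⟨ moveCells-other N¹ k r≢i r≢p ⟩
        N¹ r ≡⟨ N¹-other r≢p r≢j ⟩
        R r ≡⟨ N′-other r≢i r≢j ⟨
        N′ r ≡⟨ moveCells-other N′ k₂ r≢p r≢j ⟨
        moveCells N′ p j k₂ r ∎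

-- slink and slink⁎ on tableaux

belows-≡ : ∀ {μ m R} (F : Family μ m R) {j} (B : FirstBad m R j) {i} → i < j → ∀ {X} → AllPairs _<ᵣ_ X →
  (∀ {c} → c ∈ X ⇔ ((c ∈ R i ⊎ c ∈ R j) × row c < suc i)) → X ≡ belowCells R j i
belows-≡ F B i<j sX spec = sorted-≡ <ᵣ-asym sX (belows-sorted i<j)
  (λ c∈ → let p , lt = Equivalence.to spec c∈ in ∈-belows⁺ i<j p (s≤s⁻¹ lt))
  (λ c∈ → let p , le = ∈-belows⁻ i<j c∈ in Equivalence.from spec (p , s≤s le))
  where open BadFamily F B

kept-≡ : ∀ {μ m R} (F : Family μ m R) {p} → FirstBad m R (suc p) → filter (λ c → row c ≟ suc p) (R (suc p)) ≡ upperCells R (suc p) p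
kept-≡ {R = R} F {p} B = sorted-≡ <ᵣ-asym (AllPairs.filter⁺ (λ c → row c ≟ suc p) (Family.sorted F (suc p))) (upper-sorted p)
  (λ c∈ → let c∈j , eq = ∈-filter⁻ (λ c → row c ≟ suc p) {xs = R (suc p)} c∈ in ∈-upper⁺ p c∈j (≤-reflexive (sym eq)))
  (λ c∈ → let c∈j , le = ∈-upper⁻ p c∈ in ∈-filter⁺ (λ c → row c ≟ suc p) c∈j (≤-antisym (row-≤-run F c∈j) le))
  where open BadFamily F B

assemble-cong : ∀ {μ ν m n R S} → μ ≡ ν → m ≡ n → (∀ r → R r ≡ S r) → assemble μ m R ≡ assemble ν n S
assemble-cong {μ} {m = m} refl refl eq = cong (fromRuns μ) (List.map-cong eq [1⋯ m ])

record HasRuns (T : Tableau) (μ : List ℕ) (m : ℕ) (R : ℕ → List Cell) : Set where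
  field
    syt    : IsSYT T
    shape≡ : shape T ≡ μ
    nRuns≡ : nRuns T ≡ m
    run≡   : ∀ r → run T r ≡ R r

assemble-hasRuns : ∀ {μ m R} → Family μ m R → HasRuns (assemble μ m R) μ m R
assemble-hasRuns F = record { syt = assemble-IsSYT ; shape≡ = shape-assemble ; nRuns≡ = nRuns-assemble ; run≡ = run-assemble }
  where open AssembledFamily F

module SYTRuns {T} (syt : IsSYT T) where

  structure : RunStructure T (shape T) (entry T)
  structure = syt-structure syt

  open RunStructure structure public

  moved-tableau : ℕ → ℕ → ℕ → Tableau
  moved-tableau i j k = assemble (shape T) (nRuns T) (moveCells (run T) i j k)

  slink⁎At≡ : ∀ {j i} → FirstBad (nRuns T) (run T) j → i < j → slink⁎At T j i ≡ moved-tableau i j ((length (run T j) + i) ∸ j)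
  slink⁎At≡ {j} {i} B i<j = begin
    slink⁎At T j i
      ≡⟨ cong₂ (λ k xs → replaceRuns T i j (take k xs) (upperCells (run T) j i ++ drop k xs))
           (cong (λ l → (l + i) ∸ j) (sym (length-run j)))
           (belows-≡ {R = run T} family B i<j (cellsBelow-sorted i j (suc i)) (∈-cellsBelow {i} {j} {suc i})) ⟩
    moved-tableau i j ((length (run T j) + i) ∸ j)
      ∎
    where open ≡-Reasoning

  slinkAt≡ : ∀ {p} → FirstBad (nRuns T) (run T) (suc p) → slinkAt T (suc p) ≡ moved-tableau p (suc p) (length (run T (suc p)) ∸ 1)
  slinkAt≡ {p} B = begin
    slinkAt T (suc p)
      ≡⟨ cong₂ (λ k xs → replaceRuns T p (suc p) (take k xs) (filter (λ c → row c ≟ suc p) (run T (suc p)) ++ drop k xs))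
           (cong (_∸ 1) (sym (length-run (suc p))))
           (belows-≡ {R = run T} family B (n<1+n p) (cellsBelow-sorted p (suc p) (suc p)) (∈-cellsBelow {p} {suc p} {suc p})) ⟩
    replaceRuns T p (suc p) (take k bel) (filter (λ c → row c ≟ suc p) (run T (suc p)) ++ drop k bel)
      ≡⟨ cong (λ ys → replaceRuns T p (suc p) (take k bel) (ys ++ drop k bel)) (kept-≡ {R = run T} family B) ⟩
    moved-tableau p (suc p) k
      ∎
    where
    open ≡-Reasoning
    k = length (run T (suc p)) ∸ 1
    bel = belowCells (run T) (suc p) p

  M : ℕ → ℕ → ℕ
  M j x = nth 0 (shape (firstRuns T j)) x

  slink≡ : ∀ {p} → firstBadRun T ≡ just (suc p) → slink T ≡ moved-tableau p (suc p) (length (run T (suc p)) ∸ 1)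
  slink≡ eq = trans (cong (maybe′ (slinkAt T) T) eq) (slinkAt≡ (firstBad⁻ eq))

  slink-hasRuns : ∀ {p} → firstBadRun T ≡ just (suc p) →
    HasRuns (slink T) (shape T) (nRuns T) (moveCells (run T) p (suc p) (length (run T (suc p)) ∸ 1))
  slink-hasRuns {p} eq = subst (λ X → HasRuns X (shape T) (nRuns T) (moveCells (run T) p (suc p) (length (run T (suc p)) ∸ 1)))
    (sym (slink≡ eq)) (assemble-hasRuns (BadFamily.Move.newFamily family (firstBad⁻ eq) {i = p} p≥1 (n<1+n p) slink-count (λ {r} → slink-fits {r}) (λ _ → refl)))
    where open BadLast {R = run T} family (firstBad⁻ eq)

  index⁻ : ∀ {j i} → slink⁎Index T j ≡ just i → Index (M j) (length (run T j)) j i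
  index⁻ {j} {i} eq with find-just⁻ (λ i → part-suc (shape (firstRuns T j)) i + j ≤? β T j + i) ([1⋯]-sorted (j ∸ 1)) eq
  ... | i∈ , holds , minimal = record
    { i≥1     = proj₁ (∈-[1⋯]⁻ i∈)
    ; i<j     = i<j
    ; holds   = subst (λ l → M j i + j ≤ l + i) (sym (length-run j)) holds
    ; minimal = λ {x} 1≤x x<i h → minimal (∈-[1⋯]⁺ 1≤x (≤-trans (<⇒≤ x<i) (proj₂ (∈-[1⋯]⁻ i∈)))) x<i
        (subst (λ l → M j x + j ≤ l + x) (length-run j) h)
    }
    where
    i<j : i < j
    i<j = go j (≤-trans (proj₁ (∈-[1⋯]⁻ i∈)) (proj₂ (∈-[1⋯]⁻ i∈))) (proj₂ (∈-[1⋯]⁻ i∈))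
      where
      go : ∀ j → 1 ≤ j ∸ 1 → i ≤ j ∸ 1 → i < j
      go (suc j) _ i≤ = s≤s i≤

  index⁺ : ∀ {j i} → Index (M j) (length (run T j)) j i → slink⁎Index T j ≡ just i
  index⁺ {j} {i} I = find-just⁺ (λ i → part-suc (shape (firstRuns T j)) i + j ≤? β T j + i) ([1⋯]-sorted (j ∸ 1))
    (∈-[1⋯]⁺ i≥1 (∸-monoˡ-≤ 1 i<j))
    (subst (λ l → M j i + j ≤ l + i) (length-run j) holds)
    (λ {x} x∈ x<i h → minimal (proj₁ (∈-[1⋯]⁻ x∈)) x<i (subst (λ l → M j x + j ≤ l + x) (sym (length-run j)) h))
    where open Index I

  slink⁎-hasRuns : ∀ {j i} (B : FirstBad (nRuns T) (run T) j) (I : Index (M j) (length (run T j)) j i) →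
    HasRuns (slink⁎At T j i) (shape T) (nRuns T) (moveCells (run T) i j ((length (run T j) + i) ∸ j))
  slink⁎-hasRuns {j} {i} B I = subst (λ X → HasRuns X (shape T) (nRuns T) (moveCells (run T) i j ((length (run T j) + i) ∸ j)))
    (sym (slink⁎At≡ B i<j)) (assemble-hasRuns (BadFamily.Move.newFamily family B i≥1 i<j k+j (λ {r} → fits {r}) (λ _ → refl)))
    where
    open Index I using (i≥1; i<j)
    open IndexProperties {R = run T} family B {M j} (λ {x} {t} → firstRuns-rows {j} {x} {t}) I

module SlinkSquare {T} (syt : IsSYT T) {q i} (bad-eq : firstBadRun T ≡ just (suc (suc q)))
  (index-eq : slink⁎Index T (suc (suc q)) ≡ just i) (i<p : i < suc q) where

  p j : ℕ
  p = suc q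
  j = suc p

  module S = SYTRuns syt
  T₁ T′ : Tableau
  T₁ = slink T
  T′ = slink⁎At T j i
  bad : FirstBad (nRuns T) (run T) j
  bad = S.firstBad⁻ bad-eq
  I : Index (S.M j) (length (run T j)) j i
  I = S.index⁻ index-eq
  h₁ = S.slink-hasRuns bad-eq
  h′ = S.slink⁎-hasRuns bad I
  module H₁ = HasRuns h₁
  module H′ = HasRuns h′
  module S₁ = SYTRuns H₁.syt
  module S′ = SYTRuns H′.syt
  module C = Commute {R = run T} S.family bad {S.M j} (λ {x} {t} → S.firstRuns-rows {j} {x} {t}) I i<p
    {run T₁} H₁.run≡ {S₁.M p} (λ {x} {t} → S₁.firstRuns-rows {p} {x} {t})

  B₁ : FirstBad (nRuns T₁) (run T₁) p
  B₁ = subst (λ m → FirstBad m (run T₁) p) (sym H₁.nRuns≡) C.firstBad¹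

  B′ : FirstBad (nRuns T′) (run T′) j
  B′ = subst (λ m → FirstBad m (run T′) j) (sym H′.nRuns≡)
    (IndexProperties.Moved⁎.moved-firstBad {R = run T} S.family bad {S.M j} (λ {x} {t} → S.firstRuns-rows {j} {x} {t}) I H′.run≡)

  slink-IsSYT : IsSYT (slink T)
  slink-IsSYT = H₁.syt

  slink⁎-IsSYT : IsSYT (slink⁎At T j i)
  slink⁎-IsSYT = H′.syt

  slink-firstBad : firstBadRun (slink T) ≡ just p
  slink-firstBad = S₁.firstBad⁺ B₁

  slink-index : slink⁎Index (slink T) p ≡ just i
  slink-index = S₁.index⁺ C.index¹

  square : slink⁎At (slink T) p i ≡ slink (slink⁎At T j i)
  square = trans (S₁.slink⁎At≡ B₁ i<p) (trans
    (assemble-cong (trans H₁.shape≡ (sym H′.shape≡)) (trans H₁.nRuns≡ (sym H′.nRuns≡)) (C.commute {run T′} H′.run≡))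
    (sym (S′.slink≡ (S′.firstBad⁺ B′))))

slink-generates : ∀ {T} → IsSYT T → T ≡¹ slink T
slink-generates syt = fwd (syt , refl) ◅ ε

slink⁎At-≡¹-step : ∀ {q} →
  (∀ {T i} → IsSYT T → firstBadRun T ≡ just (suc q) → slink⁎Index T (suc q) ≡ just i → T ≡¹ slink⁎At T (suc q) i) →
  ∀ {T i} → IsSYT T → firstBadRun T ≡ just (suc (suc q)) → slink⁎Index T (suc (suc q)) ≡ just i →
  i < suc q ⊎ i ≡ suc q → T ≡¹ slink⁎At T (suc (suc q)) i
slink⁎At-≡¹-step {q} ih {T} {i} syt bad-eq index-eq (inj₁ i<p) =
  slink-generates syt ◅◅ ih slink-IsSYT slink-firstBad slink-index
    ◅◅ subst (_≡¹ slink⁎At T (suc (suc q)) i) (sym square) (EqC.symmetric Generator¹ (slink-generates slink⁎-IsSYT))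
  where open SlinkSquare syt bad-eq index-eq i<p
slink⁎At-≡¹-step {q} ih {T} syt bad-eq index-eq (inj₂ refl) = subst (T ≡¹_) same (slink-generates syt)
  where
  open SYTRuns syt
  p = suc q
  bad = firstBad⁻ bad-eq
  count : length (run T (suc p)) ∸ 1 ≡ (length (run T (suc p)) + p) ∸ suc p
  count = trans (sym (m+n∸n≡m (length (run T (suc p)) ∸ 1) (suc p)))
    (cong (_∸ suc p) (BadLast.slink-count {R = run T} family bad))
  same : slink T ≡ slink⁎At T (suc p) p
  same = trans (slink≡ bad-eq) (trans (cong (moved-tableau p (suc p)) count) (sym (slink⁎At≡ bad (n<1+n p))))

slink⁎At-≡¹ : ∀ j {T i} → IsSYT T → firstBadRun T ≡ just j → slink⁎Index T j ≡ just i → T ≡¹ slink⁎At T j i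
slink⁎At-≡¹ zero          syt bad-eq index-eq = contradiction (Index.i<j (SYTRuns.index⁻ syt {0} index-eq)) λ ()
slink⁎At-≡¹ (suc zero)    syt bad-eq index-eq =
  contradiction (Index.i<j (SYTRuns.index⁻ syt {1} index-eq)) (≤⇒≯ (Index.i≥1 (SYTRuns.index⁻ syt {1} index-eq)))
slink⁎At-≡¹ (suc (suc q)) syt bad-eq index-eq = slink⁎At-≡¹-step (slink⁎At-≡¹ (suc q)) syt bad-eq index-eq
  (m≤n⇒m<n∨m≡n (s≤s⁻¹ (Index.i<j (SYTRuns.index⁻ syt {suc (suc q)} index-eq))))

slink⁎-≡¹ : ∀ {T} → IsSYT T → T ≡¹ slink⁎ T
slink⁎-≡¹ {T} syt with firstBadRun T in bad-eq
... | nothing = ε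
... | just j with slink⁎Index T j in index-eq
...   | nothing = ε
...   | just i  = slink⁎At-≡¹ j syt bad-eq index-eq

≡⁰⇒≡¹ : ∀ {T T′} → T ≡⁰ T′ → T ≡¹ T′
≡⁰⇒≡¹ = EqC.fold (EqC.isEquivalence Generator¹) λ { (syt , refl) → slink⁎-≡¹ syt }

-- Words and shuffles

-- In a word, false stands for the next cell of `Z` and true for the next cell of `O`.
data Shuffle {A : Set} : List Bool → List A → List A → List A → Set where
  []  : Shuffle [] [] [] []
  z∷_ : ∀ {s z Z O M} → Shuffle s Z O M → Shuffle (false ∷ s) (z ∷ Z) O (z ∷ M)
  o∷_ : ∀ {s Z o O M} → Shuffle s Z O M → Shuffle (true ∷ s) Z (o ∷ O) (o ∷ M)

infixr 5 z∷_ o∷_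

shuffle-unique : ∀ {s} {Z O M M′ : List A} → Shuffle s Z O M → Shuffle s Z O M′ → M ≡ M′
shuffle-unique []     []      = refl
shuffle-unique (z∷ p) (z∷ p′) = cong (_ ∷_) (shuffle-unique p p′)
shuffle-unique (o∷ p) (o∷ p′) = cong (_ ∷_) (shuffle-unique p p′)

shuffle-↭ : ∀ {s} {Z O M : List A} → Shuffle s Z O M → M ↭ Z ++ O
shuffle-↭ []     = ↭-reflexive refl
shuffle-↭ (z∷ p) = ↭.prep _ (shuffle-↭ p)
shuffle-↭ (o∷_ {Z = Z} {o} {O} p) = ↭-trans (↭.prep _ (shuffle-↭ p)) (↭-sym (Perm.shift o Z O))

∈-shuffle : ∀ {s} {Z O M : List A} → Shuffle s Z O M → ∀ {x} → x ∈ Z ++ O → x ∈ M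
∈-shuffle p = Perm.∈-resp-↭ (↭-sym (shuffle-↭ p))

shuffle-beforeˡ : ∀ {s} {Z O M : List A} {x y} → Shuffle s Z O M → Before x y Z → Before x y M
shuffle-beforeˡ (z∷ p) (here y∈) = here (∈-shuffle p (∈-++⁺ˡ y∈))
shuffle-beforeˡ (z∷ p) (there q) = there (shuffle-beforeˡ p q)
shuffle-beforeˡ (o∷ p) q         = there (shuffle-beforeˡ p q)

shuffle-beforeʳ : ∀ {s} {Z O M : List A} {x y} → Shuffle s Z O M → Before x y O → Before x y M
shuffle-beforeʳ (o∷_ {Z = Z} p) (here y∈) = here (∈-shuffle p (∈-++⁺ʳ Z y∈))
shuffle-beforeʳ (o∷ p)          (there q) = there (shuffle-beforeʳ p q)
shuffle-beforeʳ (z∷ p)          q         = there (shuffle-beforeʳ p q)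

shuffle-zeros : ∀ (Z : List A) → Shuffle (replicate (length Z) false) Z [] Z
shuffle-zeros []      = []
shuffle-zeros (z ∷ Z) = z∷ shuffle-zeros Z

shuffle-block : ∀ (P O Q : List A) →
  Shuffle (replicate (length P) false ++ replicate (length O) true ++ replicate (length Q) false) (P ++ Q) O (P ++ O ++ Q)
shuffle-block (x ∷ P) O       Q = z∷ shuffle-block P O Q
shuffle-block []      (o ∷ O) Q = o∷ shuffle-block [] O Q
shuffle-block []      []      Q = shuffle-zeros Q

Ballot : ℕ → List Bool → Set
Ballot h       []          = ⊤
Ballot h       (false ∷ s) = Ballot (suc h) s
Ballot zero    (true ∷ s)  = ⊥
Ballot (suc h) (true ∷ s)  = Ballot h s

ballot-zeros : ∀ h n → Ballot h (replicate n false)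
ballot-zeros h zero    = _
ballot-zeros h (suc n) = ballot-zeros (suc h) n

ballot-ones : ∀ h n {s} → Ballot h s → Ballot (n + h) (replicate n true ++ s)
ballot-ones h zero    b = b
ballot-ones h (suc n) b = ballot-ones h n b

ballot-++ : ∀ h n {s} → Ballot (n + h) s → Ballot h (replicate n false ++ s)
ballot-++ h zero    b = b
ballot-++ h (suc n) {s} b = ballot-++ (suc h) n (subst (λ l → Ballot l s) (sym (+-suc n h)) b)

ballot-before : ∀ {s h} {Z O M : List A} → Shuffle s Z O M → Ballot h s →
  ∀ Z₁ {x Z₂} O₁ {y O₂} → Z ≡ Z₁ ++ x ∷ Z₂ → O ≡ O₁ ++ y ∷ O₂ → length Z₁ + h ≤ length O₁ → Before x y M
ballot-before {h = h}     (z∷_ {Z = Z} p) b [] O₁ refl refl le = here (∈-shuffle p (∈-++⁺ʳ Z (∈-++⁺ʳ O₁ (here refl))))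
ballot-before {h = h}     (z∷ p) b (z ∷ Z₁) O₁       refl eq   le =
  there (ballot-before p b Z₁ O₁ refl eq (subst (_≤ length O₁) (sym (+-suc (length Z₁) h)) le))
ballot-before {h = suc h} (o∷ p) b Z₁       []       eq   refl le = contradiction (subst (_≤ 0) (+-suc (length Z₁) h) le) λ ()
ballot-before {h = suc h} (o∷ p) b Z₁       (o ∷ O₁) eq   refl le =
  there (ballot-before p b Z₁ O₁ eq refl (s≤s⁻¹ (subst (_≤ suc (length O₁)) (+-suc (length Z₁) h) le)))

data Step : Rel (List Bool) 0ℓ where
  zero-first : ∀ {u} → Step (false ∷ false ∷ true ∷ u) (false ∷ true ∷ false ∷ u)
  one-last   : ∀ {u} → Step (false ∷ true ∷ true ∷ u) (true ∷ false ∷ true ∷ u)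
  skip       : ∀ a {u v} → Step u v → Step (a ∷ u) (a ∷ v)

infix 4 _∼_

_∼_ : Rel (List Bool) 0ℓ
_∼_ = EqClosure Step

∼-skip : ∀ a {u v} → u ∼ v → a ∷ u ∼ a ∷ v
∼-skip a = EqC.gmap (a ∷_) (skip a)

∼-prefix : ∀ w {u v} → u ∼ v → w ++ u ∼ w ++ v
∼-prefix []      p = p
∼-prefix (a ∷ w) p = ∼-skip a (∼-prefix w p)

∼-sym : ∀ {u v} → u ∼ v → v ∼ u
∼-sym = EqC.symmetric Step

zeros ones : ℕ → List Bool
zeros n = replicate n false
ones  n = replicate n true

replicate-shift : ∀ n (a : A) xs → replicate n a ++ a ∷ xs ≡ replicate (suc n) a ++ xs
replicate-shift zero    a xs = refl
replicate-shift (suc n) a xs = cong (a ∷_) (replicate-shift n a xs)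

zero-past-ones : ∀ c u → false ∷ ones c ++ true ∷ u ∼ ones c ++ false ∷ true ∷ u
zero-past-ones zero    u = ε
zero-past-ones (suc c) u = fwd first-step ◅ ∼-skip true (zero-past-ones c u)
  where
  first-step : Step (false ∷ true ∷ ones c ++ true ∷ u) (true ∷ false ∷ ones c ++ true ∷ u)
  first-step = subst₂ Step
    (cong (λ w → false ∷ true ∷ w) (sym (replicate-shift c true u)))
    (cong (λ w → true ∷ false ∷ w) (sym (replicate-shift c true u))) one-last

-- By induction on c: a zero moves right past all but the last one, pairs up there with the
-- zero that follows the ones, and the induction hypothesis applies to c - 1 ones.
move-zero-left : ∀ c x u → zeros (c + x) ++ ones c ++ false ∷ u ∼ zeros (suc (c + x)) ++ ones c ++ u
move-zero-left zero    x u = subst (zeros x ++ false ∷ u ∼_) (replicate-shift x false u) ε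
move-zero-left (suc c) x u =
  subst (_∼ zeros (c + x) ++ ones c ++ false ∷ true ∷ false ∷ u) lhs
    (∼-prefix (zeros (c + x)) (zero-past-ones c (false ∷ u)))
  ◅◅ ∼-prefix (zeros (c + x)) (∼-prefix (ones c) (bwd zero-first ◅ ε))
  ◅◅ move-zero-left c x (false ∷ true ∷ u)
  ◅◅ subst (zeros (suc (c + x)) ++ ones c ++ false ∷ true ∷ u ∼_) rhs
    (∼-prefix (zeros (suc (c + x))) (∼-sym (zero-past-ones c u)))
  where
  lhs : zeros (c + x) ++ false ∷ ones c ++ true ∷ false ∷ u ≡ zeros (suc c + x) ++ ones (suc c) ++ false ∷ u
  lhs = trans (cong (λ w → zeros (c + x) ++ false ∷ w) (replicate-shift c true (false ∷ u)))
    (replicate-shift (c + x) false (ones (suc c) ++ false ∷ u))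
  rhs : zeros (suc (c + x)) ++ false ∷ ones c ++ true ∷ u ≡ zeros (suc (suc c + x)) ++ ones (suc c) ++ u
  rhs = trans (cong (λ w → zeros (suc (c + x)) ++ false ∷ w) (replicate-shift c true u))
    (replicate-shift (suc (c + x)) false (ones (suc c) ++ u))

block : ℕ → ℕ → ℕ → List Bool
block c x y = zeros (c + x) ++ ones c ++ zeros y

block-∼ : ∀ c x y → block c x y ∼ block c (x + y) 0
block-∼ c x zero    = subst (λ l → block c x 0 ∼ block c l 0) (sym (+-identityʳ x)) ε
block-∼ c x (suc y) = move-zero-left c x (zeros y)
  ◅◅ subst₂ (λ k l → zeros k ++ ones c ++ zeros y ∼ block c l 0) (+-suc c x) (sym (+-suc x y)) (block-∼ c (suc x) y)

block-swap : ∀ c x y → block c x y ∼ block c y x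
block-swap c x y = block-∼ c x y ◅◅ subst (λ l → block c l 0 ∼ block c y x) (+-comm y x) (∼-sym (block-∼ c y x))

step-ballot : ∀ {u v} → Step u v → ∀ h w → Ballot h (u ++ w) ⇔ Ballot h (v ++ w)
step-ballot zero-first     h       w = mk⇔ id id
step-ballot one-last       zero    w = mk⇔ id id
step-ballot one-last       (suc h) w = mk⇔ id id
step-ballot (skip false s) h       w = step-ballot s (suc h) w
step-ballot (skip true s)  zero    w = mk⇔ id id
step-ballot (skip true s)  (suc h) w = step-ballot s h w

step-shuffle⁺ : ∀ {u v w} {Z O M : List A} → Step u v → Shuffle (u ++ w) Z O M → ∃[ M′ ] Shuffle (v ++ w) Z O M′
step-shuffle⁺ zero-first     (z∷ z∷ o∷ p) = _ , (z∷ o∷ z∷ p)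
step-shuffle⁺ one-last       (z∷ o∷ o∷ p) = _ , (o∷ z∷ o∷ p)
step-shuffle⁺ (skip false s) (z∷ p)       = let _ , q = step-shuffle⁺ s p in _ , (z∷ q)
step-shuffle⁺ (skip true s)  (o∷ p)       = let _ , q = step-shuffle⁺ s p in _ , (o∷ q)

step-shuffle⁻ : ∀ {u v w} {Z O M : List A} → Step u v → Shuffle (v ++ w) Z O M → ∃[ M′ ] Shuffle (u ++ w) Z O M′
step-shuffle⁻ zero-first     (z∷ o∷ z∷ p) = _ , (z∷ z∷ o∷ p)
step-shuffle⁻ one-last       (o∷ z∷ o∷ p) = _ , (z∷ o∷ o∷ p)
step-shuffle⁻ (skip false s) (z∷ p)       = let _ , q = step-shuffle⁻ s p in _ , (z∷ q)
step-shuffle⁻ (skip true s)  (o∷ p)       = let _ , q = step-shuffle⁻ s p in _ , (o∷ q)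

-- dᴿ as a swap of consecutive cells

transpose-left : ∀ x y → transpose x y x ≡ y
transpose-left x y rewrite dec-true (x ≟ x) refl = refl

transpose-right : ∀ {x y} → x ≢ y → transpose x y y ≡ x
transpose-right {x} {y} x≢y rewrite dec-false (y ≟ x) (x≢y ∘ sym) | dec-true (y ≟ y) refl = refl

transpose-other : ∀ {x y z} → z ≢ x → z ≢ y → transpose x y z ≡ z
transpose-other {x} {y} {z} z≢x z≢y rewrite dec-false (z ≟ x) z≢x | dec-false (z ≟ y) z≢y = refl

dValues-upper : ∀ {i w} → Between w i (i ∸ 1) (suc i) → dValues i w ≡ transpose i (suc i)
dValues-upper {i} {w} h rewrite dec-true (between? w i (i ∸ 1) (suc i)) h = refl

dValues-lower : ∀ {i w} → ¬ Between w i (i ∸ 1) (suc i) → Between w (i ∸ 1) (suc i) i → dValues i w ≡ transpose (i ∸ 1) i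
dValues-lower {i} {w} ¬h h
  rewrite dec-false (between? w i (i ∸ 1) (suc i)) ¬h | dec-true (between? w (i ∸ 1) (suc i) i) h = refl

dᴿ-unblocked : ∀ {i T} → suc i ∉ ID T → dᴿ i T ≡ d i T
dᴿ-unblocked {i} {T} ∉ID with suc i ∈? ID T
... | yes ∈ID = contradiction ∈ID ∉ID
... | no _    = refl

label-∉ : ∀ {c} X L → c ∉ X → label (X ++ L) c ≡ length X + label L c
label-∉ {c} X L c∉ = trans (cong suc (position-++ʳ _≟ᶜ_ X L c∉)) (sym (+-suc (length X) (position _≟ᶜ_ c L)))

label-here : ∀ c L → label (c ∷ L) c ≡ 1
label-here c L = cong suc (position-here _≟ᶜ_ c L)

label-there : ∀ {c x} L → c ≢ x → label (x ∷ L) c ≡ suc (label L c)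
label-there L c≢x = cong suc (position-there _≟ᶜ_ L c≢x)

label-swap : ∀ P {x y Q} → Unique (P ++ x ∷ y ∷ Q) → ∀ {c} → c ∈ P ++ x ∷ y ∷ Q →
  transpose (suc (length P)) (suc (suc (length P))) (label (P ++ x ∷ y ∷ Q) c) ≡ label (P ++ y ∷ x ∷ Q) c
label-swap [] {x} {y} {Q} ((x≢y ∷ x∉) ∷ (y∉ ∷ _)) {c} c∈ = by-cases (c ≟ᶜ x) (c ≟ᶜ y)
  where
  by-cases : Dec (c ≡ x) → Dec (c ≡ y) → transpose 1 2 (label (x ∷ y ∷ Q) c) ≡ label (y ∷ x ∷ Q) c
  by-cases (yes refl) _ = trans (cong (transpose 1 2) (label-here x (y ∷ Q))) (trans (transpose-left 1 2)
    (sym (trans (label-there (x ∷ Q) x≢y) (cong suc (label-here x Q)))))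
  by-cases (no c≢x) (yes refl) =
    trans (cong (transpose 1 2) (trans (label-there (y ∷ Q) c≢x) (cong suc (label-here y Q)))) (sym (label-here y (x ∷ Q)))
  by-cases (no c≢x) (no c≢y) = trans (cong (transpose 1 2) (trans (label-there (y ∷ Q) c≢x) (cong suc (label-there Q c≢y))))
    (sym (trans (label-there (x ∷ Q) c≢y) (cong suc (label-there Q c≢x))))
label-swap (a ∷ P) {x} {y} {Q} (a∉ ∷ u) {c} c∈ = by-cases (c ≟ᶜ a)
  where
  open ≡-Reasoning
  transpose-suc : ∀ x y z → transpose (suc x) (suc y) (suc z) ≡ suc (transpose x y z)
  transpose-suc x y z = go (z ≟ x) (z ≟ y)
    where
    go : Dec (z ≡ x) → Dec (z ≡ y) → transpose (suc x) (suc y) (suc z) ≡ suc (transpose x y z)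
    go (yes refl) _          = trans (transpose-left (suc x) (suc y)) (cong suc (sym (transpose-left x y)))
    go (no z≢x)   (yes refl) = trans (transpose-right (z≢x ∘ sym ∘ suc-injective)) (cong suc (sym (transpose-right (z≢x ∘ sym))))
    go (no z≢x)   (no z≢y)   = trans (transpose-other (z≢x ∘ suc-injective) (z≢y ∘ suc-injective)) (cong suc (sym (transpose-other z≢x z≢y)))
  by-cases : Dec (c ≡ a) →
    transpose (2 + length P) (3 + length P) (label (a ∷ P ++ x ∷ y ∷ Q) c) ≡ label (a ∷ P ++ y ∷ x ∷ Q) c
  by-cases (yes refl) = trans (cong (transpose (2 + length P) (3 + length P)) (label-here a (P ++ x ∷ y ∷ Q)))
    (trans (transpose-other {2 + length P} {3 + length P} {1} (λ ()) (λ ())) (sym (label-here a (P ++ y ∷ x ∷ Q))))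
  by-cases (no c≢a) = begin
    transpose (2 + length P) (3 + length P) (label (a ∷ P ++ x ∷ y ∷ Q) c)
      ≡⟨ cong (transpose (2 + length P) (3 + length P)) (label-there (P ++ x ∷ y ∷ Q) c≢a) ⟩
    transpose (2 + length P) (3 + length P) (suc (label (P ++ x ∷ y ∷ Q) c))
      ≡⟨ transpose-suc (1 + length P) (2 + length P) (label (P ++ x ∷ y ∷ Q) c) ⟩
    suc (transpose (1 + length P) (2 + length P) (label (P ++ x ∷ y ∷ Q) c))
      ≡⟨ cong suc (label-swap P u (∈-tail c∈ c≢a)) ⟩
    suc (label (P ++ y ∷ x ∷ Q) c)
      ≡⟨ label-there (P ++ y ∷ x ∷ Q) c≢a ⟨
    label (a ∷ P ++ y ∷ x ∷ Q) c
      ∎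

module DStep {μ : List ℕ} (X : List Cell) {c₁ c₂ c₃ c₄ : Cell} {W : List Cell}
  (L↭ : X ++ c₁ ∷ c₂ ∷ c₃ ∷ c₄ ∷ W ↭ cells μ) (std : Standard μ (label (X ++ c₁ ∷ c₂ ∷ c₃ ∷ c₄ ∷ W)))
  (c₃<c₄ : c₃ <ᵣ c₄) where

  L : List Cell
  L = X ++ c₁ ∷ c₂ ∷ c₃ ∷ c₄ ∷ W

  open StandardFilling std using (T; pos-<⁺; ∈-ID⁻)

  i : ℕ
  i = suc (suc (length X))

  w : List ℕ
  w = rw T

  uniqueL : Unique L
  uniqueL = SetoidPerm.Unique-resp-↭ (setoid Cell) (↭⇒↭ₛ (↭-sym L↭)) (cells-unique μ)

  label-at : ∀ P {x Q} → L ≡ P ++ x ∷ Q → label L x ≡ suc (length P)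
  label-at P {x} {Q} eq = trans (cong (λ l → label l x) eq)
    (trans (label-∉ P (x ∷ Q) λ x∈ → unique-++⁻ P (subst Unique eq uniqueL) x∈ (here refl))
      (trans (cong (length P +_) (label-here x Q)) (+-comm (length P) 1)))

  assoc : ∀ (Y Z : List Cell) → X ++ Y ++ Z ≡ (X ++ Y) ++ Z
  assoc Y Z = sym (List.++-assoc X Y Z)

  length-X+ : ∀ (Y : List Cell) → length (X ++ Y) ≡ length Y + length X
  length-X+ Y = trans (List.length-++ X) (+-comm (length X) (length Y))

  label₁ : label L c₁ ≡ suc (length X)
  label₁ = label-at X refl

  label₂ : label L c₂ ≡ i
  label₂ = trans (label-at (X ++ [ c₁ ]) (assoc [ c₁ ] _)) (cong suc (length-X+ [ c₁ ]))

  label₃ : label L c₃ ≡ suc i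
  label₃ = trans (label-at (X ++ c₁ ∷ [ c₂ ]) (assoc (c₁ ∷ [ c₂ ]) _)) (cong suc (length-X+ (c₁ ∷ [ c₂ ])))

  label₄ : label L c₄ ≡ suc (suc i)
  label₄ = trans (label-at (X ++ c₁ ∷ c₂ ∷ [ c₃ ]) (assoc (c₁ ∷ c₂ ∷ [ c₃ ]) _)) (cong suc (length-X+ (c₁ ∷ c₂ ∷ [ c₃ ])))

  ∈-L : ∀ {c} → c ∈ c₁ ∷ c₂ ∷ c₃ ∷ c₄ ∷ W → c ∈ cells μ
  ∈-L c∈ = Perm.∈-resp-↭ L↭ (∈-++⁺ʳ X c∈)

  c₁∈ : c₁ ∈ cells μ
  c₁∈ = ∈-L (here refl)
  c₂∈ : c₂ ∈ cells μ
  c₂∈ = ∈-L (there (here refl))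
  c₃∈ : c₃ ∈ cells μ
  c₃∈ = ∈-L (there (there (here refl)))
  c₄∈ : c₄ ∈ cells μ
  c₄∈ = ∈-L (there (there (there (here refl))))

  pos-lt : ∀ {c c′ v v′} → c ∈ cells μ → c′ ∈ cells μ → label L c ≡ v → label L c′ ≡ v′ → c <ᵣ c′ → pos v w < pos v′ w
  pos-lt c∈ c′∈ refl refl lt = subst (λ w → pos _ w < pos _ w) (sym (rw-filling (label L) μ)) (pos-<⁺ c∈ c′∈ lt)

  unblocked : suc i ∉ ID T
  unblocked ∈ID = <ᵣ-asym c₃<c₄ (∈-ID⁻ c₃∈ c₄∈ (trans label₄ (cong suc (sym label₃))) (subst (_∈ ID T) (sym label₃) ∈ID))

  dᴿ≡ : ∀ {f} → dValues i w ≡ f → dᴿ i T ≡ filling (f ∘ label L) μ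
  dᴿ≡ {f} eq = trans (dᴿ-unblocked unblocked) (trans (cong (λ f → map (map f) T) eq) (map-filling f (label L) μ))

  dᴿ-upper : c₃ <ᵣ c₁ → c₁ <ᵣ c₂ → dᴿ i T ≡ tab μ (X ++ c₁ ∷ c₃ ∷ c₂ ∷ c₄ ∷ W)
  dᴿ-upper c₃<c₁ c₁<c₂ = trans
    (dᴿ≡ (dValues-upper {i} {w} (inj₂ (pos-lt c₃∈ c₁∈ label₃ label₁ c₃<c₁ , pos-lt c₁∈ c₂∈ label₁ label₂ c₁<c₂))))
    (filling-cong μ λ {c} c∈ → begin
      transpose i (suc i) (label L c)
        ≡⟨ cong₂ (λ k l → transpose (suc k) (suc (suc k)) (label l c)) (sym (length-X+ [ c₁ ])) (assoc [ c₁ ] _) ⟩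
      transpose (suc (length X₁)) (suc (suc (length X₁))) (label (X₁ ++ c₂ ∷ c₃ ∷ c₄ ∷ W) c)
        ≡⟨ label-swap X₁ (subst Unique (assoc [ c₁ ] _) uniqueL) (subst (c ∈_) (assoc [ c₁ ] _) (Perm.∈-resp-↭ (↭-sym L↭) c∈)) ⟩
      label (X₁ ++ c₃ ∷ c₂ ∷ c₄ ∷ W) c
        ≡⟨ cong (λ l → label l c) (assoc [ c₁ ] _) ⟨
      label (X ++ c₁ ∷ c₃ ∷ c₂ ∷ c₄ ∷ W) c
        ∎)
    where
    open ≡-Reasoning
    X₁ = X ++ [ c₁ ]

  dᴿ-lower : c₂ <ᵣ c₃ → c₃ <ᵣ c₁ → dᴿ i T ≡ tab μ (X ++ c₂ ∷ c₁ ∷ c₃ ∷ c₄ ∷ W)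
  dᴿ-lower c₂<c₃ c₃<c₁ = trans
    (dᴿ≡ (dValues-lower {i} {w}
      (λ where
        (inj₁ (_ , p)) → <-asym p (pos-lt c₃∈ c₁∈ label₃ label₁ c₃<c₁)
        (inj₂ (_ , p)) → <-asym p (pos-lt c₂∈ c₁∈ label₂ label₁ (<ᵣ-trans c₂<c₃ c₃<c₁)))
      (inj₂ (pos-lt c₂∈ c₃∈ label₂ label₃ c₂<c₃ , pos-lt c₃∈ c₁∈ label₃ label₁ c₃<c₁))))
    (filling-cong μ λ c∈ → label-swap X uniqueL (Perm.∈-resp-↭ (↭-sym L↭) c∈))

  2≤i : 2 ≤ i
  2≤i = s≤s (s≤s z≤n)

  i≤size∸2 : i ≤ size T ∸ 2
  i≤size∸2 = subst (λ n → i ≤ n ∸ 2) (sym (trans (size-filling (label L) μ) (trans (sym (Perm.↭-length L↭)) (List.length-++ X))))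
    (≤-trans (≤-reflexive (+-comm 2 (length X))) (≤-trans (+-monoʳ-≤ (length X) (m≤m+n 2 (length W)))
      (≤-reflexive (sym (+-∸-assoc (length X) {4 + length W} {2} (s≤s (s≤s z≤n)))))))

  generator : ∀ {T′} → dᴿ i T ≡ T′ → Generator² T T′
  generator eq = Standard⇒IsSYT std , i , 2≤i , i≤size∸2 , sym eq

-- slink as a sequence of dᴿ

shuffle-head : ∀ {A : Set} u {Z O M : List A} → Shuffle (u ++ [ false ]) Z O M → ∃₂ λ c M′ → M ≡ c ∷ M′ × (c ∈ Z ⊎ c ∈ O)
shuffle-head []          (z∷ p) = _ , _ , refl , inj₁ (here refl)
shuffle-head (false ∷ u) (z∷ p) = _ , _ , refl , inj₁ (here refl)
shuffle-head (true ∷ u)  (o∷ p) = _ , _ , refl , inj₂ (here refl)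

step-generator : ∀ {μ u v} → Step u v → ∀ X Y {Z O M M′} → AllPairs _<ᵣ_ Z → AllPairs _<ᵣ_ O →
  (∀ {o z} → o ∈ O → z ∈ Z → o <ᵣ z) →
  Shuffle (u ++ [ false ]) Z O M → Shuffle (v ++ [ false ]) Z O M′ →
  X ++ M ++ Y ↭ cells μ → Standard μ (label (X ++ M ++ Y)) →
  Generator² (tab μ (X ++ M ++ Y)) (tab μ (X ++ M′ ++ Y))
step-generator {μ} (zero-first {u}) X Y ((z₁<z₂ ∷ _) ∷ _) (o< ∷ _) o<z (z∷_ {z = z₁} (z∷_ {z = z₂} (o∷_ {o = o} p))) (z∷ (o∷ (z∷ p′))) L↭ std
  with shuffle-unique p p′ | shuffle-head u p
... | refl | c , W , refl , c∈ = generator (dᴿ-upper (o<z (here refl) (here refl)) z₁<z₂)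
  where
  o<c : c ∈ _ ⊎ c ∈ _ → o <ᵣ c
  o<c (inj₁ c∈Z) = o<z (here refl) (there (there c∈Z))
  o<c (inj₂ c∈O) = All.lookup o< c∈O
  open DStep {μ} X {z₁} {z₂} {o} {c} {W ++ Y} L↭ std (o<c c∈)
step-generator {μ} (one-last {u}) X Y _ ((o₁<o₂ ∷ _) ∷ (o₂< ∷ _)) o<z (z∷_ {z = z} (o∷_ {o = o₁} (o∷_ {o = o₂} p))) (o∷ (z∷ (o∷ p′))) L↭ std
  with shuffle-unique p p′ | shuffle-head u p
... | refl | c , W , refl , c∈ = generator (dᴿ-lower o₁<o₂ (o<z (there (here refl)) (here refl)))
  where
  o<c : c ∈ _ ⊎ c ∈ _ → o₂ <ᵣ c
  o<c (inj₁ c∈Z) = o<z (there (here refl)) (there c∈Z)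
  o<c (inj₂ c∈O) = All.lookup o₂< c∈O
  open DStep {μ} X {z} {o₁} {o₂} {c} {W ++ Y} L↭ std (o<c c∈)
step-generator {μ} (skip false s) X Y (_ ∷ sZ) sO o<z (z∷_ {z = z} {M = M} p) (z∷_ {M = M′} p′) L↭ std =
  subst₂ (λ L L′ → Generator² (tab μ L) (tab μ L′)) (List.++-assoc X [ z ] (M ++ Y)) (List.++-assoc X [ z ] (M′ ++ Y))
    (step-generator s (X ++ [ z ]) Y sZ sO (λ o∈ z∈ → o<z o∈ (there z∈)) p p′
      (subst (_↭ cells μ) (sym (List.++-assoc X [ z ] (M ++ Y))) L↭)
      (subst (Standard μ ∘ label) (sym (List.++-assoc X [ z ] (M ++ Y))) std))
step-generator {μ} (skip true s) X Y sZ (_ ∷ sO) o<z (o∷_ {o = o} {M = M} p) (o∷_ {M = M′} p′) L↭ std =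
  subst₂ (λ L L′ → Generator² (tab μ L) (tab μ L′)) (List.++-assoc X [ o ] (M ++ Y)) (List.++-assoc X [ o ] (M′ ++ Y))
    (step-generator s (X ++ [ o ]) Y sZ sO (λ o∈ z∈ → o<z (there o∈) z∈) p p′
      (subst (_↭ cells μ) (sym (List.++-assoc X [ o ] (M ++ Y))) L↭)
      (subst (Standard μ ∘ label) (sym (List.++-assoc X [ o ] (M ++ Y))) std))

∼⇒≡² : ∀ {μ} X Y {Z O} → AllPairs _<ᵣ_ Z → AllPairs _<ᵣ_ O → (∀ {o z} → o ∈ O → z ∈ Z → o <ᵣ z) →
  (∀ {s M} → Shuffle s Z O M → Ballot 0 s → X ++ M ++ Y ↭ cells μ × Standard μ (label (X ++ M ++ Y))) →
  ∀ {u v M M′} → u ∼ v → Ballot 0 (u ++ [ false ]) → Shuffle (u ++ [ false ]) Z O M → Shuffle (v ++ [ false ]) Z O M′ →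
  tab μ (X ++ M ++ Y) ≡² tab μ (X ++ M′ ++ Y)
∼⇒≡² {μ} X Y sZ sO o<z valid ε b p p′ = subst (λ M → tab μ (X ++ _ ++ Y) ≡² tab μ (X ++ M ++ Y)) (shuffle-unique p p′) ε
∼⇒≡² X Y sZ sO o<z valid (fwd s ◅ r) b p p′ with step-shuffle⁺ s p
... | _ , p₁ = fwd (step-generator s X Y sZ sO o<z p p₁ (proj₁ (valid p b)) (proj₂ (valid p b)))
  ◅ ∼⇒≡² X Y sZ sO o<z valid r (Equivalence.to (step-ballot s 0 [ false ]) b) p₁ p′
∼⇒≡² X Y sZ sO o<z valid (bwd s ◅ r) b p p′ with step-shuffle⁻ s p
... | _ , p₁ = bwd (step-generator s X Y sZ sO o<z p₁ p (proj₁ (valid p₁ b₁)) (proj₂ (valid p₁ b₁)))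
  ◅ ∼⇒≡² X Y sZ sO o<z valid r b₁ p₁ p′
  where b₁ = Equivalence.from (step-ballot s 0 [ false ]) b

block-∷ʳ : ∀ c x y → block c x y ++ [ false ] ≡ zeros (c + x) ++ ones c ++ zeros (suc y)
block-∷ʳ c x y = trans (List.++-assoc (zeros (c + x)) (ones c ++ zeros y) [ false ])
  (cong (zeros (c + x) ++_) (trans (List.++-assoc (ones c) (zeros y) [ false ])
    (cong (ones c ++_) (trans (replicate-shift y false []) (List.++-identityʳ (zeros (suc y)))))))

block-ballot : ∀ c x y → Ballot 0 (block c x y ++ [ false ])
block-ballot c x y = subst (Ballot 0) (sym (block-∷ʳ c x y)) (ballot-++ 0 (c + x)
  (subst (λ h → Ballot h (ones c ++ zeros (suc y))) (sym (+-identityʳ (c + x)))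
    (ballot-ones x c (ballot-zeros x (suc y)))))

module SlinkPath {μ m R} (F : Family μ m R) {q} (bad : FirstBad m R (suc (suc q))) where

  p j : ℕ
  p = suc q
  j = suc p

  open Family F
  open FamilyProperties F
  open BadFamily F bad hiding (bad)
  open BadLast F bad
  open AssembledFamily F using (L; L↭cells; rows-before; columns-before)

  X Y Z O D M₀ : List Cell
  X = concat (map R [1⋯ q ])
  Y = concat (map R (map (q +_) (applyUpTo (λ i → 3 + i) (m ∸ j))))
  Z = belows p
  O = upper p
  D = lower p
  M₀ = R p ++ (O ++ D)

  p<j : p < j
  p<j = n<1+n p

  indices : [1⋯ m ] ≡ [1⋯ q ] ++ p ∷ j ∷ map (q +_) (applyUpTo (λ i → 3 + i) (m ∸ j))
  indices = begin
    [1⋯ m ] ≡⟨ cong [1⋯_] (m+[n∸m]≡n j≤m) ⟨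
    [1⋯ suc (suc (q + (m ∸ j))) ] ≡⟨ cong [1⋯_] (trans (+-suc q (suc (m ∸ j))) (cong suc (+-suc q (m ∸ j)))) ⟨
    [1⋯ q + suc (suc (m ∸ j)) ] ≡⟨ [1⋯+] q (suc (suc (m ∸ j))) ⟩
    [1⋯ q ] ++ (q + 1) ∷ (q + 2) ∷ rest ≡⟨ cong₂ (λ a b → [1⋯ q ] ++ a ∷ b ∷ rest) (+-comm q 1) (+-comm q 2) ⟩
    [1⋯ q ] ++ p ∷ j ∷ rest ∎
    where
    open ≡-Reasoning
    rest = map (q +_) (applyUpTo (λ i → 3 + i) (m ∸ j))

  assembled-split : ∀ {N} → (∀ {r} → r ≢ p → r ≢ j → N r ≡ R r) → concat (map N [1⋯ m ]) ≡ X ++ (N p ++ N j) ++ Y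
  assembled-split {N} same = begin
    concat (map N [1⋯ m ]) ≡⟨ cong (concat ∘ map N) indices ⟩
    concat (map N ([1⋯ q ] ++ p ∷ j ∷ rest)) ≡⟨ cong concat (List.map-++ N [1⋯ q ] _) ⟩
    concat (map N [1⋯ q ] ++ N p ∷ N j ∷ map N rest) ≡⟨ List.concat-++ (map N [1⋯ q ]) _ ⟨
    concat (map N [1⋯ q ]) ++ N p ++ N j ++ concat (map N rest) ≡⟨ cong₂ (λ as bs → concat as ++ N p ++ N j ++ concat bs) before after ⟩
    X ++ N p ++ N j ++ Y ≡⟨ cong (X ++_) (List.++-assoc (N p) (N j) Y) ⟨
    X ++ (N p ++ N j) ++ Y ∎
    where
    open ≡-Reasoning
    rest = map (q +_) (applyUpTo (λ i → 3 + i) (m ∸ j))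
    before : map N [1⋯ q ] ≡ map R [1⋯ q ]
    before = List.map-cong-local (All.tabulate λ r∈ → let r<p = s≤s (proj₂ (∈-[1⋯]⁻ r∈)) in same (<⇒≢ r<p) (<⇒≢ (<-trans r<p p<j)))
    after : map N rest ≡ map R rest
    after = List.map-cong-local (All.map⁺ (All.applyUpTo⁺₁ (λ i → 3 + i) (m ∸ j) λ {i} _ →
      let j< : j < q + (3 + i)
          j< = subst (j <_) (+-comm (3 + i) q) (+-monoˡ-≤ q (m≤m+n 3 i))
      in same (>⇒≢ (<-trans p<j j<)) (>⇒≢ j<)))

  L≡ : L ≡ X ++ M₀ ++ Y
  L≡ = trans (assembled-split {R} λ _ _ → refl) (cong (λ xs → X ++ (R p ++ xs) ++ Y) (run-j≡ p))

  Z-sorted : AllPairs _<ᵣ_ Z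
  Z-sorted = belows-sorted p<j

  O<Z : ∀ {o z} → o ∈ O → z ∈ Z → o <ᵣ z
  O<Z o∈ z∈ = inj₁ (≤-<-trans (proj₂ (∈-belows⁻ p<j z∈)) (proj₂ (∈-upper⁻ p o∈)))

  module _ {s M} (sh : Shuffle s Z O M) (ballot : Ballot 0 s) where

    M↭ : M ↭ M₀
    M↭ = ↭-trans (shuffle-↭ sh) (↭-sym (shuffle-↭ (shuffle-block (R p) O D)))

    XMY↭ : X ++ M ++ Y ↭ cells μ
    XMY↭ = ↭-trans (Perm.++⁺ˡ X (Perm.++⁺ʳ Y M↭)) (↭-trans (↭-reflexive (sym L≡)) L↭cells)

    column-before : ∀ {c c′} → c ∈ R p → c′ ∈ O → col c ≡ col c′ → Before c c′ M
    column-before {c} {c′} c∈ c′∈ eq with ∈-∃++ c∈ | ∈-∃++ c′∈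
    ... | Z₁ , Z₂ , Rp≡ | O₁ , O₂ , O≡ = ballot-before sh ballot Z₁ O₁ Z≡ O≡ (subst (_≤ length O₁) (sym (+-identityʳ (length Z₁))) Z₁≤O₁)
      where
      Z≡ : Z ≡ Z₁ ++ c ∷ (Z₂ ++ D)
      Z≡ = trans (cong (_++ D) Rp≡) (List.++-assoc Z₁ (c ∷ Z₂) D)
      c′∈j : c′ ∈ R j
      c′∈j = proj₁ (∈-upper⁻ p c′∈)
      row-c′ : row c′ ≡ j
      row-c′ = ≤-antisym (row-≤-run F c′∈j) (proj₂ (∈-upper⁻ p c′∈))
      Z₁-sorted : AllPairs _<ᵣ_ (Z₁ ++ c ∷ Z₂)
      Z₁-sorted = subst (AllPairs _<ᵣ_) Rp≡ (sorted p)
      left-of-c′ : ∀ {z} → z ∈ Z₁ → z ∈ R p → col z < col c′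
      left-of-c′ {z} z∈ z∈p with sorted-++⁻ Z₁-sorted z∈ (here refl)
      ... | inj₁ lt       = contradiction (subst₂ _<_ (rowed p<j c∈) (rowed p<j z∈p) lt) (<-irrefl refl)
      ... | inj₂ (_ , lt) = subst (col z <_) eq lt
      in-O₁ : ∀ {k} → k < col c′ → (j , k) ∈ O₁ ++ c′ ∷ O₂ → (j , k) ∈ O₁
      in-O₁ k< d∈ with ∈-++⁻ O₁ d∈
      ... | inj₁ d∈O₁         = d∈O₁
      ... | inj₂ (here refl)  = contradiction k< (<-irrefl refl)
      ... | inj₂ (there d∈O₂) = contradiction
        (sorted-++⁻ (subst (AllPairs _<ᵣ_) (trans O≡ (sym (List.++-assoc O₁ [ c′ ] O₂))) (upper-sorted p)) (∈-++⁺ʳ O₁ (here refl)) d∈O₂)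
        (<ᵣ-asym (inj₂ (sym row-c′ , k<)))
      up-∈ : ∀ {z} → z ∈ Z₁ → (j , col z) ∈ O₁
      up-∈ {z} z∈ with subst (z ∈_) (sym Rp≡) (∈-++⁺ˡ z∈)
      ... | z∈p with left-of-c′ z∈ z∈p
      ...   | z< with cover (cells-down partition {j} {j} (subst (λ r → (r , col c′) ∈ cells μ) row-c′ (⊆-cells c′∈j))
                     z<s ≤-refl (proj₂ (cell-positive {μ} (⊆-cells z∈p))) (<⇒≤ z<))
      ...     | s , d∈ = in-O₁ z< (subst ((j , col z) ∈_) O≡ (∈-upper⁺ p
        (subst (λ r → (j , col z) ∈ R r) (≤-antisym (rows-mono d∈ c′∈j (sym row-c′) z<) (row-≤-run F d∈)) d∈) ≤-refl))
      Z₁≤O₁ : length Z₁ ≤ length O₁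
      Z₁≤O₁ = strip-length {r = p} {x = j} (tabulate-before λ b → sorted-before⁻ Z₁-sorted (before-++⁺ˡ b))
        (λ z∈ → subst (_ ∈_) (sym Rp≡) (∈-++⁺ˡ z∈)) up-∈

    transfer : ∀ {c c′} → row c ≤ row c′ → (c ∈ R p → c′ ∈ O → Before c c′ M) → Before c c′ L → Before c c′ (X ++ M ++ Y)
    transfer {c} {c′} row≤ ballot-case b with before-++⁻ X (subst (Before c c′) L≡ b)
    ... | inj₁ bX               = before-++⁺ˡ bX
    ... | inj₂ (inj₁ (c∈ , c′∈)) = before-++⁺ c∈ (Perm.∈-resp-↭ (↭-sym (Perm.++⁺ʳ Y M↭)) c′∈)
    ... | inj₂ (inj₂ b′) = before-++⁺ʳ X (go (before-++⁻ M₀ b′))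
      where
      in-O++D : Before c c′ O ⊎ (c ∈ O × c′ ∈ D) ⊎ Before c c′ D → Before c c′ M
      in-O++D (inj₁ bO)                = shuffle-beforeʳ sh bO
      in-O++D (inj₂ (inj₁ (c∈ , c′∈))) = contradiction row≤
        (<⇒≱ (≤-<-trans (proj₂ (∈-lower⁻ p c′∈)) (proj₂ (∈-upper⁻ p c∈))))
      in-O++D (inj₂ (inj₂ bD))         = shuffle-beforeˡ sh (before-++⁺ʳ (R p) bD)
      in-M₀ : Before c c′ (R p) ⊎ (c ∈ R p × c′ ∈ O ++ D) ⊎ Before c c′ (O ++ D) → Before c c′ M
      in-M₀ (inj₁ bR)                = shuffle-beforeˡ sh (before-++⁺ˡ bR)
      in-M₀ (inj₂ (inj₁ (c∈ , c′∈))) with ∈-++⁻ O c′∈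
      ... | inj₁ c′∈O = ballot-case c∈ c′∈O
      ... | inj₂ c′∈D = shuffle-beforeˡ sh (before-++⁺ c∈ c′∈D)
      in-M₀ (inj₂ (inj₂ b″))         = in-O++D (before-++⁻ O b″)
      go : Before c c′ M₀ ⊎ (c ∈ M₀ × c′ ∈ Y) ⊎ Before c c′ Y → Before c c′ (M ++ Y)
      go (inj₁ bM)                = before-++⁺ˡ (in-M₀ (before-++⁻ (R p) bM))
      go (inj₂ (inj₁ (c∈ , c′∈))) = before-++⁺ (Perm.∈-resp-↭ (↭-sym M↭) c∈) c′∈
      go (inj₂ (inj₂ bY))         = before-++⁺ʳ M bY

    shuffled-standard : Standard μ (label (X ++ M ++ Y))
    shuffled-standard = linear⇒Standard partition XMY↭
      (λ c′∈ c∈ → transfer ≤-refl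
        (λ c∈p c′∈O → contradiction (rowed p<j c∈p) (>⇒≢ (proj₂ (∈-upper⁻ p c′∈O)))) (rows-before c′∈ c∈))
      (λ c′∈ c∈ → transfer (n≤1+n _) (λ c∈p c′∈O → column-before c∈p c′∈O refl) (columns-before c′∈ c∈))

  module _ {N : ℕ → List Cell} (N≡ : ∀ r → N r ≡ moveCells R p j (length (R j) ∸ 1) r) where
    open Move p≥1 (n<1+n p) slink-count slink-fits N≡ using (N-first; N-second; N-other; length-first)

    k c a e : ℕ
    k = length (R j) ∸ 1
    c = length O
    a = length (R p) ∸ c
    e = length D ∸ 1

    Rp≡ : length (R p) ≡ c + a
    Rp≡ = sym (m+[n∸m]≡n (upper-length p≥1 p<j))

    D≡ : length D ≡ suc e
    D≡ = sym (m+[n∸m]≡n lower-nonempty)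

    k≡ : k ≡ c + e
    k≡ = cong pred (trans (length-run-j p) (trans (cong (c +_) D≡) (+-suc c e)))

    drop≡ : length (drop k Z) ≡ suc a
    drop≡ = begin
      length (drop k Z) ≡⟨ List.length-drop k Z ⟩
      length Z ∸ k ≡⟨ cong₂ _∸_ (trans (List.length-++ (R p)) (cong₂ _+_ Rp≡ D≡)) k≡ ⟩
      (c + a + suc e) ∸ (c + e) ≡⟨ cong (_∸ (c + e)) (trans (+-assoc c a (suc e)) (cong (c +_) (trans (+-suc a e) (cong suc (+-comm a e))))) ⟩
      (c + (suc e + a)) ∸ (c + e) ≡⟨ [m+n]∸[m+o]≡n∸o c (suc e + a) e ⟩
      (suc e + a) ∸ e ≡⟨ cong (_∸ e) (trans (cong suc (+-comm e a)) (+-comm (suc a) e)) ⟩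
      (e + suc a) ∸ e ≡⟨ m+n∸m≡n e (suc a) ⟩
      suc a ∎
      where open ≡-Reasoning

    shuffle₀ : Shuffle (block c a e ++ [ false ]) Z O M₀
    shuffle₀ = subst (λ w → Shuffle w Z O M₀)
      (trans (cong₂ (λ x y → zeros x ++ ones c ++ zeros y) Rp≡ D≡) (sym (block-∷ʳ c a e)))
      (shuffle-block (R p) O D)

    shuffle₁ : Shuffle (block c e a ++ [ false ]) Z O (take k Z ++ O ++ drop k Z)
    shuffle₁ = subst₂ (λ w Z → Shuffle w Z O (take k (belows p) ++ O ++ drop k (belows p)))
      (trans (cong₂ (λ x y → zeros x ++ ones c ++ zeros y) (trans length-first k≡) drop≡) (sym (block-∷ʳ c e a)))
      (List.take++drop≡id k Z)
      (shuffle-block (take k Z) O (drop k Z))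

    slink-path : assemble μ m R ≡² assemble μ m N
    slink-path = subst₂ _≡²_
      (trans (cong (tab μ) (sym L≡)) (sym (fromRuns≡tab μ (map R [1⋯ m ]))))
      (trans (cong (tab μ) (sym (trans (assembled-split {N} N-other) (cong₂ (λ xs ys → X ++ (xs ++ ys) ++ Y) N-first N-second))))
        (sym (fromRuns≡tab μ (map N [1⋯ m ]))))
      (∼⇒≡² X Y Z-sorted (upper-sorted p) O<Z (λ sh b → XMY↭ sh b , shuffled-standard sh b)
        (block-swap c a e) (block-ballot c a e) shuffle₀ shuffle₁)

slink-≡² : ∀ {T} → IsSYT T → T ≡² slink T
slink-≡² {T} syt = go (firstBadRun T) refl
  where
  open SYTRuns syt
  go : ∀ mj → firstBadRun T ≡ mj → T ≡² slink T
  go nothing        eq = subst (T ≡²_) (cong (maybe′ (slinkAt T) T) (sym eq)) ε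
  go (just zero)    eq = contradiction (FirstBad.j≥1 (firstBad⁻ eq)) λ ()
  go (just (suc zero)) eq = contradiction (BadLast.p≥1 {R = run T} family (firstBad⁻ eq)) λ ()
  go (just (suc (suc q))) eq = subst₂ _≡²_ (sym assembled) (sym (slink≡ eq))
    (SlinkPath.slink-path {R = run T} family {q} (firstBad⁻ eq) λ _ → refl)

≡¹⇒≡² : ∀ {T T′} → T ≡¹ T′ → T ≡² T′
≡¹⇒≡² = EqC.fold (EqC.isEquivalence Generator²) λ { (syt , refl) → slink-≡² syt }

theorem2p13 : ∀ {T T′ : Tableau} → IsSYT T → IsSYT T′ →
    (T ≡⁰ T′ → T ≡¹ T′) × (T ≡¹ T′ → T ≡² T′)
theorem2p13 _ _ = ≡⁰⇒≡¹ , ≡¹⇒≡²
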